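{- The $3$-graph $F_5$ is not $(2,1/2)$-vertex-extendable with respect to $\mathfrak{K}_3^3$, where $\mathfrak{K}_3^3$ is the collection of all $3$-partite $3$-graphs.
   Context: A $3$-graph $\mathcal{H}$ consists of a finite vertex set $V(\mathcal{H})$ and a collection of $3$-subsets of $V(\mathcal{H})$ (its edges). $F_5$ is the $3$-graph on vertex set $\{1,2,3,4,5\}$ with edges $\{1,2,3\},\{1,2,4\},\{3,4,5\}$. A $3$-graph is $F_5$-free if it contains no copy of $F_5$ as a (not necessarily induced) subgraph. A $3$-graph is $3$-partite if its vertex set can be partitioned into three parts so that every edge contains exactly one vertex from each part. For $T\subset V(\mathcal{H})$, $d_{\mathcal{H}}(T)$ is the number of edges containing $T$. For real $p>0$, $\|\mathcal{H}\|_{2,p}:=\sum_{T\in\binom{V(\mathcal{H})}{2}}d_{\mathcal{H}}(T)^p$. The $(2,p)$-degree of a vertex $v$ is $\|\mathcal{H}\|_{2,p}-\|\mathcal{H}-v\|_{2,p}$, where $\mathcal{H}-v$ is obtained by removing $v$ and all edges containing it; $\delta_{2,p}(\mathcal{H})$ is the minimum $(2,p)$-degree. $\mathrm{ex}_{2,p}(n,F_5)$ is the maximum of $\|\mathcal{H}\|_{2,p}$ over $n$-vertex $F_5$-free $3$-graphs, and $\mathrm{exdeg}_{2,p}(n,F_5):=(2+p)\cdot\mathrm{ex}_{2,p}(n,F_5)/n$. For a family $\mathfrak{H}$ of $F_5$-free $3$-graphs closed under taking subgraphs, $F_5$ is $(2,p)$-vertex-extendable with respect to $\mathfrak{H}$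 if there exist $\varepsilon>0$ and $N_0$ such that the following holds for every $F_5$-free $3$-graph $\mathcal{H}$ on $n\ge N_0$ vertices with $\delta_{2,p}(\mathcal{H})\ge(1-\varepsilon)\cdot\mathrm{exdeg}_{2,p}(n,F_5)$: if $\mathcal{H}-v\in\mathfrak{H}$ for some $v\in V(\mathcal{H})$, then $\mathcal{H}\in\mathfrak{H}$. -}

module Defs where

open import Data.Bool using (Bool; T; T?)
open import Data.Bool.Properties using () renaming (_≟_ to _≟ᴮ_)
open import Data.Empty using () renaming (⊥-elim to absurd)
open import Data.Fin using (Fin; zero; suc)
open import Data.Fin.Patterns using (0F; 1F; 2F; 3F; 4F)
open import Data.Fin.Properties using (any?; all?) renaming (_≟_ to _≟ᶠ_)
open import Data.Fin.Subset
  using (Subset; inside; outside; ⊥; ⁅_⁆; _∪_; _∈_; ∣_∣)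
open import Data.Fin.Subset.Properties
  using (_⊆?_; anySubset?; ∉⊥; x∈⁅x⁆; x∈⁅y⁆⇒x≡y; x∈p∪q⁺; x∈p∪q⁻)
open import Data.Integer as ℤ using (+_)
open import Data.List using (List; []; _∷_; [_]; _++_; map; filter; foldr; length)
open import Data.List.Membership.Propositional using () renaming (_∈_ to _∈ᴸ_)
open import Data.List.Membership.DecPropositional using () renaming (_∈?_ to mem?)
open import Data.Nat as ℕ using (ℕ; zero; suc; NonZero)
open import Data.Product using (Σ; ∃; ∃!; _×_; _,_; proj₁; proj₂)
open import Data.Rational as ℚ using (ℚ; mkℚ; 0ℚ; 1ℚ; ½; ↥_; ↧ₙ_; Positive)
import Data.Integer.Properties as ℤ
import Data.Nat.Properties as ℕ
import Data.Rational.Properties as ℚ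
import Data.Integer.Solver as ℤ
import Data.Nat.Solver as ℕ
import Data.Rational.Solver as ℚ
open import Data.Rational.Unnormalised as ℚᵘ using (mkℚᵘ; *≤*; *≡*)
import Data.Rational.Unnormalised.Properties as ℚᵘ
open import Data.Sum using (inj₁; inj₂)
open import Data.Vec using (Vec; []; _∷_; insertAt; lookup; tabulate; here; there)
open import Data.Vec.Properties using (≡-dec; lookup∘tabulate)
open import Function using (_∘_)
open import Function.Definitions using (Injective)
open import Relation.Binary.PropositionalEquality
  using (_≡_; refl; sym; trans; cong; cong₂; subst; subst₂)
open import Relation.Nullary using (¬_; Dec; yes; no)
open import Relation.Nullary.Decidable using (map′; ¬?; _×-dec_; _→-dec_; ⌊_⌋; toWitness; decidable-stable)
open import Relation.Unary using (Decidable)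

private variable
  k m n : ℕ

halves : ∀ ε → ½ ℚ.* ε ℚ.+ ½ ℚ.* ε ≡ ε
halves ε = trans (sym (ℚ.*-distribʳ-+ ε ½ ½)) (ℚ.*-identityˡ ε)

half>0 : ∀ {ε} → 0ℚ ℚ.< ε → 0ℚ ℚ.< ½ ℚ.* ε
half>0 {ε} 0<ε = subst (ℚ._< ½ ℚ.* ε) (ℚ.*-zeroʳ ½) (ℚ.*-monoʳ-<-pos ½ 0<ε)

module _ where
  open ℚ.+-*-Solver

  +-diff : ∀ a b c d → (a ℚ.- c) ℚ.+ (b ℚ.- d) ≡ (a ℚ.+ b) ℚ.- (c ℚ.+ d)
  +-diff = solve 4 (λ a b c d → (a :- c) :+ (b :- d) := (a :+ b) :- (c :+ d)) refl

  *-diff : ∀ a b c d → a ℚ.* (b ℚ.- d) ℚ.+ d ℚ.* (a ℚ.- c) ≡ a ℚ.* b ℚ.- c ℚ.* d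
  *-diff = solve 4 (λ a b c d → a :* (b :- d) :+ d :* (a :- c) := a :* b :- c :* d) refl

  +-cancel : ∀ a b → a ℚ.+ (b ℚ.- a) ≡ b
  +-cancel = solve 2 (λ a b → a :+ (b :- a) := b) refl

∣-∣≤⇒≤+ : ∀ {ε} p q → ℚ.∣ p ℚ.- q ∣ ℚ.≤ ε → p ℚ.≤ q ℚ.+ ε
∣-∣≤⇒≤+ {ε} p q h = subst (ℚ._≤ q ℚ.+ ε)
  (solve 2 (λ p q → q :+ (p :- q) := p) refl p q)
  (ℚ.+-monoʳ-≤ q (ℚ.≤-trans (p≤∣p∣ (p ℚ.- q)) h))
  where
  open ℚ.+-*-Solver
  p≤∣p∣ : ∀ p → p ℚ.≤ ℚ.∣ p ∣
  p≤∣p∣ p with ℚ.≤-total 0ℚ p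
  ... | inj₁ 0≤p = ℚ.≤-reflexive (sym (ℚ.0≤p⇒∣p∣≡p 0≤p))
  ... | inj₂ p≤0 = ℚ.≤-trans p≤0 (ℚ.0≤∣p∣ p)

≤+⇒-≤ : ∀ {ε} p q → p ℚ.≤ q ℚ.+ ε → p ℚ.- q ℚ.≤ ε
≤+⇒-≤ {ε} p q h = subst (p ℚ.- q ℚ.≤_)
  (solve 2 (λ q ε → (q :+ ε) :- q := ε) refl q ε)
  (ℚ.+-monoˡ-≤ (ℚ.- q) h)
  where open ℚ.+-*-Solver

≤+⇒∣-∣≤ : ∀ {ε} p q → p ℚ.≤ q ℚ.+ ε → q ℚ.≤ p ℚ.+ ε → ℚ.∣ p ℚ.- q ∣ ℚ.≤ ε
≤+⇒∣-∣≤ {ε} p q h₁ h₂ with ℚ.∣p∣≡p∨∣p∣≡-p (p ℚ.- q)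
... | inj₁ e = subst (ℚ._≤ ε) (sym e) (≤+⇒-≤ p q h₁)
... | inj₂ e = subst (ℚ._≤ ε)
  (trans (solve 2 (λ p q → q :- p := :- (p :- q)) refl p q) (sym e))
  (≤+⇒-≤ q p h₂)
  where open ℚ.+-*-Solver

⊔-near : ∀ {ε} p q r s → ℚ.∣ p ℚ.- r ∣ ℚ.≤ ε → ℚ.∣ q ℚ.- s ∣ ℚ.≤ ε →
         ℚ.∣ (p ℚ.⊔ q) ℚ.- (r ℚ.⊔ s) ∣ ℚ.≤ ε
⊔-near {ε} p q r s h₁ h₂ = ≤+⇒∣-∣≤ (p ℚ.⊔ q) (r ℚ.⊔ s)
  (one p q r s (∣-∣≤⇒≤+ p r h₁) (∣-∣≤⇒≤+ q s h₂))
  (one r s p q (∣-∣≤⇒≤+ r p (flip p r h₁)) (∣-∣≤⇒≤+ s q (flip q s h₂)))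
  where
  flip : ∀ a b → ℚ.∣ a ℚ.- b ∣ ℚ.≤ ε → ℚ.∣ b ℚ.- a ∣ ℚ.≤ ε
  flip a b = subst (ℚ._≤ ε) (trans (sym (ℚ.∣-p∣≡∣p∣ (a ℚ.- b)))
    (cong ℚ.∣_∣ (solve 2 (λ a b → :- (a :- b) := b :- a) refl a b)))
    where open ℚ.+-*-Solver
  one : ∀ p q r s → p ℚ.≤ r ℚ.+ ε → q ℚ.≤ s ℚ.+ ε → p ℚ.⊔ q ℚ.≤ (r ℚ.⊔ s) ℚ.+ ε
  one p q r s a b = ℚ.⊔-lub
    (ℚ.≤-trans a (ℚ.+-monoˡ-≤ ε (ℚ.p≤p⊔q r s)))
    (ℚ.≤-trans b (ℚ.+-monoˡ-≤ ε (ℚ.p≤q⊔p r s)))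

------------------------------------------------------------------------
-- Real numbers: Cauchy sequences of rationals, with equality left implicit
-- (x equals y when x ≤ℝ y and y ≤ℝ x).

record ℝ : Set where
  field
    seq    : ℕ → ℚ
    cauchy : ∀ ε → 0ℚ ℚ.< ε → ∃ λ N → ∀ i j → N ℕ.≤ i → N ℕ.≤ j →
             ℚ.∣ seq i ℚ.- seq j ∣ ℚ.≤ ε

open ℝ public

infix  4 _≤ℝ_ _<ℝ_
infixl 6 _+ℝ_ _-ℝ_ _⊔ℝ_ _⊓ℝ_
infixl 7 _*ℝ_
infix  8 -ℝ_

_≤ℝ_ : ℝ → ℝ → Set
x ≤ℝ y = ∀ ε → 0ℚ ℚ.< ε → ∃ λ N → ∀ i → N ℕ.≤ i → seq x i ℚ.≤ seq y i ℚ.+ ε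

_<ℝ_ : ℝ → ℝ → Set
x <ℝ y = ∃ λ ε → 0ℚ ℚ.< ε × ∃ λ N → ∀ i → N ℕ.≤ i → seq x i ℚ.+ ε ℚ.≤ seq y i

fromℚ : ℚ → ℝ
fromℚ q = record
  { seq    = λ _ → q
  ; cauchy = λ ε 0<ε → 0 , λ _ _ _ _ →
      subst (λ z → ℚ.∣ z ∣ ℚ.≤ ε) (sym (ℚ.+-inverseʳ q)) (ℚ.<⇒≤ 0<ε)
  }

0ℝ 1ℝ : ℝ
0ℝ = fromℚ 0ℚ
1ℝ = fromℚ 1ℚ

_+ℝ_ : ℝ → ℝ → ℝ
x +ℝ y = record { seq = λ i → seq x i ℚ.+ seq y i ; cauchy = c }
  where
  c : ∀ ε → 0ℚ ℚ.< ε → ∃ λ N → ∀ i j → N ℕ.≤ i → N ℕ.≤ j →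
      ℚ.∣ (seq x i ℚ.+ seq y i) ℚ.- (seq x j ℚ.+ seq y j) ∣ ℚ.≤ ε
  c ε 0<ε with cauchy x (½ ℚ.* ε) (half>0 0<ε) | cauchy y (½ ℚ.* ε) (half>0 0<ε)
  ... | N₁ , h₁ | N₂ , h₂ = N₁ ℕ.⊔ N₂ , λ i j Ni Nj → subst₂ ℚ._≤_
    (cong ℚ.∣_∣ (+-diff (seq x i) (seq y i) (seq x j) (seq y j)))
    (halves ε)
    (ℚ.≤-trans (ℚ.∣p+q∣≤∣p∣+∣q∣ (seq x i ℚ.- seq x j) (seq y i ℚ.- seq y j))
      (ℚ.+-mono-≤
        (h₁ i j (ℕ.m⊔n≤o⇒m≤o N₁ N₂ Ni) (ℕ.m⊔n≤o⇒m≤o N₁ N₂ Nj))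
        (h₂ i j (ℕ.m⊔n≤o⇒n≤o N₁ N₂ Ni) (ℕ.m⊔n≤o⇒n≤o N₁ N₂ Nj))))

-ℝ_ : ℝ → ℝ
-ℝ x = record
  { seq    = λ i → ℚ.- seq x i
  ; cauchy = λ ε 0<ε → let N , h = cauchy x ε 0<ε in N , λ i j Ni Nj →
      subst (ℚ._≤ ε)
        (trans (sym (ℚ.∣-p∣≡∣p∣ (seq x i ℚ.- seq x j)))
               (cong ℚ.∣_∣ (ℚ.neg-distrib-+ (seq x i) (ℚ.- seq x j))))
        (h i j Ni Nj)
  }

_-ℝ_ : ℝ → ℝ → ℝ
x -ℝ y = x +ℝ -ℝ y

_⊔ℝ_ : ℝ → ℝ → ℝ
x ⊔ℝ y = record
  { seq    = λ i → seq x i ℚ.⊔ seq y i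
  ; cauchy = λ ε 0<ε →
      let N₁ , h₁ = cauchy x ε 0<ε
          N₂ , h₂ = cauchy y ε 0<ε
      in N₁ ℕ.⊔ N₂ , λ i j Ni Nj → ⊔-near {ε} (seq x i) (seq y i) (seq x j) (seq y j)
        (h₁ i j (ℕ.m⊔n≤o⇒m≤o N₁ N₂ Ni) (ℕ.m⊔n≤o⇒m≤o N₁ N₂ Nj))
        (h₂ i j (ℕ.m⊔n≤o⇒n≤o N₁ N₂ Ni) (ℕ.m⊔n≤o⇒n≤o N₁ N₂ Nj))
  }

_⊓ℝ_ : ℝ → ℝ → ℝ
x ⊓ℝ y = -ℝ (-ℝ x ⊔ℝ -ℝ y)

bounded : ∀ x → ∃ λ N → Σ ℚ λ B → Positive B × (∀ i → N ℕ.≤ i → ℚ.∣ seq x i ∣ ℚ.≤ B)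
bounded x with cauchy x 1ℚ (ℚ.positive⁻¹ 1ℚ)
... | N , h = N , ℚ.∣ seq x N ∣ ℚ.+ 1ℚ
  , ℚ.nonNeg+pos⇒pos ℚ.∣ seq x N ∣ {{ℚ.nonNegative (ℚ.0≤∣p∣ (seq x N))}} 1ℚ
  , λ i Ni → subst₂ ℚ._≤_
      (cong ℚ.∣_∣ (+-cancel (seq x N) (seq x i))) refl
      (ℚ.≤-trans (ℚ.∣p+q∣≤∣p∣+∣q∣ (seq x N) (seq x i ℚ.- seq x N))
        (ℚ.+-monoʳ-≤ ℚ.∣ seq x N ∣ (h i N Ni ℕ.≤-refl)))

scaled : ∀ B .{{_ : Positive B}} {ε} → 0ℚ ℚ.< ε →
         Σ ℚ λ δ → 0ℚ ℚ.< δ × B ℚ.* δ ≡ ε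
scaled B {ε} 0<ε = 1/B ℚ.* ε , 0<δ , eq
  where
  instance
    nz : ℚ.NonZero B
    nz = ℚ.pos⇒nonZero B
  1/B : ℚ
  1/B = ℚ.1/ B
  0<δ : 0ℚ ℚ.< 1/B ℚ.* ε
  0<δ = subst (ℚ._< 1/B ℚ.* ε) (ℚ.*-zeroʳ 1/B)
    (ℚ.*-monoʳ-<-pos 1/B {{ℚ.1/pos⇒pos B}} 0<ε)
  eq : B ℚ.* (1/B ℚ.* ε) ≡ ε
  eq = trans (sym (ℚ.*-assoc B 1/B ε))
    (trans (cong (ℚ._* ε) (ℚ.*-inverseʳ B)) (ℚ.*-identityˡ ε))

*-near : ∀ {B δ} p q → 0ℚ ℚ.≤ B → ℚ.∣ p ∣ ℚ.≤ B → ℚ.∣ q ∣ ℚ.≤ δ → ℚ.∣ p ℚ.* q ∣ ℚ.≤ B ℚ.* δ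
*-near {B} {δ} p q 0≤B hp hq = subst (ℚ._≤ B ℚ.* δ) (sym (ℚ.∣p*q∣≡∣p∣*∣q∣ p q))
  (ℚ.≤-trans {j = B ℚ.* ℚ.∣ q ∣} (ℚ.*-monoʳ-≤-nonNeg ℚ.∣ q ∣ {{ℚ.nonNegative (ℚ.0≤∣p∣ q)}} hp)
             (ℚ.*-monoˡ-≤-nonNeg B {{ℚ.nonNegative 0≤B}} hq))

*-close : ∀ B δ C η a b c d → 0ℚ ℚ.≤ B → 0ℚ ℚ.≤ C →
          ℚ.∣ a ∣ ℚ.≤ B → ℚ.∣ b ℚ.- d ∣ ℚ.≤ δ → ℚ.∣ d ∣ ℚ.≤ C → ℚ.∣ a ℚ.- c ∣ ℚ.≤ η →
          ℚ.∣ a ℚ.* b ℚ.- c ℚ.* d ∣ ℚ.≤ B ℚ.* δ ℚ.+ C ℚ.* η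
*-close B δ C η a b c d 0≤B 0≤C ha hb hd hc =
  subst (λ z → ℚ.∣ z ∣ ℚ.≤ B ℚ.* δ ℚ.+ C ℚ.* η) (*-diff a b c d)
    (ℚ.≤-trans (ℚ.∣p+q∣≤∣p∣+∣q∣ (a ℚ.* (b ℚ.- d)) (d ℚ.* (a ℚ.- c)))
      (ℚ.+-mono-≤ (*-near {B} {δ} a (b ℚ.- d) 0≤B ha hb)
                  (*-near {C} {η} d (a ℚ.- c) 0≤C hd hc)))

_*ℝ_ : ℝ → ℝ → ℝ
x *ℝ y = record { seq = λ i → seq x i ℚ.* seq y i ; cauchy = c }
  where
  c : ∀ ε → 0ℚ ℚ.< ε → ∃ λ N → ∀ i j → N ℕ.≤ i → N ℕ.≤ j →
      ℚ.∣ (seq x i ℚ.* seq y i) ℚ.- (seq x j ℚ.* seq y j) ∣ ℚ.≤ ε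
  c ε 0<ε =
    let K , B , B⁺ , hB = bounded x
        L , C , C⁺ , hC = bounded y
        δ , 0<δ , eδ = scaled B {{B⁺}} {½ ℚ.* ε} (half>0 {ε} 0<ε)
        η , 0<η , eη = scaled C {{C⁺}} {½ ℚ.* ε} (half>0 {ε} 0<ε)
        N₁ , h₁ = cauchy y δ 0<δ
        N₂ , h₂ = cauchy x η 0<η
        KL = K ℕ.⊔ L
        N  = N₁ ℕ.⊔ N₂
    in KL ℕ.⊔ N , λ i j Mi Mj →
      let KLi = ℕ.m⊔n≤o⇒m≤o KL N Mi
          KLj = ℕ.m⊔n≤o⇒m≤o KL N Mj
          Ni  = ℕ.m⊔n≤o⇒n≤o KL N Mi
          Nj  = ℕ.m⊔n≤o⇒n≤o KL N Mj
      in subst (ℚ.∣ (seq x i ℚ.* seq y i) ℚ.- (seq x j ℚ.* seq y j) ∣ ℚ.≤_)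
        (trans (cong₂ ℚ._+_ eδ eη) (halves ε))
        (*-close B δ C η (seq x i) (seq y i) (seq x j) (seq y j)
          (ℚ.<⇒≤ (ℚ.positive⁻¹ B {{B⁺}})) (ℚ.<⇒≤ (ℚ.positive⁻¹ C {{C⁺}}))
          (hB i (ℕ.m⊔n≤o⇒m≤o K L KLi))
          (h₁ i j (ℕ.m⊔n≤o⇒m≤o N₁ N₂ Ni) (ℕ.m⊔n≤o⇒m≤o N₁ N₂ Nj))
          (hC j (ℕ.m⊔n≤o⇒n≤o K L KLj))
          (h₂ i j (ℕ.m⊔n≤o⇒n≤o N₁ N₂ Ni) (ℕ.m⊔n≤o⇒n≤o N₁ N₂ Nj)))

-- iroot b t is the largest r with r ^ b ≤ t.
search : (b t : ℕ) → ℕ → ℕ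
search b t zero    = zero
search b t (suc r) with suc r ℕ.^ b ℕ.≤? t
... | yes _ = suc r
... | no  _ = search b t r

iroot : (b t : ℕ) → ℕ
iroot b t = search b t t

iroot-lower : ∀ b .{{_ : NonZero b}} t → iroot b t ℕ.^ b ℕ.≤ t
iroot-lower b@(suc _) t = go t
  where
  go : ∀ r → search b t r ℕ.^ b ℕ.≤ t
  go zero    = ℕ.z≤n
  go (suc r) with suc r ℕ.^ b ℕ.≤? t
  ... | yes h = h
  ... | no  _ = go r

iroot-upper : ∀ b .{{_ : NonZero b}} t → t ℕ.< suc (iroot b t) ℕ.^ b
iroot-upper b@(suc _) t = go t (ℕ.≤-trans (ℕ.≤-reflexive (sym (ℕ.^-identityʳ (suc t))))
                                          (ℕ.^-monoʳ-≤ (suc t) {1} {b} (ℕ.s≤s ℕ.z≤n)))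
  where
  go : ∀ r → t ℕ.< suc r ℕ.^ b → t ℕ.< suc (search b t r) ℕ.^ b
  go zero    h = h
  go (suc r) h with suc r ℕ.^ b ℕ.≤? t
  ... | yes _ = h
  ... | no  q = go r (ℕ.≰⇒> q)

^-cancel-< : ∀ b x y → x ℕ.^ b ℕ.< y ℕ.^ b → x ℕ.< y
^-cancel-< b x y h = ℕ.≰⇒> λ y≤x → ℕ.<⇒≱ h (ℕ.^-monoˡ-≤ b y≤x)

^-distrib-* : ∀ x y b → (x ℕ.* y) ℕ.^ b ≡ x ℕ.^ b ℕ.* y ℕ.^ b
^-distrib-* x y zero    = refl
^-distrib-* x y (suc b) = trans (cong (x ℕ.* y ℕ.*_) (^-distrib-* x y b))
  (ℕ.[m*n]*[o*p]≡[m*o]*[n*p] x y (x ℕ.^ b) (y ℕ.^ b))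

root-cross : ∀ b .{{_ : NonZero b}} t i j →
  iroot b (t ℕ.* suc i ℕ.^ b) ℕ.* suc j ℕ.≤ suc (iroot b (t ℕ.* suc j ℕ.^ b)) ℕ.* suc i
root-cross b t i j = ℕ.<⇒≤ (^-cancel-< b _ _ (begin-strict
  (r ℕ.* suc j) ℕ.^ b                  ≡⟨ ^-distrib-* r (suc j) b ⟩
  r ℕ.^ b ℕ.* suc j ℕ.^ b              ≤⟨ ℕ.*-monoˡ-≤ (suc j ℕ.^ b) (iroot-lower b (t ℕ.* suc i ℕ.^ b)) ⟩
  t ℕ.* suc i ℕ.^ b ℕ.* suc j ℕ.^ b    ≡⟨ solve 3 (λ t u v → t :* u :* v := t :* v :* u) refl t (suc i ℕ.^ b) (suc j ℕ.^ b) ⟩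
  t ℕ.* suc j ℕ.^ b ℕ.* suc i ℕ.^ b    <⟨ ℕ.*-monoˡ-< (suc i ℕ.^ b) {{ℕ.m^n≢0 (suc i) b}} (iroot-upper b (t ℕ.* suc j ℕ.^ b)) ⟩
  suc s ℕ.^ b ℕ.* suc i ℕ.^ b          ≡⟨ ^-distrib-* (suc s) (suc i) b ⟨
  (suc s ℕ.* suc i) ℕ.^ b              ∎))
  where
  open ℕ.≤-Reasoning
  open ℕ.+-*-Solver
  r = iroot b (t ℕ.* suc i ℕ.^ b)
  s = iroot b (t ℕ.* suc j ℕ.^ b)

/-≤ : ∀ r s i j → r ℕ.* suc j ℕ.≤ s ℕ.* suc i → (+ r) ℚ./ suc i ℚ.≤ (+ s) ℚ./ suc j
/-≤ r s i j h = ℚ.toℚᵘ-cancel-≤ (ℚᵘ.≤-respˡ-≃ (ℚᵘ.≃-sym (ℚ.toℚᵘ-fromℚᵘ (mkℚᵘ (+ r) i)))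
  (ℚᵘ.≤-respʳ-≃ (ℚᵘ.≃-sym (ℚ.toℚᵘ-fromℚᵘ (mkℚᵘ (+ s) j)))
    (*≤* (subst₂ ℤ._≤_ (ℤ.pos-* r (suc j)) (ℤ.pos-* s (suc i)) (ℤ.+≤+ h)))))

suc/ : ∀ s j → (+ suc s) ℚ./ suc j ≡ (+ s) ℚ./ suc j ℚ.+ (+ 1) ℚ./ suc j
suc/ s j = ℚ.toℚᵘ-injective (ℚᵘ.≃-trans (ℚ.toℚᵘ-fromℚᵘ (mkℚᵘ (+ suc s) j))
  (ℚᵘ.≃-trans (*≡* lem)
  (ℚᵘ.≃-trans (ℚᵘ.≃-sym (ℚᵘ.+-cong (ℚ.toℚᵘ-fromℚᵘ (mkℚᵘ (+ s) j)) (ℚ.toℚᵘ-fromℚᵘ (mkℚᵘ (+ 1) j))))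
              (ℚᵘ.≃-sym (ℚ.toℚᵘ-homo-+ ((+ s) ℚ./ suc j) ((+ 1) ℚ./ suc j))))))
  where
  open ℤ.+-*-Solver
  lem : + suc s ℤ.* + (suc j ℕ.* suc j) ≡ (+ s ℤ.* + suc j ℤ.+ + 1 ℤ.* + suc j) ℤ.* + suc j
  lem = trans (cong (+ suc s ℤ.*_) (ℤ.pos-* (suc j) (suc j)))
    (solve 2 (λ a d → (con (+ 1) :+ a) :* (d :* d) := (a :* d :+ con (+ 1) :* d) :* d) refl (+ s) (+ suc j))

1/suc≤ : ∀ {ε} → 0ℚ ℚ.< ε → ∀ i → ↧ₙ ε ℕ.≤ i → (+ 1) ℚ./ suc i ℚ.≤ ε
1/suc≤ {mkℚ (+ zero) _ _} (ℚ.*<* (ℤ.+<+ ()))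
1/suc≤ {mkℚ ℤ.-[1+ _ ] _ _} (ℚ.*<* ())
1/suc≤ {ε@(mkℚ (+ suc a) d _)} _ i d≤i = ℚ.toℚᵘ-cancel-≤
  (ℚᵘ.≤-respˡ-≃ (ℚᵘ.≃-sym (ℚ.toℚᵘ-fromℚᵘ (mkℚᵘ (+ 1) i)))
    (*≤* (subst₂ ℤ._≤_ (ℤ.pos-* 1 (suc d)) (ℤ.pos-* (suc a) (suc i)) (ℤ.+≤+ h))))
  where
  h : 1 ℕ.* suc d ℕ.≤ suc a ℕ.* suc i
  h = ℕ.*-mono-≤ {1} {suc a} {suc d} {suc i} (ℕ.s≤s ℕ.z≤n) (ℕ.≤-trans d≤i (ℕ.n≤1+n i))

-- root b t is the real number t^(1/b): its i-th approximation is the largest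
-- multiple of 1/(i+1) not exceeding it.
root : (b : ℕ) .{{_ : NonZero b}} → ℕ → ℝ
root b t = record { seq = s ; cauchy = λ ε 0<ε → ↧ₙ ε , λ i j Ni Nj →
    ≤+⇒∣-∣≤ {ε} (s i) (s j) (near 0<ε i j Nj) (near 0<ε j i Ni) }
  where
  s : ℕ → ℚ
  s i = (+ iroot b (t ℕ.* suc i ℕ.^ b)) ℚ./ suc i
  near : ∀ {ε} → 0ℚ ℚ.< ε → ∀ i j → ↧ₙ ε ℕ.≤ j → s i ℚ.≤ s j ℚ.+ ε
  near {ε} 0<ε i j Nj = ℚ.≤-trans
    (/-≤ (iroot b (t ℕ.* suc i ℕ.^ b)) (suc (iroot b (t ℕ.* suc j ℕ.^ b))) i j (root-cross b t i j))
    (ℚ.≤-trans (ℚ.≤-reflexive (suc/ (iroot b (t ℕ.* suc j ℕ.^ b)) j))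
      (ℚ.+-monoʳ-≤ (s j) (1/suc≤ 0<ε j Nj)))

-- d ^ℝ p is dᵖ for a rational exponent p = a/b > 0, namely (dᵃ)^(1/b).
infixr 8 _^ℝ_
_^ℝ_ : ℕ → (p : ℚ) .{{_ : Positive p}} → ℝ
d ^ℝ p = root (↧ₙ p) (d ℕ.^ ℤ.∣ ↥ p ∣)

sumℝ : List ℝ → ℝ
sumℝ = foldr _+ℝ_ 0ℝ

minℝ : .{{_ : NonZero n}} → (Fin n → ℝ) → ℝ
minℝ {suc zero}    x = x zero
minℝ {suc (suc n)} x = x zero ⊓ℝ minℝ (x ∘ suc)

------------------------------------------------------------------------
-- 3-graphs on the vertex set Fin n

record ThreeGraph (n : ℕ) : Set where
  field
    edge?   : Subset n → Bool
    uniform : ∀ e → T (edge? e) → ∣ e ∣ ≡ 3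

open ThreeGraph public using (edge?)

Edge : ThreeGraph n → Subset n → Set
Edge H e = T (edge? H e)

-- The 3-graph whose edges are the 3-element members of a list of sets.
fromList : List (Subset n) → ThreeGraph n
fromList es = record
  { edge?   = λ e → ⌊ threeMember? e ⌋
  ; uniform = λ e h → proj₁ (toWitness {a? = threeMember? e} h)
  }
  where
  threeMember? : ∀ e → Dec (∣ e ∣ ≡ 3 × e ∈ᴸ es)
  threeMember? e = (∣ e ∣ ℕ.≟ 3) ×-dec mem? (≡-dec _≟ᴮ_) e es

F₅ : ThreeGraph 5
F₅ = fromList
  ( ⁅ 0F ⁆ ∪ ⁅ 1F ⁆ ∪ ⁅ 2F ⁆
  ∷ ⁅ 0F ⁆ ∪ ⁅ 1F ⁆ ∪ ⁅ 3F ⁆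
  ∷ ⁅ 2F ⁆ ∪ ⁅ 3F ⁆ ∪ ⁅ 4F ⁆
  ∷ [])

image : (Fin m → Fin n) → Subset m → Subset n
image f []            = ⊥
image f (inside  ∷ s) = ⁅ f zero ⁆ ∪ image (f ∘ suc) s
image f (outside ∷ s) = image (f ∘ suc) s

-- Only edges are preserved, so copies need not be induced.
IsEmbedding : ThreeGraph m → ThreeGraph n → (Fin m → Fin n) → Set
IsEmbedding G H f = Injective _≡_ _≡_ f × (∀ e → Edge G e → Edge H (image f e))

_⊑_ : ThreeGraph m → ThreeGraph n → Set
G ⊑ H = ∃ (IsEmbedding G H)

_IsFree_ : ThreeGraph m → ThreeGraph n → Set
F IsFree H = ¬ (F ⊑ H)

∣insertAt∣ : ∀ (e : Subset n) v → ∣ insertAt e v outside ∣ ≡ ∣ e ∣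
∣insertAt∣ e             zero    = refl
∣insertAt∣ (inside  ∷ e) (suc v) = cong suc (∣insertAt∣ e v)
∣insertAt∣ (outside ∷ e) (suc v) = ∣insertAt∣ e v

-- The vertices other than v are renumbered by Fin n; insertAt restores the
-- original numbering, leaving v out, so edges containing v are dropped.
infixl 7 _∖_
_∖_ : ThreeGraph (suc n) → Fin (suc n) → ThreeGraph n
H ∖ v = record
  { edge?   = λ e → edge? H (insertAt e v outside)
  ; uniform = λ e h → trans (sym (∣insertAt∣ e v))
                            (ThreeGraph.uniform H (insertAt e v outside) h)
  }

------------------------------------------------------------------------
-- Enumerations

subsetsOfSize : ℕ → (n : ℕ) → List (Subset n)
subsetsOfSize zero    n       = [ ⊥ ]
subsetsOfSize (suc k) zero    = []
subsetsOfSize (suc k) (suc n) =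
  map (inside ∷_) (subsetsOfSize k n) ++ map (outside ∷_) (subsetsOfSize (suc k) n)

sublists : ∀ {A : Set} → List A → List (List A)
sublists []       = [ [] ]
sublists (x ∷ xs) = map (x ∷_) (sublists xs) ++ sublists xs

-- Up to pointwise equality of edge?, each 3-graph on Fin n occurs exactly once.
threeGraphs : (n : ℕ) → List (ThreeGraph n)
threeGraphs n = map fromList (sublists (subsetsOfSize 3 n))

any-Vec? : ∀ {P : Vec (Fin n) m → Set} → Decidable P → Dec (∃ P)
any-Vec? {m = zero}  P? = map′ (λ p → [] , p) (λ { ([] , p) → p }) (P? [])
any-Vec? {m = suc m} P? = map′ (λ { (x , v , p) → x ∷ v , p }) (λ { (x ∷ v , p) → x , v , p })
  (any? λ x → any-Vec? λ v → P? (x ∷ v))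

image-cong : {f g : Fin m → Fin n} → (∀ i → f i ≡ g i) → ∀ s → image f s ≡ image g s
image-cong f≗g []            = refl
image-cong f≗g (inside  ∷ s) = cong₂ (λ x t → ⁅ x ⁆ ∪ t) (f≗g zero) (image-cong (f≗g ∘ suc) s)
image-cong f≗g (outside ∷ s) = image-cong (f≗g ∘ suc) s

injective? : (f : Fin m → Fin n) → Dec (Injective _≡_ _≡_ f)
injective? f = map′ (λ h {i} {j} → h i j) (λ h i j → h)
  (all? λ i → all? λ j → (f i ≟ᶠ f j) →-dec (i ≟ᶠ j))

allSubset? : ∀ {P : Subset n → Set} → Decidable P → Dec (∀ s → P s)
allSubset? P? = map′ (λ h s → decidable-stable (P? s) λ ¬p → h (s , ¬p)) (λ h (s , ¬p) → ¬p (h s))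
  (¬? (anySubset? (¬? ∘ P?)))

embedding? : (G : ThreeGraph m) (H : ThreeGraph n) → Decidable (IsEmbedding G H)
embedding? G H f =
  injective? f ×-dec allSubset? λ e → T? (edge? G e) →-dec T? (edge? H (image f e))

_⊑?_ : (G : ThreeGraph m) (H : ThreeGraph n) → Dec (G ⊑ H)
G ⊑? H = map′ (λ (v , p) → lookup v , p)
  (λ (f , inj , hom) → tabulate f
    , (λ {i} {j} eq → inj (trans (sym (lookup∘tabulate f i)) (trans eq (lookup∘tabulate f j))))
    , λ e h → subst (Edge H) (image-cong (λ i → sym (lookup∘tabulate f i)) e) (hom e h))
  (any-Vec? λ v → embedding? G H (lookup v))

_isFree?_ : (F : ThreeGraph m) (H : ThreeGraph n) → Dec (F IsFree H)
F isFree? H = ¬? (F ⊑? H)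

------------------------------------------------------------------------
-- Degrees, norms and the extremal function, for rational p > 0

edges : ThreeGraph n → List (Subset n)
edges {n} H = filter (λ e → T? (edge? H e)) (subsetsOfSize 3 n)

deg : ThreeGraph n → Subset n → ℕ
deg H S = length (filter (S ⊆?_) (edges H))

module _ (p : ℚ) .{{_ : Positive p}} where

  norm₂ : ThreeGraph n → ℝ
  norm₂ {n} H = sumℝ (map (λ S → deg H S ^ℝ p) (subsetsOfSize 2 n))

  deg₂ : ThreeGraph (suc n) → Fin (suc n) → ℝ
  deg₂ H v = norm₂ H -ℝ norm₂ (H ∖ v)

  δ₂ : ThreeGraph (suc n) → ℝ
  δ₂ H = minℝ (deg₂ H)

  -- Norms are nonnegative, so 0 is a harmless base value for the maximum.
  ex₂ : ThreeGraph k → ℕ → ℝ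
  ex₂ F n = foldr _⊔ℝ_ 0ℝ (map norm₂ (filter (F isFree?_) (threeGraphs n)))

  exdeg₂ : ThreeGraph k → (n : ℕ) .{{_ : NonZero n}} → ℝ
  exdeg₂ F n = fromℚ ((+ 2) ℚ./ 1 ℚ.+ p) *ℝ ex₂ F n *ℝ fromℚ ((+ 1) ℚ./ n)

------------------------------------------------------------------------
-- Vertex-extendability

-- Closure under ⊑ includes closure under relabelling the vertices.
record FreeFamily (F : ThreeGraph k) : Set₁ where
  field
    Member : ∀ {n} → ThreeGraph n → Set
    free   : (H : ThreeGraph n) → Member H → F IsFree H
    closed : (G : ThreeGraph m) (H : ThreeGraph n) → G ⊑ H → Member H → Member G

-- The vertex set must be nonempty for δ₂ and H ∖ v to make sense.
VertexExtendable : (p : ℚ) .{{_ : Positive p}} (F : ThreeGraph k) → FreeFamily F → Set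
VertexExtendable p F 𝔥 =
  ∃ λ (ε : ℝ) → 0ℝ <ℝ ε × ∃ λ (N₀ : ℕ) →
    ∀ n → N₀ ℕ.≤ suc n → (H : ThreeGraph (suc n)) → F IsFree H →
    (1ℝ -ℝ ε) *ℝ exdeg₂ p F (suc n) ≤ℝ δ₂ p H →
    (∃ λ v → Member (H ∖ v)) → Member H
  where open FreeFamily 𝔥

-- colour v is the index of the part containing v; parts may be empty.
ThreePartite : ThreeGraph n → Set
ThreePartite {n} H = ∃ λ (colour : Fin n → Fin 3) →
  ∀ e → Edge H e → ∀ i → ∃! _≡_ λ v → v ∈ e × colour v ≡ i

∈-image⁺ : (f : Fin m → Fin n) {s : Subset m} {i : Fin m} → i ∈ s → f i ∈ image f s
∈-image⁺ f {inside  ∷ s} here      = x∈p∪q⁺ (inj₁ (x∈⁅x⁆ (f zero)))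
∈-image⁺ f {inside  ∷ s} (there h) = x∈p∪q⁺ (inj₂ (∈-image⁺ (f ∘ suc) h))
∈-image⁺ f {outside ∷ s} (there h) = ∈-image⁺ (f ∘ suc) h

∈-image⁻ : (f : Fin m → Fin n) (s : Subset m) {v : Fin n} →
           v ∈ image f s → ∃ λ i → i ∈ s × f i ≡ v
∈-image⁻ f []            h = absurd (∉⊥ h)
∈-image⁻ f (inside  ∷ s) h with x∈p∪q⁻ ⁅ f zero ⁆ (image (f ∘ suc) s) h
... | inj₁ q = zero , here , sym (x∈⁅y⁆⇒x≡y _ q)
... | inj₂ q = let i , i∈s , eq = ∈-image⁻ (f ∘ suc) s q in suc i , there i∈s , eq
∈-image⁻ f (outside ∷ s) h = let i , i∈s , eq = ∈-image⁻ (f ∘ suc) s h in suc i , there i∈s , eq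

threePartite-closed : (G : ThreeGraph m) (H : ThreeGraph n) → G ⊑ H →
                      ThreePartite H → ThreePartite G
threePartite-closed G H (f , inj , hom) (colour , part) = colour ∘ f , go
  where
  go : ∀ e → Edge G e → ∀ i → ∃! _≡_ λ v → v ∈ e × colour (f v) ≡ i
  go e h i with part (image f e) (hom e h) i
  ... | w , (w∈ , c) , unique with ∈-image⁻ f e w∈
  ... | v , v∈ , refl = v , (v∈ , c) , λ (u∈ , d) → inj (unique (∈-image⁺ f u∈ , d))

F₅-not-threePartite : ¬ ThreePartite F₅
F₅-not-threePartite (c , part)
  with part (⁅ 0F ⁆ ∪ ⁅ 1F ⁆ ∪ ⁅ 2F ⁆) _ (c 2F)
     | part (⁅ 0F ⁆ ∪ ⁅ 1F ⁆ ∪ ⁅ 3F ⁆) _ (c 2F)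
     | part (⁅ 2F ⁆ ∪ ⁅ 3F ⁆ ∪ ⁅ 4F ⁆) _ (c 2F)
... | a , _ , ua | b , (b∈ , cb) , _ | d , _ , ud = case-b b b∈ cb
  where
  ≡2F : ∀ {x} → x ∈ ⁅ 0F ⁆ ∪ ⁅ 1F ⁆ ∪ ⁅ 2F ⁆ → c x ≡ c 2F → x ≡ 2F
  ≡2F x∈ eq = trans (sym (ua (x∈ , eq))) (ua (there (there here) , refl))
  case-b : ∀ b → b ∈ ⁅ 0F ⁆ ∪ ⁅ 1F ⁆ ∪ ⁅ 3F ⁆ → c b ≡ c 2F → _
  case-b 0F _ eq with () ← ≡2F here eq
  case-b 1F _ eq with () ← ≡2F (there here) eq
  case-b 2F (there (there ())) eq
  case-b 3F _ eq with () ← trans (sym (ud (there (there here) , refl))) (ud (there (there (there here)) , eq))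
  case-b 4F (there (there (there (there ())))) eq

𝔎₃³ : FreeFamily F₅
𝔎₃³ = record
  { Member = ThreePartite
  ; free   = λ H h copy → F₅-not-threePartite (threePartite-closed F₅ H copy h)
  ; closed = threePartite-closed
  }

{-# OPTIONS --safe #-}
module Submission where

-- In an F₅-free 3-graph call a pair heavy if its codegree is at least 3.  Every
-- neighbourhood N(yz) is independent in the graph of heavy pairs, so
-- (heavy degree of x) + d(yz) ≤ n for every edge xyz.  Summed over all edges, and
-- combined with a pointwise inequality that is tight for the balanced complete
-- 3-partite 3-graph, this gives ex(n, F₅) ≤ (1 + o(1)) 3s⁵ with n = 3s².
--
-- For the lower bound, add a vertex v to the balanced complete 3-partite 3-graph, choose
-- a sparse graph L of pairs from different parts, delete all edges containing a pair of L
-- and make L the link of v.  The pairs of L then have codegree 1, and as 1ᵖ is not small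
-- compared with dᵖ - (d-1)ᵖ for p < 1, a graph L with only O(n^(3/2)) edges already gives
-- v the required (2,1/2)-degree.  If every vertex has its L-neighbours in a single part,
-- the result is F₅-free, but it is not 3-partite when L uses all three pairs of parts.

open import Defs
open import Data.Bool using (Bool; true; false; T; T?; _∧_; _∨_)
open import Data.Empty using () renaming (⊥ to ⊥₀)
open import Data.Fin using (Fin; zero; suc; combine; quotient; remainder; punchIn; _↑ˡ_; _↑ʳ_)
open import Data.Fin.Patterns using (0F; 1F; 2F; 3F; 4F)
open import Data.Fin.Properties using (any?; all?; remQuot-combine) renaming (_≟_ to _≟ᶠ_)
open import Data.Fin.Subset using (Subset; inside; outside; ⊥; ⁅_⁆; _∪_; _∈_; _∉_; ∣_∣)
open import Data.Fin.Subset.Properties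
  using (_⊆?_; _∈?_; p⊆q⇒∣p∣≤∣q∣; ∪-identityʳ; ∪-identityˡ; ∪-assoc; ∪-comm; ∪-idem; ∣⁅x⁆∣≡1; ∣⊥∣≡0;
         x∈⁅x⁆; x∈⁅y⁆⇒x≡y; x∈p∪q⁺; x∈p∪q⁻)
open import Data.List using (List; []; _∷_; _++_; foldr; map; filter; length)
open import Data.List.Relation.Unary.All as All using (All; []; _∷_)
open import Data.List.Relation.Unary.All.Properties using (all-filter)
open import Data.List.Relation.Unary.Any using (here; there)
open import Data.Nat
  using (ℕ; zero; suc; _+_; _*_; _^_; _∸_; _⊔_; _≤_; _<_; z≤n; s≤s; _≤?_; NonZero; >-nonZero; >-nonZero⁻¹)
open import Data.Nat.Properties
open import Data.Nat.Solver using (module +-*-Solver)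
open import Data.Product using (_×_; _,_; ∃; proj₁; proj₂)
open import Data.Rational as ℚ using (ℚ; ½; 0ℚ; 1ℚ; ↧ₙ_)
open import Data.Rational.Unnormalised as ℚᵘ using (mkℚᵘ; *≡*)
open import Data.Sum using (_⊎_; inj₁; inj₂)
open import Data.Unit using (tt)
open import Data.Vec using ([]; _∷_; here; there; insertAt; lookup)
open import Data.Vec.Relation.Unary.All using ([]; _∷_)
open import Data.Vec.Relation.Unary.AllPairs using ([]; _∷_)
open import Data.Vec.Relation.Unary.Unique.Propositional.Properties using (lookup-injective)
open import Function using (_∘_; case_of_)
open import Relation.Binary.PropositionalEquality
  using (_≡_; _≢_; refl; sym; trans; cong; cong₂; subst; subst₂; module ≡-Reasoning)
open import Relation.Nullary using (¬_; Dec; yes; no; does; contradiction)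
open import Relation.Nullary.Decidable
  using (toWitness; fromWitness; isYes; decidable-stable; _×-dec_; _→-dec_; ¬?)
open import Relation.Unary using (Decidable)
open import Algebra.Properties.Semiring.Sum +-*-semiring
  using (sum; sum-cong-≗; sum-remove; ∑-comm; ∑-distrib-+; *-distribˡ-sum; *-distribʳ-sum)
import Data.Integer as ℤ
import Data.Integer.Properties as ℤ
import Data.Integer.Solver as ℤ
import Data.Nat.ListAction as List
import Data.Rational.Properties as ℚ
import Data.Rational.Solver as ℚ
import Data.Rational.Unnormalised.Properties as ℚᵘ

-- With parts of size `σ` = s², every codegree of the complete 3-partite 3-graph is s² and its root
-- is the integer s. The target `exdeg₂` is then about (5/2) · 3s⁵ / 3s² = (5/2)s³. An old vertex
-- attains it to leading order: its 2s² pairs give 2s³, and the s⁴ pairs opposite it lose about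
-- 1/(2s) each, another s³/2. For the new vertex the link pairs alone suffice, since each falls from
-- codegree 1 to 0 and so is worth exactly 1. With s = 3u and u blocks, each a complete bipartite
-- graph between cells of size 9u, L has 81u³ = 3s³ pairs, more than (5/2)s³. Yet a vertex has at
-- most 9u = 3s link neighbours, negligible against s², so the degrees of old vertices change only
-- in lower order. Non-3-partiteness comes from one edge of three linked old vertices: none of them
-- can share the part of the new vertex, but together they meet every part. It is enough that all
-- three colours are touched by L. The analysis is done at a fixed denominator k, with roots rounded
-- down to multiples of 1/k; this leaves inequalities in ℕ, and in the lower bound a k of at least
-- `N * N` absorbs the rounding.

private variable
  m n : ℕ

-- Sums over Fin n

sum-mono : {f g : Fin n → ℕ} → (∀ i → f i ≤ g i) → sum f ≤ sum g
sum-mono {zero}  h = z≤n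
sum-mono {suc n} h = +-mono-≤ (h zero) (sum-mono (h ∘ suc))

sum-const : ∀ n c → sum {n} (λ _ → c) ≡ n * c
sum-const zero    c = refl
sum-const (suc n) c = cong (c +_) (sum-const n c)

sum-≤-const : {f : Fin n → ℕ} {c : ℕ} → (∀ i → f i ≤ c) → sum f ≤ n * c
sum-≤-const {n} {c = c} h = ≤-trans (sum-mono h) (≤-reflexive (sum-const n c))

sum-zero : {f : Fin n → ℕ} → (∀ i → f i ≡ 0) → sum f ≡ 0
sum-zero {zero}  h = refl
sum-zero {suc n} h = cong₂ _+_ (h zero) (sum-zero (h ∘ suc))

sum-++ : ∀ m {n} (f : Fin (m + n) → ℕ) → sum f ≡ sum (λ i → f (i ↑ˡ n)) + sum (λ j → f (m ↑ʳ j))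
sum-++ zero    f = refl
sum-++ (suc m) {n} f = trans (cong (f zero +_) (sum-++ m (f ∘ suc)))
  (sym (+-assoc (f zero) (sum (λ i → f (suc (i ↑ˡ n)))) (sum (λ j → f (suc (m ↑ʳ j))))))

sum-combine : ∀ m {n} (f : Fin (m * n) → ℕ) → sum f ≡ sum (λ i → sum (λ j → f (combine {m} i j)))
sum-combine zero        f = refl
sum-combine (suc m) {n} f = trans (sum-++ n f) (cong (sum (λ j → f (j ↑ˡ m * n)) +_) (sum-combine m (λ j → f (n ↑ʳ j))))

sum₂-mono : {f g : Fin m → Fin n → ℕ} → (∀ i j → f i j ≤ g i j) →
            sum (λ i → sum (f i)) ≤ sum (λ i → sum (g i))
sum₂-mono h = sum-mono λ i → sum-mono (h i)

sum₂-cong : {f g : Fin m → Fin n → ℕ} → (∀ i j → f i j ≡ g i j) →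
            sum (λ i → sum (f i)) ≡ sum (λ i → sum (g i))
sum₂-cong h = sum-cong-≗ λ i → sum-cong-≗ (h i)

sum₂-+ : (f g : Fin m → Fin n → ℕ) →
         sum (λ i → sum (λ j → f i j + g i j)) ≡ sum (λ i → sum (f i)) + sum (λ i → sum (g i))
sum₂-+ f g = trans (sum-cong-≗ λ i → ∑-distrib-+ (f i) (g i))
                   (∑-distrib-+ (λ i → sum (f i)) (λ i → sum (g i)))

sum₂-* : ∀ c (f : Fin m → Fin n → ℕ) →
         sum (λ i → sum (λ j → c * f i j)) ≡ c * sum (λ i → sum (f i))
sum₂-* c f = trans (sum-cong-≗ λ i → sym (*-distribˡ-sum c (f i)))
                   (sym (*-distribˡ-sum c (λ i → sum (f i))))

sum₂-const : ∀ m n c → sum {m} (λ _ → sum {n} (λ _ → c)) ≡ m * (n * c)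
sum₂-const m n c = trans (sum-cong-≗ {m} λ _ → sum-const n c) (sum-const m (n * c))

sum₂-punchIn : (v : Fin (suc n)) (f : Fin (suc n) → Fin (suc n) → ℕ) → (∀ y → f v y ≡ 0) → (∀ x → f x v ≡ 0) →
               sum (λ x → sum (f x)) ≡ sum (λ x → sum (λ y → f (punchIn v x) (punchIn v y)))
sum₂-punchIn v f row col = trans (sum-remove {i = v} (λ x → sum (f x)))
  (cong₂ _+_ (sum-zero {f = f v} row) (sum-cong-≗ λ x →
    trans (sum-remove {i = v} (f (punchIn v x)))
          (cong (_+ sum (λ y → f (punchIn v x) (punchIn v y))) (col (punchIn v x)))))

-- Indicators of Booleans and of decidable propositions

𝟙 : Bool → ℕ
𝟙 true  = 1
𝟙 false = 0

𝟙≤1 : ∀ b → 𝟙 b ≤ 1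
𝟙≤1 true  = s≤s z≤n
𝟙≤1 false = z≤n

T⇒𝟙≡1 : ∀ {b} → T b → 𝟙 b ≡ 1
T⇒𝟙≡1 {true} _ = refl

¬T⇒𝟙≡0 : ∀ {b} → ¬ T b → 𝟙 b ≡ 0
¬T⇒𝟙≡0 {true}  h = contradiction _ h
¬T⇒𝟙≡0 {false} _ = refl

𝟙-yes : {P : Set} (P? : Dec P) → P → 𝟙 (does P?) ≡ 1
𝟙-yes (yes _) p = refl
𝟙-yes (no ¬p) p = contradiction p ¬p

𝟙-no : {P : Set} (P? : Dec P) → ¬ P → 𝟙 (does P?) ≡ 0
𝟙-no (yes p) ¬p = contradiction p ¬p
𝟙-no (no  _) ¬p = refl

𝟙-⇔ : {P Q : Set} (P? : Dec P) (Q? : Dec Q) → (P → Q) → (Q → P) → 𝟙 (does P?) ≡ 𝟙 (does Q?)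
𝟙-⇔ (yes p) Q? to from = sym (𝟙-yes Q? (to p))
𝟙-⇔ (no ¬p) Q? to from = sym (𝟙-no Q? (¬p ∘ from))

𝟙-∧ : ∀ b c → 𝟙 (b ∧ c) ≡ 𝟙 b * 𝟙 c
𝟙-∧ true  c = sym (*-identityˡ (𝟙 c))
𝟙-∧ false c = refl

𝟙-⊎ : {P Q R : Set} (P? : Dec P) (Q? : Dec Q) (R? : Dec R) → (P → Q ⊎ R) →
      𝟙 (does P?) ≤ 𝟙 (does Q?) + 𝟙 (does R?)
𝟙-⊎ (no ¬p) Q? R? f = z≤n
𝟙-⊎ (yes p) Q? R? f with f p
... | inj₁ q = ≤-trans (≤-reflexive (sym (𝟙-yes Q? q))) (m≤m+n _ _)
... | inj₂ r = ≤-trans (≤-reflexive (sym (𝟙-yes R? r))) (m≤n+m _ _)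

𝟙-×₃ : {P Q R : Set} (P? : Dec P) (Q? : Dec Q) (R? : Dec R) {m : ℕ} → (P → Q → R → 1 ≤ m) →
       𝟙 (does P?) * (𝟙 (does Q?) * 𝟙 (does R?)) ≤ m
𝟙-×₃ (no _)  Q?      R?      f = z≤n
𝟙-×₃ (yes p) (no _)  R?      f = z≤n
𝟙-×₃ (yes p) (yes q) (no _)  f = z≤n
𝟙-×₃ (yes p) (yes q) (yes r) f = f p q r

-- Degrees and norms as sums over vertices

sumOver : {A : Set} → (A → ℕ) → List A → ℕ
sumOver f xs = List.sum (map f xs)

sumOver-++ : {A : Set} (f : A → ℕ) (xs ys : List A) → sumOver f (xs ++ ys) ≡ sumOver f xs + sumOver f ys
sumOver-++ f []       ys = refl
sumOver-++ f (x ∷ xs) ys = trans (cong (f x +_) (sumOver-++ f xs ys)) (sym (+-assoc (f x) _ _))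

sumOver-map : {A B : Set} (f : B → ℕ) (g : A → B) (xs : List A) → sumOver f (map g xs) ≡ sumOver (f ∘ g) xs
sumOver-map f g []       = refl
sumOver-map f g (x ∷ xs) = cong (f (g x) +_) (sumOver-map f g xs)

sumOver-zero : {A : Set} (xs : List A) → sumOver (λ _ → 0) xs ≡ 0
sumOver-zero []       = refl
sumOver-zero (_ ∷ xs) = sumOver-zero xs

length-filter₂ : {A : Set} {P Q : A → Set} (P? : Decidable P) (Q? : Decidable Q) (xs : List A) →
                 length (filter P? (filter Q? xs)) ≡ sumOver (λ x → 𝟙 (does (P? x)) * 𝟙 (does (Q? x))) xs
length-filter₂ P? Q? [] = refl
length-filter₂ P? Q? (x ∷ xs) with does (Q? x)
... | false = trans (length-filter₂ P? Q? xs) (cong (_+ sumOver (λ y → 𝟙 (does (P? y)) * 𝟙 (does (Q? y))) xs) (sym (*-zeroʳ (𝟙 (does (P? x))))))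
... | true with does (P? x)
...   | true  = cong suc (length-filter₂ P? Q? xs)
...   | false = length-filter₂ P? Q? xs

sum-subsetsOfSize-suc : ∀ j n (F : Subset (suc n) → ℕ) →
  sumOver F (subsetsOfSize (suc j) (suc n)) ≡
  sumOver (F ∘ (inside ∷_)) (subsetsOfSize j n) + sumOver (F ∘ (outside ∷_)) (subsetsOfSize (suc j) n)
sum-subsetsOfSize-suc j n F = trans
  (sumOver-++ F (map (inside ∷_) (subsetsOfSize j n)) (map (outside ∷_) (subsetsOfSize (suc j) n)))
  (cong₂ _+_ (sumOver-map F (inside ∷_) (subsetsOfSize j n))
             (sumOver-map F (outside ∷_) (subsetsOfSize (suc j) n)))

sum-singletons : ∀ n (F : Subset n → ℕ) → sumOver F (subsetsOfSize 1 n) ≡ sum (λ x → F ⁅ x ⁆)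
sum-singletons zero    F = refl
sum-singletons (suc n) F = trans (sum-subsetsOfSize-suc 0 n F)
  (cong₂ _+_ (+-identityʳ _) (sum-singletons n (F ∘ (outside ∷_))))

-- Each unordered pair is met in both orders; this is the source of the factor 2 in front of every
-- later `norm`. The induction separates the pairs containing `zero`, which appear once as a row and
-- once as a column.
sum-pairs : ∀ n (F : Subset n → ℕ) (f : Fin n → Fin n → ℕ) → (∀ x → f x x ≡ 0) →
            (∀ {x y} → x ≢ y → f x y ≡ F (⁅ x ⁆ ∪ ⁅ y ⁆)) →
            sum (λ x → sum (f x)) ≡ 2 * sumOver F (subsetsOfSize 2 n)
sum-pairs zero    F f f-diag f-pair = refl
sum-pairs (suc n) F f f-diag f-pair = begin
  (f zero zero + ∑row) + sum (λ x → f (suc x) zero + sum (f (suc x) ∘ suc))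
    ≡⟨ cong₂ _+_ (cong₂ _+_ (f-diag zero) row≡) (∑-distrib-+ (λ x → f (suc x) zero) _) ⟩
  A + (sum (λ x → f (suc x) zero) + sum (λ x → sum (f (suc x) ∘ suc)))
    ≡⟨ cong (A +_) (cong₂ _+_ col≡
         (sum-pairs n (F ∘ (outside ∷_)) (λ x y → f (suc x) (suc y)) (f-diag ∘ suc)
           λ x≢y → f-pair (λ { refl → x≢y refl }))) ⟩
  A + (A + 2 * B)
    ≡⟨ solve 2 (λ a b → a :+ (a :+ con 2 :* b) := con 2 :* (a :+ b)) refl A B ⟩
  2 * (A + B)
    ≡⟨ cong (2 *_) (sum-subsetsOfSize-suc 1 n F) ⟨
  2 * sumOver F (subsetsOfSize 2 (suc n)) ∎
  where
  open ≡-Reasoning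
  open +-*-Solver
  ∑row = sum (λ y → f zero (suc y))
  A = sumOver (F ∘ (inside ∷_)) (subsetsOfSize 1 n)
  B = sumOver (F ∘ (outside ∷_)) (subsetsOfSize 2 n)
  row≡ : ∑row ≡ A
  row≡ = trans (sum-cong-≗ λ y → trans (f-pair λ ()) (cong (F ∘ (inside ∷_)) (∪-identityˡ ⁅ y ⁆)))
               (sym (sum-singletons n (F ∘ (inside ∷_))))
  col≡ : sum (λ x → f (suc x) zero) ≡ A
  col≡ = trans (sum-cong-≗ λ x → trans (f-pair λ ()) (cong (F ∘ (inside ∷_)) (∪-identityʳ ⁅ x ⁆)))
               (sym (sum-singletons n (F ∘ (inside ∷_))))

superset-sum : Subset n → (Subset n → ℕ) → ℕ → ℕ
superset-sum {n} S Φ j = sumOver (λ e → 𝟙 (does (S ⊆? e)) * Φ e) (subsetsOfSize j n)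

superset-sum-inside : ∀ j (S : Subset n) (Φ : Subset (suc n) → ℕ) →
  superset-sum (inside ∷ S) Φ (suc j) ≡ superset-sum S (Φ ∘ (inside ∷_)) j
superset-sum-inside {n} j S Φ = trans (sum-subsetsOfSize-suc j n _)
  (trans (cong (superset-sum S (Φ ∘ (inside ∷_)) j +_) (sumOver-zero (subsetsOfSize (suc j) n)))
         (+-identityʳ _))

superset-sum-outside : ∀ j (S : Subset n) (Φ : Subset (suc n) → ℕ) →
  superset-sum (outside ∷ S) Φ (suc j) ≡
  superset-sum S (Φ ∘ (inside ∷_)) j + superset-sum S (Φ ∘ (outside ∷_)) (suc j)
superset-sum-outside {n} j S Φ = sum-subsetsOfSize-suc j n _

superset-sum-small : ∀ j (S : Subset n) (Φ : Subset n → ℕ) → j < ∣ S ∣ → superset-sum S Φ j ≡ 0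
superset-sum-small {n} zero S Φ h with S ⊆? ⊥
... | yes S⊆⊥ = contradiction (≤-trans (p⊆q⇒∣p∣≤∣q∣ S⊆⊥) (≤-reflexive (∣⊥∣≡0 n))) (<⇒≱ h)
... | no  _   = refl
superset-sum-small (suc j) (inside  ∷ S) Φ (s≤s h) =
  trans (superset-sum-inside j S Φ) (superset-sum-small j S (Φ ∘ (inside ∷_)) h)
superset-sum-small (suc j) (outside ∷ S) Φ h = trans (superset-sum-outside j S Φ)
  (cong₂ _+_ (superset-sum-small j S (Φ ∘ (inside ∷_)) (<-trans (n<1+n j) h))
             (superset-sum-small (suc j) S (Φ ∘ (outside ∷_)) h))

superset-sum-same : ∀ j (S : Subset n) (Φ : Subset n → ℕ) → ∣ S ∣ ≡ j → superset-sum S Φ j ≡ Φ S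
superset-sum-same zero    []            Φ refl = trans (+-identityʳ _) (+-identityʳ (Φ []))
superset-sum-same (suc j) (inside  ∷ S) Φ eq =
  trans (superset-sum-inside j S Φ) (superset-sum-same j S (Φ ∘ (inside ∷_)) (suc-injective eq))
superset-sum-same zero    (outside ∷ S) Φ eq = superset-sum-same zero S (Φ ∘ (outside ∷_)) eq
superset-sum-same (suc j) (outside ∷ S) Φ eq = trans (superset-sum-outside j S Φ)
  (cong₂ _+_ (superset-sum-small j S (Φ ∘ (inside ∷_)) (≤-reflexive (sym eq)))
             (superset-sum-same (suc j) S (Φ ∘ (outside ∷_)) eq))

-- A superset with one more element arises from exactly one z outside `S`. A z inside `S`
-- contributes `Φ S`, so `Φ S ≡ 0` allows z to range over all vertices.
superset-sum-suc : ∀ j (S : Subset n) (Φ : Subset n → ℕ) → ∣ S ∣ ≡ j → Φ S ≡ 0 →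
                   superset-sum S Φ (suc j) ≡ sum (λ z → Φ (S ∪ ⁅ z ⁆))
superset-sum-suc j       []            Φ eq ΦS = refl
superset-sum-suc (suc j) (inside  ∷ S) Φ eq ΦS = trans (superset-sum-inside (suc j) S Φ)
  (cong₂ _+_ (sym (trans (cong (Φ ∘ (inside ∷_)) (∪-identityʳ S)) ΦS))
             (superset-sum-suc j S (Φ ∘ (inside ∷_)) (suc-injective eq) ΦS))
superset-sum-suc j       (outside ∷ S) Φ eq ΦS = trans (superset-sum-outside j S Φ)
  (cong₂ _+_ (trans (superset-sum-same j S (Φ ∘ (inside ∷_)) eq)
                    (cong (Φ ∘ (inside ∷_)) (sym (∪-identityʳ S))))
             (superset-sum-suc j S (Φ ∘ (outside ∷_)) eq ΦS))

-- Edges as triples of vertices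

triple : Fin n → Fin n → Fin n → Subset n
triple x y z = ⁅ x ⁆ ∪ (⁅ y ⁆ ∪ ⁅ z ⁆)

triple-swap : (x y z : Fin n) → triple x y z ≡ triple y x z
triple-swap x y z = trans (sym (∪-assoc ⁅ x ⁆ ⁅ y ⁆ ⁅ z ⁆))
  (trans (cong (_∪ ⁅ z ⁆) (∪-comm ⁅ x ⁆ ⁅ y ⁆)) (∪-assoc ⁅ y ⁆ ⁅ x ⁆ ⁅ z ⁆))

triple-rotate : (x y z : Fin n) → triple x y z ≡ triple y z x
triple-rotate x y z = trans (∪-comm ⁅ x ⁆ (⁅ y ⁆ ∪ ⁅ z ⁆)) (∪-assoc ⁅ y ⁆ ⁅ z ⁆ ⁅ x ⁆)

∣⁅x⁆∪p∣ : (x : Fin n) (p : Subset n) → x ∉ p → ∣ ⁅ x ⁆ ∪ p ∣ ≡ suc ∣ p ∣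
∣⁅x⁆∪p∣ zero    (inside  ∷ p) x∉p = contradiction here x∉p
∣⁅x⁆∪p∣ zero    (outside ∷ p) x∉p = cong (suc ∘ ∣_∣) (∪-identityˡ p)
∣⁅x⁆∪p∣ (suc x) (inside  ∷ p) x∉p = cong suc (∣⁅x⁆∪p∣ x p (x∉p ∘ there))
∣⁅x⁆∪p∣ (suc x) (outside ∷ p) x∉p = ∣⁅x⁆∪p∣ x p (x∉p ∘ there)

∣pair∣ : {x y : Fin n} → x ≢ y → ∣ ⁅ x ⁆ ∪ ⁅ y ⁆ ∣ ≡ 2
∣pair∣ {x = x} {y} x≢y = trans (∣⁅x⁆∪p∣ x ⁅ y ⁆ (x≢y ∘ x∈⁅y⁆⇒x≡y y)) (cong suc (∣⁅x⁆∣≡1 y))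

∣pair∣≤2 : (x y : Fin n) → ∣ ⁅ x ⁆ ∪ ⁅ y ⁆ ∣ ≤ 2
∣pair∣≤2 x y with x ≟ᶠ y
... | yes refl = ≤-trans (≤-reflexive (trans (cong ∣_∣ (∪-idem ⁅ x ⁆)) (∣⁅x⁆∣≡1 x))) (s≤s z≤n)
... | no  x≢y  = ≤-reflexive (∣pair∣ x≢y)

∣triple∣ : (x y z : Fin n) → x ≢ y → y ≢ z → x ≢ z → ∣ triple x y z ∣ ≡ 3
∣triple∣ x y z x≢y y≢z x≢z = trans (∣⁅x⁆∪p∣ x (⁅ y ⁆ ∪ ⁅ z ⁆) x∉) (cong suc (∣pair∣ y≢z))
  where
  x∉ : x ∉ ⁅ y ⁆ ∪ ⁅ z ⁆
  x∉ h with x∈p∪q⁻ ⁅ y ⁆ ⁅ z ⁆ h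
  ... | inj₁ q = x≢y (x∈⁅y⁆⇒x≡y y q)
  ... | inj₂ q = x≢z (x∈⁅y⁆⇒x≡y z q)

-- A record, so that the three vertices can be inferred from the type; they are not determined by
-- the subset `triple x y z`.
record Edge₃ (H : ThreeGraph n) (x y z : Fin n) : Set where
  constructor edge₃
  field edge : Edge H (triple x y z)

open Edge₃ public

module _ (H : ThreeGraph n) where

  edge-≢ : ∀ {x y z} → Edge₃ H x y z → x ≢ y
  edge-≢ {x} {z = z} (edge₃ h) refl = contradiction
    (≤-trans (≤-reflexive (sym (ThreeGraph.uniform H _ h))) (≤-trans (≤-reflexive (cong ∣_∣ eq)) (∣pair∣≤2 x z)))
    (λ { (s≤s (s≤s ())) })
    where
    eq : triple x x z ≡ ⁅ x ⁆ ∪ ⁅ z ⁆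
    eq = trans (sym (∪-assoc ⁅ x ⁆ ⁅ x ⁆ ⁅ z ⁆)) (cong (_∪ ⁅ z ⁆) (∪-idem ⁅ x ⁆))

  edge-swap : ∀ {x y z} → Edge₃ H x y z → Edge₃ H y x z
  edge-swap {x} {y} {z} (edge₃ h) = edge₃ (subst (Edge H) (triple-swap x y z) h)

  edge-rotate : ∀ {x y z} → Edge₃ H x y z → Edge₃ H y z x
  edge-rotate {x} {y} {z} (edge₃ h) = edge₃ (subst (Edge H) (triple-rotate x y z) h)

  ind : Fin n → Fin n → Fin n → ℕ
  ind x y z = 𝟙 (edge? H (triple x y z))

  ind-swap : ∀ x y z → ind x y z ≡ ind y x z
  ind-swap x y z = cong (𝟙 ∘ edge? H) (triple-swap x y z)

  ind-rotate : ∀ x y z → ind x y z ≡ ind y z x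
  ind-rotate x y z = cong (𝟙 ∘ edge? H) (triple-rotate x y z)

  codeg : Fin n → Fin n → ℕ
  codeg x y = sum (ind x y)

  codeg-diag : ∀ x → codeg x x ≡ 0
  codeg-diag x = sum-zero {f = ind x x} λ z → ¬T⇒𝟙≡0 λ h → edge-≢ {x} (edge₃ h) refl

  codeg-sym : ∀ x y → codeg x y ≡ codeg y x
  codeg-sym x y = sum-cong-≗ (ind-swap x y)

  deg-pair : ∀ {x y} → x ≢ y → deg H (⁅ x ⁆ ∪ ⁅ y ⁆) ≡ codeg x y
  deg-pair {x} {y} x≢y = begin
    deg H S
      ≡⟨ length-filter₂ (S ⊆?_) (λ e → T? (edge? H e)) (subsetsOfSize 3 n) ⟩
    superset-sum S (𝟙 ∘ edge? H) 3
      ≡⟨ superset-sum-suc 2 S (𝟙 ∘ edge? H) (∣pair∣ x≢y)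
           (¬T⇒𝟙≡0 λ h → case trans (sym (∣pair∣ x≢y)) (ThreeGraph.uniform H S h) of λ ()) ⟩
    sum (λ z → 𝟙 (edge? H (S ∪ ⁅ z ⁆)))
      ≡⟨ sum-cong-≗ (λ z → cong (𝟙 ∘ edge? H) (∪-assoc ⁅ x ⁆ ⁅ y ⁆ ⁅ z ⁆)) ⟩
    codeg x y ∎
    where
    open ≡-Reasoning
    S = ⁅ x ⁆ ∪ ⁅ y ⁆

  sum-deg : (φ : ℕ → ℕ) → φ 0 ≡ 0 →
            sum (λ x → sum (λ y → φ (codeg x y))) ≡ 2 * sumOver (φ ∘ deg H) (subsetsOfSize 2 n)
  sum-deg φ φ0 = sum-pairs n (φ ∘ deg H) (λ x y → φ (codeg x y))
    (λ x → trans (cong φ (codeg-diag x)) φ0) (λ x≢y → cong φ (sym (deg-pair x≢y)))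

-- Codegrees after the deletion of a vertex

insertAt-⊥ : (v : Fin (suc n)) → insertAt ⊥ v outside ≡ ⊥
insertAt-⊥         zero    = refl
insertAt-⊥ {suc n} (suc v) = cong (outside ∷_) (insertAt-⊥ v)

insertAt-⁅⁆ : (v : Fin (suc n)) (x : Fin n) → insertAt ⁅ x ⁆ v outside ≡ ⁅ punchIn v x ⁆
insertAt-⁅⁆ zero    x       = refl
insertAt-⁅⁆ (suc v) zero    = cong (inside ∷_) (insertAt-⊥ v)
insertAt-⁅⁆ (suc v) (suc x) = cong (outside ∷_) (insertAt-⁅⁆ v x)

insertAt-∪ : (v : Fin (suc n)) (p q : Subset n) →
             insertAt (p ∪ q) v outside ≡ insertAt p v outside ∪ insertAt q v outside
insertAt-∪ zero    p       q       = refl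
insertAt-∪ (suc v) (x ∷ p) (y ∷ q) = cong ((x ∨ y) ∷_) (insertAt-∪ v p q)

ind-∖ : (H : ThreeGraph (suc n)) (v : Fin (suc n)) (x y z : Fin n) →
        ind (H ∖ v) x y z ≡ ind H (punchIn v x) (punchIn v y) (punchIn v z)
ind-∖ H v x y z = cong (𝟙 ∘ edge? H) (trans (insertAt-∪ v ⁅ x ⁆ (⁅ y ⁆ ∪ ⁅ z ⁆))
  (cong₂ _∪_ (insertAt-⁅⁆ v x) (trans (insertAt-∪ v ⁅ y ⁆ ⁅ z ⁆)
    (cong₂ _∪_ (insertAt-⁅⁆ v y) (insertAt-⁅⁆ v z)))))

codeg-∖ : (H : ThreeGraph (suc n)) (v : Fin (suc n)) (x y : Fin n) →
          codeg H (punchIn v x) (punchIn v y) ≡ ind H (punchIn v x) (punchIn v y) v + codeg (H ∖ v) x y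
codeg-∖ H v x y = trans (sum-remove {i = v} (ind H (punchIn v x) (punchIn v y)))
  (cong (ind H (punchIn v x) (punchIn v y) v +_) (sym (sum-cong-≗ (ind-∖ H v x y))))

-- Inequalities in ℕ

m≤n⇒2mn≤m²+n² : ∀ {m n} → m ≤ n → 2 * (m * n) ≤ m * m + n * n
m≤n⇒2mn≤m²+n² {m} m≤n with c , refl ← m≤n⇒∃[o]m+o≡n m≤n = ≤-trans (m≤m+n _ (c * c)) (≤-reflexive
  (solve 2 (λ m c → con 2 :* (m :* (m :+ c)) :+ c :* c := m :* m :+ (m :+ c) :* (m :+ c)) refl m c))
  where open +-*-Solver

2mn≤m²+n² : ∀ m n → 2 * (m * n) ≤ m * m + n * n
2mn≤m²+n² m n with ≤-total m n
... | inj₁ m≤n = m≤n⇒2mn≤m²+n² m≤n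
... | inj₂ n≤m = subst₂ _≤_ (cong (2 *_) (*-comm n m)) (+-comm (n * n) (m * m)) (m≤n⇒2mn≤m²+n² n≤m)

m²≤n²⇒m≤n : ∀ {m n} → m * m ≤ n * n → m ≤ n
m²≤n²⇒m≤n h = ≮⇒≥ λ n<m → <⇒≱ (*-mono-< n<m n<m) h

-- At g = 2σ and d = σ both inequalities are equalities.
codegree-bound : ∀ {σ g w} d → g + w ≡ 4 * σ →
  16 * σ * d + 4 * (σ * σ) ≤ 4 * (d * (g + d)) + (4 * (σ * σ) + w * w)
codegree-bound {σ} {g} {w} d eq = begin
  16 * σ * d + 4 * (σ * σ)
    ≡⟨ solve 2 (λ σ d → con 16 :* σ :* d :+ con 4 :* (σ :* σ)
                        := con 4 :* d :* (con 4 :* σ) :+ con 4 :* (σ :* σ)) refl σ d ⟩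
  4 * d * (4 * σ) + 4 * (σ * σ)
    ≡⟨ cong (λ x → 4 * d * x + 4 * (σ * σ)) eq ⟨
  4 * d * (g + w) + 4 * (σ * σ)
    ≡⟨ solve 4 (λ σ d g w → con 4 :* d :* (g :+ w) :+ con 4 :* (σ :* σ)
                 := con 2 :* (con 2 :* d :* w) :+ (con 4 :* (d :* g) :+ con 4 :* (σ :* σ))) refl σ d g w ⟩
  2 * (2 * d * w) + (4 * (d * g) + 4 * (σ * σ))
    -- Equality needs w = 2d. In the extremal graph g = 2σ and d = σ, and this is what fixes the sum
    -- g + w at 4σ.
    ≤⟨ +-monoˡ-≤ _ (2mn≤m²+n² (2 * d) w) ⟩
  2 * d * (2 * d) + w * w + (4 * (d * g) + 4 * (σ * σ))
    ≡⟨ solve 4 (λ σ d g w → con 2 :* d :* (con 2 :* d) :+ w :* w :+ (con 4 :* (d :* g) :+ con 4 :* (σ :* σ))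
                 := con 4 :* (d :* (g :+ d)) :+ (con 4 :* (σ :* σ) :+ w :* w)) refl σ d g w ⟩
  4 * (d * (g + d)) + (4 * (σ * σ) + w * w) ∎
  where
  open ≤-Reasoning
  open +-*-Solver

-- Four times the left side is g(g + w)² + 4gw², and 4gw ≤ (g + w)² bounds it by (g + w)³ = 64σ³.
heavy-degree-bound : ∀ {σ g w} → g + w ≡ 4 * σ → g * (4 * (σ * σ) + w * w) ≤ 16 * (σ * σ * σ)
heavy-degree-bound {σ} {g} {w} eq = *-cancelˡ-≤ 4 (begin
  4 * (g * (4 * (σ * σ) + w * w))
    ≡⟨ solve 3 (λ σ g w → con 4 :* (g :* (con 4 :* (σ :* σ) :+ w :* w))
                 := g :* (con 4 :* σ :* (con 4 :* σ)) :+ con 2 :* w :* (con 2 :* (g :* w))) refl σ g w ⟩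
  g * (4 * σ * (4 * σ)) + 2 * w * (2 * (g * w))
    ≤⟨ +-monoʳ-≤ (g * (4 * σ * (4 * σ))) (begin
      2 * w * (2 * (g * w))
        ≡⟨ solve 2 (λ g w → con 2 :* w :* (con 2 :* (g :* w))
                      := w :* (con 2 :* (g :* w) :+ con 2 :* (g :* w))) refl g w ⟩
      w * (2 * (g * w) + 2 * (g * w))
        ≤⟨ *-monoʳ-≤ w (+-monoˡ-≤ (2 * (g * w)) (2mn≤m²+n² g w)) ⟩
      w * (g * g + w * w + 2 * (g * w))
        ≡⟨ solve 2 (λ g w → w :* (g :* g :+ w :* w :+ con 2 :* (g :* w))
                      := w :* ((g :+ w) :* (g :+ w))) refl g w ⟩
      w * ((g + w) * (g + w))
        ≡⟨ cong (λ x → w * (x * x)) eq ⟩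
      w * (4 * σ * (4 * σ)) ∎) ⟩
  g * (4 * σ * (4 * σ)) + w * (4 * σ * (4 * σ))
    ≡⟨ *-distribʳ-+ (4 * σ * (4 * σ)) g w ⟨
  (g + w) * (4 * σ * (4 * σ))
    ≡⟨ cong (_* (4 * σ * (4 * σ))) eq ⟩
  4 * σ * (4 * σ * (4 * σ))
    ≡⟨ solve 1 (λ σ → con 4 :* σ :* (con 4 :* σ :* (con 4 :* σ))
                 := con 4 :* (con 16 :* (σ :* σ :* σ))) refl σ ⟩
  4 * (16 * (σ * σ * σ)) ∎)
  where
  open ≤-Reasoning
  open +-*-Solver

-- rt k d is k√d rounded down.
rt : ℕ → ℕ → ℕ
rt k d = iroot 2 (d ^ 1 * k ^ 2)

rt-radicand : ∀ k d → d ^ 1 * k ^ 2 ≡ d * (k * k)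
rt-radicand = solve 2 (λ k d → d :^ 1 :* k :^ 2 := d :* (k :* k)) refl
  where open +-*-Solver

rt-lower : ∀ k d → rt k d * rt k d ≤ d * (k * k)
rt-lower k d = subst₂ _≤_ (cong (rt k d *_) (*-identityʳ (rt k d))) (rt-radicand k d)
  (iroot-lower 2 (d ^ 1 * k ^ 2))

rt-upper : ∀ k d → d * (k * k) < suc (rt k d) * suc (rt k d)
rt-upper k d = subst₂ _<_ (rt-radicand k d) (cong (suc (rt k d) *_) (*-identityʳ (suc (rt k d))))
  (iroot-upper 2 (d ^ 1 * k ^ 2))

rt-greatest : ∀ {k d r} → r * r ≤ d * (k * k) → r ≤ rt k d
rt-greatest {k} {d} h = ≮⇒≥ λ rt<r → <⇒≱ (rt-upper k d) (≤-trans (*-mono-≤ rt<r rt<r) h)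

rt-mono : ∀ k {d e} → d ≤ e → rt k d ≤ rt k e
rt-mono k {d} {e} d≤e = rt-greatest {k} {e} (≤-trans (rt-lower k d) (*-monoˡ-≤ (k * k) d≤e))

-- The tangent to the square root at s².
rt-tangent : ∀ s k d .{{_ : NonZero k}} → 2 * s * rt k d ≤ k * (d + s * s)
rt-tangent s k d = *-cancelˡ-≤ k (begin
  k * (2 * s * r)
    ≡⟨ solve 3 (λ s k r → k :* (con 2 :* s :* r) := con 2 :* (r :* (s :* k))) refl s k r ⟩
  2 * (r * (s * k))
    ≤⟨ 2mn≤m²+n² r (s * k) ⟩
  r * r + s * k * (s * k)
    ≤⟨ +-monoˡ-≤ (s * k * (s * k)) (rt-lower k d) ⟩
  d * (k * k) + s * k * (s * k)
    ≡⟨ solve 3 (λ s k d → d :* (k :* k) :+ s :* k :* (s :* k) := k :* (k :* (d :+ s :* s))) refl s k d ⟩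
  k * (k * (d + s * s)) ∎)
  where
  open ≤-Reasoning
  open +-*-Solver
  r = rt k d

rt-small : ∀ k {d} → d ≤ 2 → rt k d ≤ 2 * k
rt-small k {d} d≤2 = m²≤n²⇒m≤n (begin
  rt k d * rt k d    ≤⟨ rt-lower k d ⟩
  d * (k * k)        ≤⟨ *-monoˡ-≤ (k * k) (≤-trans d≤2 (m≤m+n 2 2)) ⟩
  4 * (k * k)        ≡⟨ solve 1 (λ k → con 4 :* (k :* k) := con 2 :* k :* (con 2 :* k)) refl k ⟩
  2 * k * (2 * k)    ∎)
  where
  open ≤-Reasoning
  open +-*-Solver

-- Copies of F₅

image-triple : (f : Fin m → Fin n) → ∀ {i j k} →
  ⁅ f i ⁆ ∪ (⁅ f j ⁆ ∪ (⁅ f k ⁆ ∪ ⊥)) ≡ triple (f i) (f j) (f k)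
image-triple f {i} {j} {k} = cong (λ p → ⁅ f i ⁆ ∪ (⁅ f j ⁆ ∪ p)) (∪-identityʳ ⁅ f k ⁆)

module _ (H : ThreeGraph n) where

  -- Of the ten pairs of vertices of F₅, eight lie in a common edge and are distinct for that
  -- reason. The other two, ae and be, are separated by hypothesis.
  F₅-copy : ∀ {a b c d e} → Edge₃ H a b c → Edge₃ H a b d → Edge₃ H c d e →
            a ≢ e → b ≢ e → F₅ ⊑ H
  F₅-copy {a} {b} {c} {d} {e} abc abd cde a≢e b≢e = f , (λ {i} {j} → lookup-injective unique i j) , hom
    where
    f : Fin 5 → Fin n
    f = lookup (a ∷ b ∷ c ∷ d ∷ e ∷ [])
    rot : ∀ {x y z} → Edge₃ H x y z → Edge₃ H y z x
    rot = edge-rotate H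
    ≢₂ : ∀ {x y z} → Edge₃ H x y z → y ≢ z
    ≢₂ h = edge-≢ H (rot h)
    ≢₃ : ∀ {x y z} → Edge₃ H x y z → x ≢ z
    ≢₃ h = edge-≢ H (rot (rot h)) ∘ sym
    unique = (edge-≢ H abc ∷ ≢₃ abc ∷ ≢₃ abd ∷ a≢e ∷ [])
           ∷ (≢₂ abc ∷ ≢₂ abd ∷ b≢e ∷ [])
           ∷ (edge-≢ H cde ∷ ≢₃ cde ∷ [])
           ∷ (≢₂ cde ∷ [])
           ∷ []
           ∷ []
    hom : ∀ S → Edge F₅ S → Edge H (image f S)
    hom S h with proj₂ (toWitness h)
    ... | here refl                 = subst (Edge H) (sym (image-triple f {0F} {1F} {2F})) (edge abc)
    ... | there (here refl)         = subst (Edge H) (sym (image-triple f {0F} {1F} {3F})) (edge abd)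
    ... | there (there (here refl)) = subst (Edge H) (sym (image-triple f {2F} {3F} {4F})) (edge cde)

-- The upper bound on the norm of an F₅-free 3-graph

sum-indicator : (x : Fin n) → sum (λ y → 𝟙 (does (x ≟ᶠ y))) ≡ 1
sum-indicator {suc n} zero    = cong suc (sum-zero {n} {f = λ _ → 0} λ _ → refl)
sum-indicator {suc n} (suc x) = sum-indicator x

-- This is why heavy starts at codegree 3: `y` and `z` account for at most two of the members.
third-member : (b : Fin n → Bool) → 3 ≤ sum (𝟙 ∘ b) → ∀ y z → ∃ λ x → T (b x) × y ≢ x × z ≢ x
third-member b h y z with any? (λ x → T? (b x) ×-dec ¬? (y ≟ᶠ x) ×-dec ¬? (z ≟ᶠ x))
... | yes found = found
... | no  none  = contradiction (≤-trans h (begin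
  sum (𝟙 ∘ b)                                                      ≤⟨ sum-mono pointwise ⟩
  sum (λ x → 𝟙 (does (y ≟ᶠ x)) + 𝟙 (does (z ≟ᶠ x)))                ≡⟨ ∑-distrib-+ (λ x → 𝟙 (does (y ≟ᶠ x))) _ ⟩
  sum (λ x → 𝟙 (does (y ≟ᶠ x))) + sum (λ x → 𝟙 (does (z ≟ᶠ x)))    ≡⟨ cong₂ _+_ (sum-indicator y) (sum-indicator z) ⟩
  2                                                                ∎)) λ { (s≤s (s≤s ())) }
  where
  open ≤-Reasoning
  pointwise : ∀ x → 𝟙 (b x) ≤ 𝟙 (does (y ≟ᶠ x)) + 𝟙 (does (z ≟ᶠ x))
  pointwise x with y ≟ᶠ x | z ≟ᶠ x
  ... | yes _ | _     = ≤-trans (𝟙≤1 (b x)) (s≤s z≤n)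
  ... | no  _ | yes _ = 𝟙≤1 (b x)
  ... | no  p | no  q = ≤-reflexive (¬T⇒𝟙≡0 λ t → none (x , t , p , q))

module _ (H : ThreeGraph n) where

  heavy : Fin n → Fin n → ℕ
  heavy x y = 𝟙 (does (3 ≤? codeg H x y))

  heavyDeg : Fin n → ℕ
  heavyDeg x = sum (heavy x)

  rotate-sum : (f : Fin n → Fin n → Fin n → ℕ) →
    sum (λ y → sum (λ z → sum (λ x → f x y z))) ≡ sum (λ x → sum (λ y → sum (f x y)))
  rotate-sum f = trans (sum-cong-≗ λ y → ∑-comm (λ z x → f x y z)) (∑-comm (λ y x → sum (f x y)))

  module _ (free : F₅ IsFree H) where

    heavyDeg+codeg≤n : ∀ {x y z} → Edge₃ H x y z → heavyDeg x + codeg H y z ≤ n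
    heavyDeg+codeg≤n {x} {y} {z} xyz = begin
      heavyDeg x + codeg H y z                ≡⟨ ∑-distrib-+ (heavy x) (ind H y z) ⟨
      sum (λ t → heavy x t + ind H y z t)     ≤⟨ sum-≤-const exclusive ⟩
      n * 1                                   ≡⟨ *-identityʳ n ⟩
      n                                       ∎
      where
      open ≤-Reasoning
      exclusive : ∀ t → heavy x t + ind H y z t ≤ 1
      exclusive t with 3 ≤? codeg H x t
      ... | no  c≤2 = subst (λ h → h + ind H y z t ≤ 1) (sym (𝟙-no (3 ≤? codeg H x t) c≤2)) (𝟙≤1 (edge? H (triple y z t)))
      ... | yes 3≤c with T? (edge? H (triple y z t))
      ...   | no ¬yzt = subst (λ h → heavy x t + h ≤ 1) (sym (¬T⇒𝟙≡0 ¬yzt))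
                          (subst (_≤ 1) (sym (+-identityʳ (heavy x t))) (𝟙≤1 (does (3 ≤? codeg H x t))))
      -- The edges yzx, yzt and xtw form a copy of F₅ once w avoids y and z, and the heavy pair xt
      -- supplies such a w.
      ...   | yes yzt with w , xtw , y≢w , z≢w ← third-member (λ w → edge? H (triple x t w)) 3≤c y z =
        contradiction (F₅-copy H (edge-rotate H xyz) (edge₃ yzt) (edge₃ xtw) y≢w z≢w) free

    -- The bound `heavyDeg+codeg≤n` is summed over ordered edges xyz and regrouped by pairs:
    -- `heavyDeg x` along xy and `codeg H y z` along yz, every pair being met as often as its
    -- codegree says.
    sum-codeg-heavyDeg : sum (λ y → sum λ z → codeg H y z * (heavyDeg y + codeg H y z))
                         ≤ n * sum (λ y → sum (codeg H y))
    sum-codeg-heavyDeg = begin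
      sum (λ y → sum λ z → codeg H y z * (heavyDeg y + codeg H y z))
        ≡⟨ sum₂-cong (λ y z → *-distribˡ-+ (codeg H y z) (heavyDeg y) (codeg H y z)) ⟩
      sum (λ y → sum λ z → codeg H y z * heavyDeg y + codeg H y z * codeg H y z)
        ≡⟨ sum₂-+ (λ y z → codeg H y z * heavyDeg y) (λ y z → codeg H y z * codeg H y z) ⟩
      sum (λ y → sum λ z → codeg H y z * heavyDeg y) + sum (λ y → sum λ z → codeg H y z * codeg H y z)
        ≡⟨ cong₂ _+_
             (sum₂-cong λ x y → *-distribʳ-sum (heavyDeg x) (ind H x y))
             (trans (sum₂-cong λ y z → *-distribʳ-sum (codeg H y z) (ind H y z))
             (trans (rotate-sum λ x y z → ind H y z x * codeg H y z)
                    (sum-cong-≗ λ x → sum₂-cong λ y z → cong (_* codeg H y z) (sym (ind-rotate H x y z))))) ⟩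
      sum (λ x → sum λ y → sum λ z → ind H x y z * heavyDeg x) +
      sum (λ x → sum λ y → sum λ z → ind H x y z * codeg H y z)
        ≡⟨ ∑-distrib-+ (λ x → sum λ y → sum λ z → ind H x y z * heavyDeg x) _ ⟨
      sum (λ x → sum (λ y → sum λ z → ind H x y z * heavyDeg x) + sum (λ y → sum λ z → ind H x y z * codeg H y z))
        ≡⟨ sum-cong-≗ (λ x → sum₂-+ (λ y z → ind H x y z * heavyDeg x) (λ y z → ind H x y z * codeg H y z)) ⟨
      sum (λ x → sum λ y → sum λ z → ind H x y z * heavyDeg x + ind H x y z * codeg H y z)
        ≤⟨ sum-mono (λ x → sum₂-mono λ y z → pointwise x y z) ⟩
      sum (λ x → sum λ y → sum λ z → n * ind H x y z)
        ≡⟨ sum-cong-≗ (λ x → sum₂-* n (ind H x)) ⟩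
      sum (λ x → n * sum λ y → codeg H x y)
        ≡⟨ *-distribˡ-sum n (λ x → sum (codeg H x)) ⟨
      n * sum (λ x → sum (codeg H x)) ∎
      where
      open ≤-Reasoning
      pointwise : ∀ x y z → ind H x y z * heavyDeg x + ind H x y z * codeg H y z ≤ n * ind H x y z
      pointwise x y z with T? (edge? H (triple x y z))
      ... | no ¬h rewrite ¬T⇒𝟙≡0 ¬h = z≤n
      ... | yes h rewrite T⇒𝟙≡1 h = subst₂ _≤_
        (sym (cong₂ _+_ (*-identityˡ (heavyDeg x)) (*-identityˡ (codeg H y z)))) (sym (*-identityʳ n))
        (heavyDeg+codeg≤n {x} {y} {z} (edge₃ h))

    -- The extra 1 is the new vertex: the bound is wanted at the order of the counterexample.
    module _ {σ} (1≤σ : 1 ≤ σ) (n≡ : n ≡ suc (3 * σ)) where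

      open +-*-Solver

      n≤4σ : n ≤ 4 * σ
      n≤4σ = begin
        n             ≡⟨ n≡ ⟩
        1 + 3 * σ     ≤⟨ +-monoˡ-≤ (3 * σ) 1≤σ ⟩
        σ + 3 * σ     ∎
        where open ≤-Reasoning

      heavyDeg≤4σ : ∀ y → heavyDeg y ≤ 4 * σ
      heavyDeg≤4σ y = ≤-trans (sum-≤-const λ z → 𝟙≤1 (does (3 ≤? codeg H y z)))
        (≤-trans (≤-reflexive (*-identityʳ n)) n≤4σ)

      -- Only heavy z enter, so the error term 4σ² + w² of `codegree-bound` occurs `heavyDeg y`
      -- times, which is the product that `heavy-degree-bound` controls.
      row-bound : ∀ y → sum (λ z → heavy y z * (16 * σ * codeg H y z + 4 * (σ * σ))) ≤
                        4 * sum (λ z → codeg H y z * (heavyDeg y + codeg H y z)) + 16 * (σ * σ * σ)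
      row-bound y = begin
        sum (λ z → heavy y z * (16 * σ * codeg H y z + 4 * (σ * σ)))
          ≤⟨ sum-mono pointwise ⟩
        sum (λ z → 4 * (codeg H y z * (g + codeg H y z)) + heavy y z * c)
          ≡⟨ ∑-distrib-+ (λ z → 4 * (codeg H y z * (g + codeg H y z))) (λ z → heavy y z * c) ⟩
        sum (λ z → 4 * (codeg H y z * (g + codeg H y z))) + sum (λ z → heavy y z * c)
          ≡⟨ cong₂ _+_ (*-distribˡ-sum 4 (λ z → codeg H y z * (g + codeg H y z))) (*-distribʳ-sum c (heavy y)) ⟨
        4 * sum (λ z → codeg H y z * (g + codeg H y z)) + g * c
          ≤⟨ +-monoʳ-≤ _ (heavy-degree-bound {σ} {g} {w} g+w≡) ⟩
        4 * sum (λ z → codeg H y z * (g + codeg H y z)) + 16 * (σ * σ * σ) ∎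
        where
        open ≤-Reasoning
        g = heavyDeg y
        w = 4 * σ ∸ g
        c = 4 * (σ * σ) + w * w
        g+w≡ : g + w ≡ 4 * σ
        g+w≡ = m+[n∸m]≡n (heavyDeg≤4σ y)
        scale : ∀ b {l r t} → l ≤ r + t → 𝟙 b * l ≤ r + 𝟙 b * t
        scale false     h = z≤n
        scale true  {l} {r} {t} h = subst₂ _≤_ (sym (*-identityˡ l)) (cong (r +_) (sym (*-identityˡ t))) h
        pointwise : ∀ z → heavy y z * (16 * σ * codeg H y z + 4 * (σ * σ)) ≤
                          4 * (codeg H y z * (g + codeg H y z)) + heavy y z * c
        pointwise z = scale (does (3 ≤? codeg H y z)) (codegree-bound {σ} {g} {w} (codeg H y z) g+w≡)

      -- For σ = s² the quantity d + σ bounds 2s√d by the tangent to the root at σ. The restriction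
      -- to heavy pairs matters: on light pairs the constant σ could already add up to the order of
      -- the main term.
      ∑codeg ∑heavy ∑weight : ℕ
      ∑codeg = sum (λ y → sum (codeg H y))
      ∑heavy = sum (λ y → sum λ z → heavy y z * codeg H y z)
      ∑weight = sum (λ y → sum λ z → heavy y z * (codeg H y z + σ))

      ∑codeg≤ : ∑codeg ≤ ∑heavy + n * (n * 2)
      ∑codeg≤ = begin
        ∑codeg                                                      ≤⟨ sum₂-mono pointwise ⟩
        sum (λ y → sum λ z → heavy y z * codeg H y z + 2)      ≡⟨ sum₂-+ (λ y z → heavy y z * codeg H y z) (λ _ _ → 2) ⟩
        ∑heavy + sum {n} (λ _ → sum {n} (λ _ → 2))                  ≡⟨ cong (∑heavy +_) (sum₂-const n n 2) ⟩
        ∑heavy + n * (n * 2)                                        ∎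
        where
        open ≤-Reasoning
        pointwise : ∀ y z → codeg H y z ≤ heavy y z * codeg H y z + 2
        pointwise y z with 3 ≤? codeg H y z
        ... | yes 3≤c = subst (λ h → codeg H y z ≤ h * codeg H y z + 2) (sym (𝟙-yes (3 ≤? codeg H y z) 3≤c))
                          (≤-trans (≤-reflexive (sym (*-identityˡ (codeg H y z)))) (m≤m+n _ 2))
        ... | no  c≱3 = ≤-trans (≤-pred (≰⇒> c≱3)) (m≤n+m 2 _)

      ∑heavy≤n³ : ∑heavy ≤ n * (n * n)
      ∑heavy≤n³ = ≤-trans (sum₂-mono pointwise) (≤-reflexive (sum₂-const n n n))
        where
        pointwise : ∀ y z → heavy y z * codeg H y z ≤ n
        pointwise y z = ≤-trans (*-mono-≤ (𝟙≤1 (does (3 ≤? codeg H y z)))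
                                          (sum-≤-const λ x → 𝟙≤1 (edge? H (triple y z x))))
                                (≤-reflexive (trans (*-identityˡ (n * 1)) (*-identityʳ n)))

      -- The left side of `codegree-bound` splits as 16σd + 4σ² = 4σ(d + σ) + 12σd. Divided by 4,
      -- the second part sums to 3σ `∑heavy`, which will cancel against n `∑codeg` up to lower order
      -- and leave the weights alone.
      σ∑weight≤ : σ * ∑weight + 3 * σ * ∑heavy ≤ n * ∑codeg + 4 * (σ * σ * σ) * n
      σ∑weight≤ = *-cancelˡ-≤ 4 (begin
        4 * (σ * ∑weight + 3 * σ * ∑heavy)
          ≡⟨ solve 3 (λ σ W A → con 4 :* (σ :* W :+ con 3 :* σ :* A)
                        := con 4 :* σ :* W :+ con 12 :* σ :* A) refl σ ∑weight ∑heavy ⟩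
        4 * σ * ∑weight + 12 * σ * ∑heavy
          ≡⟨ cong₂ _+_ (sum₂-* (4 * σ) (λ y z → heavy y z * (codeg H y z + σ)))
                       (sum₂-* (12 * σ) (λ y z → heavy y z * codeg H y z)) ⟨
        sum (λ y → sum λ z → 4 * σ * (heavy y z * (codeg H y z + σ))) +
        sum (λ y → sum λ z → 12 * σ * (heavy y z * codeg H y z))
          ≡⟨ sum₂-+ (λ y z → 4 * σ * (heavy y z * (codeg H y z + σ))) _ ⟨
        sum (λ y → sum λ z → 4 * σ * (heavy y z * (codeg H y z + σ)) + 12 * σ * (heavy y z * codeg H y z))
          ≡⟨ sum₂-cong (λ y z → solve 3 (λ σ h d →
               con 4 :* σ :* (h :* (d :+ σ)) :+ con 12 :* σ :* (h :* d)
               := h :* (con 16 :* σ :* d :+ con 4 :* (σ :* σ))) refl σ (heavy y z) (codeg H y z)) ⟩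
        sum (λ y → sum λ z → heavy y z * (16 * σ * codeg H y z + 4 * (σ * σ)))
          ≤⟨ sum-mono row-bound ⟩
        sum (λ y → 4 * sum (λ z → codeg H y z * (heavyDeg y + codeg H y z)) + 16 * (σ * σ * σ))
          ≡⟨ ∑-distrib-+ (λ y → 4 * sum (λ z → codeg H y z * (heavyDeg y + codeg H y z))) (λ _ → 16 * (σ * σ * σ)) ⟩
        sum (λ y → 4 * sum (λ z → codeg H y z * (heavyDeg y + codeg H y z))) + sum {n} (λ _ → 16 * (σ * σ * σ))
          ≡⟨ cong₂ _+_ (sym (*-distribˡ-sum 4 (λ y → sum (λ z → codeg H y z * (heavyDeg y + codeg H y z)))))
                       (sum-const n (16 * (σ * σ * σ))) ⟩
        4 * sum (λ y → sum (λ z → codeg H y z * (heavyDeg y + codeg H y z))) + n * (16 * (σ * σ * σ))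
          ≤⟨ +-monoˡ-≤ _ (*-monoʳ-≤ 4 sum-codeg-heavyDeg) ⟩
        4 * (n * ∑codeg) + n * (16 * (σ * σ * σ))
          ≡⟨ solve 3 (λ σ n C → con 4 :* (n :* C) :+ n :* (con 16 :* (σ :* σ :* σ))
                        := con 4 :* (n :* C :+ con 4 :* (σ :* σ :* σ) :* n)) refl σ n ∑codeg ⟩
        4 * (n * ∑codeg + 4 * (σ * σ * σ) * n) ∎)
        where open ≤-Reasoning

      -- As n = 3σ + 1 and light pairs have codegree at most 2, n `∑codeg` exceeds 3σ `∑heavy` by at
      -- most `∑heavy` + 2n³ ≤ 3n³ ≤ 192σ³. The last vertex adds 4σ³ through the term 4σ³n; together
      -- these are the 196.
      ∑weight≤ : ∑weight ≤ 12 * (σ * σ * σ) + 196 * (σ * σ)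
      ∑weight≤ = *-cancelˡ-≤ σ {{>-nonZero 1≤σ}} (+-cancelʳ-≤ (3 * σ * ∑heavy) _ _ (begin
        σ * ∑weight + 3 * σ * ∑heavy
          ≤⟨ σ∑weight≤ ⟩
        n * ∑codeg + 4 * (σ * σ * σ) * n
          ≤⟨ +-monoˡ-≤ _ (*-monoʳ-≤ n ∑codeg≤) ⟩
        n * (∑heavy + n * (n * 2)) + 4 * (σ * σ * σ) * n
          ≡⟨ solve 3 (λ σ n A → n :* (A :+ n :* (n :* con 2)) :+ con 4 :* (σ :* σ :* σ) :* n
                        := con 2 :* (n :* (n :* n)) :+ n :* (A :+ con 4 :* (σ :* σ :* σ))) refl σ n ∑heavy ⟩
        2 * (n * (n * n)) + n * (∑heavy + 4 * (σ * σ * σ))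
          ≡⟨ cong (λ m → 2 * (n * (n * n)) + m * (∑heavy + 4 * (σ * σ * σ))) n≡ ⟩
        2 * (n * (n * n)) + suc (3 * σ) * (∑heavy + 4 * (σ * σ * σ))
          ≡⟨ solve 3 (λ σ n³ A → con 2 :* n³ :+ (con 1 :+ con 3 :* σ) :* (A :+ con 4 :* (σ :* σ :* σ))
               := con 2 :* n³ :+ A :+ (con 12 :* (σ :* σ :* σ :* σ) :+ con 4 :* (σ :* σ :* σ) :+ con 3 :* σ :* A))
               refl σ (n * (n * n)) ∑heavy ⟩
        2 * (n * (n * n)) + ∑heavy + (12 * (σ * σ * σ * σ) + 4 * (σ * σ * σ) + 3 * σ * ∑heavy)
          ≤⟨ +-monoˡ-≤ _ (begin
            2 * (n * (n * n)) + ∑heavy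
              ≤⟨ +-monoʳ-≤ (2 * (n * (n * n))) ∑heavy≤n³ ⟩
            2 * (n * (n * n)) + n * (n * n)
              ≡⟨ solve 1 (λ n → con 2 :* (n :* (n :* n)) :+ n :* (n :* n) := con 3 :* (n :* (n :* n))) refl n ⟩
            3 * (n * (n * n))
              ≤⟨ *-monoʳ-≤ 3 (*-mono-≤ n≤4σ (*-mono-≤ n≤4σ n≤4σ)) ⟩
            3 * (4 * σ * (4 * σ * (4 * σ))) ∎) ⟩
        3 * (4 * σ * (4 * σ * (4 * σ))) + (12 * (σ * σ * σ * σ) + 4 * (σ * σ * σ) + 3 * σ * ∑heavy)
          ≡⟨ solve 2 (λ σ A → con 3 :* (con 4 :* σ :* (con 4 :* σ :* (con 4 :* σ)))
                :+ (con 12 :* (σ :* σ :* σ :* σ) :+ con 4 :* (σ :* σ :* σ) :+ con 3 :* σ :* A)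
               := σ :* (con 12 :* (σ :* σ :* σ) :+ con 196 :* (σ :* σ)) :+ con 3 :* σ :* A) refl σ ∑heavy ⟩
        σ * (12 * (σ * σ * σ) + 196 * (σ * σ)) + 3 * σ * ∑heavy ∎))
        where open ≤-Reasoning

-- The norm of H, scaled by k and with every root rounded down.
norm : ℕ → ThreeGraph n → ℕ
norm {n} k H = sumOver (rt k ∘ deg H) (subsetsOfSize 2 n)

sum-rt : (k : ℕ) (H : ThreeGraph n) → sum (λ x → sum (λ y → rt k (codeg H x y))) ≡ 2 * norm k H
sum-rt k H = sum-deg H (rt k) refl

-- The tangent is used on heavy pairs and the bound 2k on light ones. Ordered counting and the 2s of
-- the tangent produce the factor 4s, so 12σ³ = 12s⁶ yields the leading 3s⁵. Light pairs cost at
-- most 16s⁴ · 4s = 64s⁵, and with 196s⁴ ≤ 196s⁵ the error is 260s⁵ = 4s · 65s⁴.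
norm-upper : (H : ThreeGraph n) → F₅ IsFree H → ∀ s .{{_ : NonZero s}} → n ≡ suc (3 * (s * s)) →
             ∀ k .{{_ : NonZero k}} → norm k H ≤ k * (3 * s ^ 5 + 65 * s ^ 4)
norm-upper {n} H free s n≡ k = *-cancelˡ-≤ (4 * s) {{m*n≢0 4 s}} (begin
  4 * s * norm k H
    ≡⟨ solve 2 (λ s N → con 4 :* s :* N := con 2 :* s :* (con 2 :* N)) refl s (norm k H) ⟩
  2 * s * (2 * norm k H)
    ≡⟨ cong (2 * s *_) (sum-rt k H) ⟨
  2 * s * sum (λ y → sum λ z → rt k (codeg H y z))
    ≡⟨ sum₂-* (2 * s) (λ y z → rt k (codeg H y z)) ⟨
  sum (λ y → sum λ z → 2 * s * rt k (codeg H y z))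
    ≤⟨ sum₂-mono pointwise ⟩
  sum (λ y → sum λ z → k * (heavy H y z * (codeg H y z + s * s)) + k * (4 * s))
    ≡⟨ sum₂-+ (λ y z → k * (heavy H y z * (codeg H y z + s * s))) (λ _ _ → k * (4 * s)) ⟩
  sum (λ y → sum λ z → k * (heavy H y z * (codeg H y z + s * s))) + sum {n} (λ _ → sum {n} λ _ → k * (4 * s))
    ≡⟨ cong₂ _+_ (sum₂-* k (λ y z → heavy H y z * (codeg H y z + s * s))) (sum₂-const n n (k * (4 * s))) ⟩
  k * ∑weight H free 1≤σ n≡ + n * (n * (k * (4 * s)))
    ≤⟨ +-mono-≤ (*-monoʳ-≤ k (∑weight≤ H free 1≤σ n≡))
                (*-mono-≤ (n≤4σ H free 1≤σ n≡) (*-monoˡ-≤ (k * (4 * s)) (n≤4σ H free 1≤σ n≡))) ⟩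
  k * (12 * (s * s * (s * s) * (s * s)) + 196 * (s * s * (s * s))) +
  4 * (s * s) * (4 * (s * s) * (k * (4 * s)))
    ≡⟨ solve 2 (λ s k → k :* (con 12 :* (s :* s :* (s :* s) :* (s :* s)) :+ con 196 :* (s :* s :* (s :* s)))
           :+ con 4 :* (s :* s) :* (con 4 :* (s :* s) :* (k :* (con 4 :* s)))
         := k :* (con 12 :* s :^ 6 :+ con 64 :* s :^ 5 :+ con 196 :* s :^ 4 :* con 1)) refl s k ⟩
  k * (12 * s ^ 6 + 64 * s ^ 5 + 196 * s ^ 4 * 1)
    ≤⟨ *-monoʳ-≤ k (+-monoʳ-≤ (12 * s ^ 6 + 64 * s ^ 5) (*-monoʳ-≤ (196 * s ^ 4) (>-nonZero⁻¹ s))) ⟩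
  k * (12 * s ^ 6 + 64 * s ^ 5 + 196 * s ^ 4 * s)
    ≡⟨ solve 2 (λ s k → k :* (con 12 :* s :^ 6 :+ con 64 :* s :^ 5 :+ con 196 :* s :^ 4 :* s)
         := con 4 :* s :* (k :* (con 3 :* s :^ 5 :+ con 65 :* s :^ 4))) refl s k ⟩
  4 * s * (k * (3 * s ^ 5 + 65 * s ^ 4)) ∎)
  where
  open ≤-Reasoning
  open +-*-Solver
  1≤σ : 1 ≤ s * s
  1≤σ = *-mono-≤ (>-nonZero⁻¹ s) (>-nonZero⁻¹ s)
  pointwise : ∀ y z → 2 * s * rt k (codeg H y z) ≤ k * (heavy H y z * (codeg H y z + s * s)) + k * (4 * s)
  pointwise y z with 3 ≤? codeg H y z
  ... | yes 3≤c = subst (λ h → 2 * s * rt k (codeg H y z) ≤ k * (h * (codeg H y z + s * s)) + k * (4 * s))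
    (sym (𝟙-yes (3 ≤? codeg H y z) 3≤c))
    (≤-trans (rt-tangent s k (codeg H y z))
      (≤-trans (≤-reflexive (cong (k *_) (sym (*-identityˡ (codeg H y z + s * s))))) (m≤m+n _ (k * (4 * s)))))
  ... | no  c≱3 = ≤-trans (*-monoʳ-≤ (2 * s) (rt-small k (≤-pred (≰⇒> c≱3))))
    (≤-trans (≤-reflexive (solve 2 (λ s k → con 2 :* s :* (con 2 :* k) := k :* (con 4 :* s)) refl s k))
             (m≤n+m (k * (4 * s)) _))

-- By concavity √(d+1) - √d ≥ 1/(2s) as long as d + 1 ≤ s²; the final 2s pays for the rounding of
-- the larger root. After squaring, what remains is 4s√d + 1 ≤ 4s², which is the tangent bound
-- again.
rt-step : ∀ s k d .{{_ : NonZero k}} → suc d ≤ s * s → 2 * s * rt k d + k ≤ 2 * s * rt k (suc d) + 2 * s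
rt-step s k d d<s² = subst (2 * s * r + k ≤_) (trans (*-suc (2 * s) R) (+-comm (2 * s) (2 * s * R)))
  (m²≤n²⇒m≤n (begin
    (2 * s * r + k) * (2 * s * r + k)
      ≡⟨ solve 3 (λ s r k → (con 2 :* s :* r :+ k) :* (con 2 :* s :* r :+ k)
           := con 4 :* (s :* s) :* (r :* r) :+ k :* (con 2 :* (con 2 :* s :* r) :+ k)) refl s r k ⟩
    4 * (s * s) * (r * r) + k * (2 * (2 * s * r) + k)
      ≤⟨ +-mono-≤ (*-monoʳ-≤ (4 * (s * s)) (rt-lower k d)) (*-monoʳ-≤ k tangent) ⟩
    4 * (s * s) * (d * (k * k)) + k * (4 * (s * s) * k)
      ≡⟨ solve 3 (λ s d k → con 4 :* (s :* s) :* (d :* (k :* k)) :+ k :* (con 4 :* (s :* s) :* k)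
           := con 4 :* (s :* s) :* ((con 1 :+ d) :* (k :* k))) refl s d k ⟩
    4 * (s * s) * (suc d * (k * k))
      ≤⟨ *-monoʳ-≤ (4 * (s * s)) (<⇒≤ (rt-upper k (suc d))) ⟩
    4 * (s * s) * (suc R * suc R)
      ≡⟨ solve 2 (λ s t → con 4 :* (s :* s) :* (t :* t) := con 2 :* s :* t :* (con 2 :* s :* t)) refl s (suc R) ⟩
    2 * s * suc R * (2 * s * suc R) ∎))
  where
  open ≤-Reasoning
  open +-*-Solver
  r = rt k d
  R = rt k (suc d)
  tangent : 2 * (2 * s * r) + k ≤ 4 * (s * s) * k
  tangent = begin
    2 * (2 * s * r) + k              ≤⟨ +-mono-≤ (*-monoʳ-≤ 2 (rt-tangent s k d)) (m≤n*m k 2) ⟩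
    2 * (k * (d + s * s)) + 2 * k    ≡⟨ solve 3 (λ σ d k → con 2 :* (k :* (d :+ σ)) :+ con 2 :* k
                                          := con 2 :* (k :* ((con 1 :+ d) :+ σ))) refl (s * s) d k ⟩
    2 * (k * (suc d + s * s))        ≤⟨ *-monoʳ-≤ 2 (*-monoʳ-≤ k (+-monoˡ-≤ (s * s) d<s²)) ⟩
    2 * (k * (s * s + s * s))        ≡⟨ solve 2 (λ σ k → con 2 :* (k :* (σ :+ σ)) := con 4 :* σ :* k) refl (s * s) k ⟩
    4 * (s * s) * k                  ∎

-- Deleting a vertex

module _ (k : ℕ) (H : ThreeGraph (suc n)) (v : Fin (suc n)) where

  norm-split : 2 * norm k H ≡ 2 * sum (λ z → rt k (codeg H v z)) +
               sum (λ y → sum λ z → rt k (codeg H (punchIn v y) (punchIn v z)))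
  norm-split = begin
    2 * norm k H
      ≡⟨ sum-rt k H ⟨
    sum (λ y → sum λ z → ρ y z)
      ≡⟨ sum-remove {i = v} (λ y → sum (ρ y)) ⟩
    sum (ρ v) + sum (λ y → sum (ρ (punchIn v y)))
      ≡⟨ cong (sum (ρ v) +_) (trans (sum-cong-≗ λ y → sum-remove {i = v} (ρ (punchIn v y)))
           (∑-distrib-+ (λ y → ρ (punchIn v y) v) _)) ⟩
    sum (ρ v) + (sum (λ y → ρ (punchIn v y) v) + rest)
      ≡⟨ cong (λ x → sum (ρ v) + (x + rest)) column ⟩
    sum (ρ v) + (sum (ρ v) + rest)
      ≡⟨ solve 2 (λ a b → a :+ (a :+ b) := con 2 :* a :+ b) refl (sum (ρ v)) rest ⟩
    2 * sum (ρ v) + rest ∎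
    where
    open ≡-Reasoning
    open +-*-Solver
    ρ : Fin (suc n) → Fin (suc n) → ℕ
    ρ y z = rt k (codeg H y z)
    rest = sum (λ y → sum λ z → ρ (punchIn v y) (punchIn v z))
    column : sum (λ y → ρ (punchIn v y) v) ≡ sum (ρ v)
    column = trans (sum-cong-≗ λ y → cong (rt k) (codeg-sym H (punchIn v y) v))
      (sym (trans (sum-remove {i = v} (ρ v)) (cong (λ d → rt k d + sum (λ y → ρ v (punchIn v y))) (codeg-diag H v))))

  module _ .{{_ : NonZero k}} (s : ℕ) where

    -- Pairs joined to v whose codegree is at most s²; each loses at least k/2s up to rounding.
    losing : Fin (suc n) → Fin (suc n) → ℕ
    losing y z = 𝟙 (does (codeg H y z ≤? s * s)) * ind H y z v

    -- Pairs at v disappear with their whole root, pairs in `losing` drop by about k/(2s) through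
    -- `rt-step`, and no other pair gains. Each of the n² ordered pairs avoiding v is granted one
    -- unit of rounding, scaled by 2s.
    norm-∖ : 2 * s * (2 * norm k (H ∖ v)) + k * sum (λ y → sum (losing y)) +
             2 * s * (2 * sum (λ z → rt k (codeg H v z))) ≤ 2 * s * (2 * norm k H) + n * (n * (2 * s))
    norm-∖ = begin
      2 * s * (2 * norm k (H ∖ v)) + k * sum (λ y → sum (losing y)) + 2 * s * (2 * D)
        ≡⟨ cong (_+ 2 * s * (2 * D)) (cong₂ _+_
             (trans (cong (2 * s *_) (sym (sum-rt k (H ∖ v)))) (sym (sum₂-* (2 * s) λ y z → rt k (codeg (H ∖ v) y z))))
             (trans (cong (k *_) (sum₂-punchIn v losing row col)) (sym (sum₂-* k λ y z → losing (p y) (p z))))) ⟩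
      sum (λ y → sum λ z → 2 * s * rt k (codeg (H ∖ v) y z)) + sum (λ y → sum λ z → k * losing (p y) (p z)) + 2 * s * (2 * D)
        ≡⟨ cong (_+ 2 * s * (2 * D)) (sum₂-+ (λ y z → 2 * s * rt k (codeg (H ∖ v) y z)) (λ y z → k * losing (p y) (p z))) ⟨
      sum (λ y → sum λ z → 2 * s * rt k (codeg (H ∖ v) y z) + k * losing (p y) (p z)) + 2 * s * (2 * D)
        ≤⟨ +-monoˡ-≤ (2 * s * (2 * D)) (sum₂-mono pointwise) ⟩
      sum (λ y → sum λ z → 2 * s * rt k (codeg H (p y) (p z)) + 2 * s) + 2 * s * (2 * D)
        ≡⟨ cong (_+ 2 * s * (2 * D)) (trans (sum₂-+ (λ y z → 2 * s * rt k (codeg H (p y) (p z))) (λ _ _ → 2 * s))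
             (cong₂ _+_ (sum₂-* (2 * s) λ y z → rt k (codeg H (p y) (p z))) (sum₂-const n n (2 * s)))) ⟩
      2 * s * R + n * (n * (2 * s)) + 2 * s * (2 * D)
        ≡⟨ solve 4 (λ s R E D → con 2 :* s :* R :+ E :+ con 2 :* s :* D := con 2 :* s :* (D :+ R) :+ E)
             refl s R (n * (n * (2 * s))) (2 * D) ⟩
      2 * s * (2 * D + R) + n * (n * (2 * s))
        ≡⟨ cong (λ x → 2 * s * x + n * (n * (2 * s))) norm-split ⟨
      2 * s * (2 * norm k H) + n * (n * (2 * s)) ∎
      where
      open ≤-Reasoning
      open +-*-Solver
      p = punchIn v
      D = sum (λ z → rt k (codeg H v z))
      R = sum (λ y → sum λ z → rt k (codeg H (p y) (p z)))
      row : ∀ z → losing v z ≡ 0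
      row z = trans (cong (𝟙 (does (codeg H v z ≤? s * s)) *_) (¬T⇒𝟙≡0 λ h →
        edge-≢ H (edge-rotate H (edge-rotate H (edge₃ {x = v} {z} {v} h))) refl)) (*-zeroʳ (𝟙 (does (codeg H v z ≤? s * s))))
      col : ∀ y → losing y v ≡ 0
      col y = trans (cong (𝟙 (does (codeg H y v ≤? s * s)) *_) (¬T⇒𝟙≡0 λ h →
        edge-≢ H (edge-rotate H (edge₃ {x = y} {v} {v} h)) refl)) (*-zeroʳ (𝟙 (does (codeg H y v ≤? s * s))))
      step : ∀ b d {c} → c ≡ 𝟙 b + d → 2 * s * rt k d + k * (𝟙 (does (c ≤? s * s)) * 𝟙 b) ≤ 2 * s * rt k c + 2 * s
      step false d {c} refl = begin
        2 * s * rt k d + k * (𝟙 (does (d ≤? s * s)) * 0)  ≡⟨ cong (λ x → 2 * s * rt k d + k * x) (*-zeroʳ (𝟙 (does (d ≤? s * s)))) ⟩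
        2 * s * rt k d + k * 0                            ≡⟨ cong (2 * s * rt k d +_) (*-zeroʳ k) ⟩
        2 * s * rt k d + 0                                ≤⟨ +-monoʳ-≤ (2 * s * rt k d) z≤n ⟩
        2 * s * rt k d + 2 * s                            ∎
      step true d refl = by (suc d ≤? s * s)
        where
        by : (d<s² : Dec (suc d ≤ s * s)) →
             2 * s * rt k d + k * (𝟙 (does d<s²) * 1) ≤ 2 * s * rt k (suc d) + 2 * s
        by (yes d<s²) = subst (λ x → 2 * s * rt k d + x ≤ 2 * s * rt k (suc d) + 2 * s)
          (sym (*-identityʳ k)) (rt-step s k d d<s²)
        by (no  _)    = +-mono-≤ (*-monoʳ-≤ (2 * s) (rt-mono k (n≤1+n d)))
          (≤-trans (≤-reflexive (*-zeroʳ k)) z≤n)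
      pointwise : ∀ y z → 2 * s * rt k (codeg (H ∖ v) y z) + k * losing (p y) (p z) ≤
                          2 * s * rt k (codeg H (p y) (p z)) + 2 * s
      pointwise y z = step (edge? H (triple (p y) (p z) v)) (codeg (H ∖ v) y z) (codeg-∖ H v y z)

-- Elements of finite sets

∈-triple : ∀ {w} (x y z : Fin n) → w ∈ triple x y z → w ≡ x ⊎ w ≡ y ⊎ w ≡ z
∈-triple x y z h with x∈p∪q⁻ ⁅ x ⁆ (⁅ y ⁆ ∪ ⁅ z ⁆) h
... | inj₁ p = inj₁ (x∈⁅y⁆⇒x≡y x p)
... | inj₂ q with x∈p∪q⁻ ⁅ y ⁆ ⁅ z ⁆ q
...   | inj₁ p = inj₂ (inj₁ (x∈⁅y⁆⇒x≡y y p))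
...   | inj₂ p = inj₂ (inj₂ (x∈⁅y⁆⇒x≡y z p))

triple-∋₁ : (x y z : Fin n) → x ∈ triple x y z
triple-∋₁ x y z = x∈p∪q⁺ (inj₁ (x∈⁅x⁆ x))

triple-∋₂ : (x y z : Fin n) → y ∈ triple x y z
triple-∋₂ x y z = x∈p∪q⁺ (inj₂ (x∈p∪q⁺ (inj₁ (x∈⁅x⁆ y))))

triple-∋₃ : (x y z : Fin n) → z ∈ triple x y z
triple-∋₃ x y z = x∈p∪q⁺ (inj₂ (x∈p∪q⁺ (inj₂ (x∈⁅x⁆ z))))

extract : (p : Subset n) → ∀ {j} → ∣ p ∣ ≡ suc j →
          ∃ λ x → x ∈ p × ∃ λ q → ∣ q ∣ ≡ j × (∀ {y} → y ∈ q → y ∈ p × y ≢ x)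
extract (inside  ∷ p) eq = zero , here , outside ∷ p , suc-injective eq ,
  λ { (there h) → there h , λ () }
extract (outside ∷ p) eq with x , x∈p , q , ∣q∣ , q⊆p ← extract p eq =
  suc x , there x∈p , outside ∷ q , ∣q∣ ,
  λ { (there h) → there (proj₁ (q⊆p h)) , λ { refl → proj₂ (q⊆p h) refl } }

third-colour : ∀ (a b c d : Fin 3) → a ≢ b → c ≢ a → c ≢ b → d ≢ a → d ≢ b → c ≡ d
third-colour = toWitness {a? = all? λ a → all? λ b → all? λ c → all? λ d →
  ¬? (a ≟ᶠ b) →-dec ¬? (c ≟ᶠ a) →-dec ¬? (c ≟ᶠ b) →-dec ¬? (d ≟ᶠ a) →-dec ¬? (d ≟ᶠ b) →-dec (c ≟ᶠ d)} tt

-- The counterexample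

-- A vertex is a colour, a block and a position below `β`, so the graph consists of 3u cells of size
-- `β`. Links stay inside a block and skip its omitted colour; with two colours left, all link
-- neighbours of a vertex fall into one class.
module Construction (u β : ℕ) (omitted : Fin u → Fin 3) where

  N : ℕ
  N = 3 * (u * β)

  colour : Fin N → Fin 3
  colour = quotient (u * β)

  block : Fin N → Fin u
  block x = quotient β (remainder {3} (u * β) x)

  -- Link is the graph L, which joins the two colours that a block does not omit; the added
  -- vertex v is zero.
  Link Cross : Fin N → Fin N → Set
  Link x y = block x ≡ block y × colour x ≢ colour y ×
             colour x ≢ omitted (block x) × colour y ≢ omitted (block y)
  Cross x y = colour x ≢ colour y × ¬ Link x y

  abstract
    link? : ∀ x y → Dec (Link x y)
    link? x y = (block x ≟ᶠ block y) ×-dec ¬? (colour x ≟ᶠ colour y) ×-dec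
      ¬? (colour x ≟ᶠ omitted (block x)) ×-dec ¬? (colour y ≟ᶠ omitted (block y))

    cross? : ∀ x y → Dec (Cross x y)
    cross? x y = ¬? (colour x ≟ᶠ colour y) ×-dec ¬? (link? x y)

  link-sym : ∀ {x y} → Link x y → Link y x
  link-sym (b , c , ox , oy) = sym b , c ∘ sym , oy , ox

  cross-sym : ∀ {x y} → Cross x y → Cross y x
  cross-sym (c , ¬l) = c ∘ sym , ¬l ∘ link-sym

  link⇒≢ : ∀ {x y} → Link x y → x ≢ y
  link⇒≢ (_ , c , _) refl = c refl

  cross⇒≢ : ∀ {x y} → Cross x y → x ≢ y
  cross⇒≢ (c , _) refl = c refl

  Joined : Bool → Fin N → Fin N → Set
  Joined true  = Link
  Joined false = Cross

  joined? : ∀ b x y → Dec (Joined b x y)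
  joined? true  = link?
  joined? false = cross?

  -- Stated through pairs, so that it does not depend on an order of the vertices. `lookup e zero`
  -- tells whether the new vertex lies in `e` and thereby selects `Link` or `Cross`; three old
  -- vertices that are pairwise `Cross` use all three colours.
  IsEdge : Subset (suc N) → Set
  IsEdge e = ∣ e ∣ ≡ 3 × (∀ x y → suc x ∈ e → suc y ∈ e → x ≢ y → Joined (lookup e zero) x y)

  abstract
    isEdge? : ∀ e → Dec (IsEdge e)
    isEdge? e = (∣ e ∣ ≟ 3) ×-dec all? λ x → all? λ y →
      (suc x ∈? e) →-dec (suc y ∈? e) →-dec ¬? (x ≟ᶠ y) →-dec joined? (lookup e zero) x y

  H : ThreeGraph (suc N)
  H = record
    { edge?   = λ e → isYes (isEdge? e)
    ; uniform = λ e h → proj₁ (toWitness {a? = isEdge? e} h)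
    }

  edge⇒ : ∀ {e} → Edge H e → IsEdge e
  edge⇒ {e} h = toWitness {a? = isEdge? e} h

  edge⇐ : ∀ {e} → IsEdge e → Edge H e
  edge⇐ {e} h = fromWitness {a? = isEdge? e} h

  link-edge : ∀ {x y} → Link x y → Edge₃ H zero (suc x) (suc y)
  link-edge {x} {y} l = edge₃ (edge⇐ {triple zero (suc x) (suc y)}
    (∣triple∣ zero (suc x) (suc y) (λ ()) (λ { refl → link⇒≢ l refl }) (λ ()) , pairs))
    where
    pairs : ∀ a b → suc a ∈ triple zero (suc x) (suc y) → suc b ∈ triple zero (suc x) (suc y) → a ≢ b → Link a b
    pairs a b a∈ b∈ a≢b with ∈-triple zero (suc x) (suc y) a∈ | ∈-triple zero (suc x) (suc y) b∈
    ... | inj₂ (inj₁ refl) | inj₂ (inj₁ refl) = contradiction refl a≢b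
    ... | inj₂ (inj₁ refl) | inj₂ (inj₂ refl) = l
    ... | inj₂ (inj₂ refl) | inj₂ (inj₁ refl) = link-sym l
    ... | inj₂ (inj₂ refl) | inj₂ (inj₂ refl) = contradiction refl a≢b

  cross-edge : ∀ {x y z} → Cross x y → Cross y z → Cross x z → Edge₃ H (suc x) (suc y) (suc z)
  cross-edge {x} {y} {z} xy yz xz = edge₃ (edge⇐ {e} (∣triple∣ (suc x) (suc y) (suc z)
    (λ { refl → cross⇒≢ xy refl }) (λ { refl → cross⇒≢ yz refl }) (λ { refl → cross⇒≢ xz refl }) , pairs))
    where
    e = triple (suc x) (suc y) (suc z)
    pairs : ∀ a b → suc a ∈ e → suc b ∈ e → a ≢ b → Cross a b
    pairs a b a∈ b∈ a≢b with ∈-triple (suc x) (suc y) (suc z) a∈ | ∈-triple (suc x) (suc y) (suc z) b∈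
    ... | inj₁ refl        | inj₁ refl        = contradiction refl a≢b
    ... | inj₁ refl        | inj₂ (inj₁ refl) = xy
    ... | inj₁ refl        | inj₂ (inj₂ refl) = xz
    ... | inj₂ (inj₁ refl) | inj₁ refl        = cross-sym xy
    ... | inj₂ (inj₁ refl) | inj₂ (inj₁ refl) = contradiction refl a≢b
    ... | inj₂ (inj₁ refl) | inj₂ (inj₂ refl) = yz
    ... | inj₂ (inj₂ refl) | inj₁ refl        = cross-sym xz
    ... | inj₂ (inj₂ refl) | inj₂ (inj₁ refl) = cross-sym yz
    ... | inj₂ (inj₂ refl) | inj₂ (inj₂ refl) = contradiction refl a≢b

  edge-link : ∀ {x y} → Edge₃ H zero (suc x) (suc y) → Link x y
  edge-link {x} {y} h = proj₂ (edge⇒ {e} (edge h)) x y (triple-∋₂ zero (suc x) (suc y)) (triple-∋₃ zero (suc x) (suc y))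
    λ { refl → edge-≢ H (edge-rotate H h) refl }
    where e = triple zero (suc x) (suc y)

  edge-cross : ∀ {x y z} → Edge₃ H (suc x) (suc y) (suc z) → Cross x y
  edge-cross {x} {y} {z} h = proj₂ (edge⇒ {e} (edge h)) x y
    (triple-∋₁ (suc x) (suc y) (suc z)) (triple-∋₂ (suc x) (suc y) (suc z)) λ { refl → edge-≢ H h refl }
    where e = triple (suc x) (suc y) (suc z)

  -- F₅-freeness

  -- Both neighbours lie in the block of x and avoid two different colours, that of x and the
  -- omitted one.
  link-colour : ∀ {x y z} → Link x y → Link x z → colour y ≡ colour z
  link-colour (bxy , cxy , ox , oy) (bxz , cxz , _ , oz) = third-colour _ _ _ _ ox
    (cxy ∘ sym) (λ eq → oy (trans eq (cong omitted bxy)))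
    (cxz ∘ sym) (λ eq → oz (trans eq (cong omitted bxz)))

  -- With the new vertex at a, both c and d are link neighbours of b and so share a colour. As `e`
  -- differs from `zero`, the edge cde consists of old vertices, whose colours differ.
  no-F₅-at-zero : ∀ b c d e → Edge₃ H zero b c → Edge₃ H zero b d → Edge₃ H c d e → zero ≢ e → ⊥₀
  no-F₅-at-zero zero c d e 0bc 0bd cde 0≢e = edge-≢ H 0bc refl
  no-F₅-at-zero (suc b) zero d e 0bc 0bd cde 0≢e = edge-≢ H (edge-rotate H (edge-rotate H 0bc)) refl
  no-F₅-at-zero (suc b) (suc c) zero e 0bc 0bd cde 0≢e = edge-≢ H (edge-rotate H (edge-rotate H 0bd)) refl
  no-F₅-at-zero (suc b) (suc c) (suc d) zero 0bc 0bd cde 0≢e = 0≢e refl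
  no-F₅-at-zero (suc b) (suc c) (suc d) (suc e) 0bc 0bd cde 0≢e =
    proj₁ (edge-cross cde) (link-colour (edge-link 0bc) (edge-link 0bd))

  -- The roles of a and b are symmetric. If the new vertex is c or d, one edge makes ab a link and
  -- the other makes it a cross pair. If it is e or absent, c and d both have the colour missing
  -- from ab, although they lie in a common edge.
  no-F₅ : ∀ a b c d e → Edge₃ H a b c → Edge₃ H a b d → Edge₃ H c d e → a ≢ e → b ≢ e → ⊥₀
  no-F₅ zero b c d e abc abd cde a≢e b≢e = no-F₅-at-zero b c d e abc abd cde a≢e
  no-F₅ (suc a) zero c d e abc abd cde a≢e b≢e =
    no-F₅-at-zero (suc a) c d e (edge-swap H abc) (edge-swap H abd) cde b≢e
  no-F₅ (suc a) (suc b) zero zero e abc abd cde a≢e b≢e = edge-≢ H cde refl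
  no-F₅ (suc a) (suc b) zero (suc d) e abc abd cde a≢e b≢e =
    proj₂ (edge-cross abd) (edge-link (edge-rotate H (edge-rotate H abc)))
  no-F₅ (suc a) (suc b) (suc c) zero e abc abd cde a≢e b≢e =
    proj₂ (edge-cross abc) (edge-link (edge-rotate H (edge-rotate H abd)))
  no-F₅ (suc a) (suc b) (suc c) (suc d) e abc abd cde a≢e b≢e = cd≢ e cde
    (third-colour _ _ _ _ (proj₁ (edge-cross abc))
      (proj₁ (edge-cross (edge-rotate H (edge-rotate H abc))))
      (proj₁ (edge-cross (edge-rotate H abc)) ∘ sym)
      (proj₁ (edge-cross (edge-rotate H (edge-rotate H abd))))
      (proj₁ (edge-cross (edge-rotate H abd)) ∘ sym))
    where
    cd≢ : ∀ e → Edge₃ H (suc c) (suc d) e → colour c ≢ colour d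
    cd≢ zero    h = proj₁ (proj₂ (edge-link (edge-rotate H (edge-rotate H h))))
    cd≢ (suc e) h = proj₁ (edge-cross h)

  F₅-free : F₅ IsFree H
  F₅-free (f , inj , hom) = no-F₅ (f 0F) (f 1F) (f 2F) (f 3F) (f 4F)
    (edge₃ (subst (Edge H) (image-triple f {0F} {1F} {2F}) (hom (triple 0F 1F 2F) tt)))
    (edge₃ (subst (Edge H) (image-triple f {0F} {1F} {3F}) (hom (triple 0F 1F 3F) tt)))
    (edge₃ (subst (Edge H) (image-triple f {2F} {3F} {4F}) (hom (triple 2F 3F 4F) tt)))
    (λ eq → case inj eq of λ ()) (λ eq → case inj eq of λ ())

  -- Three-partiteness

  ∖zero-threePartite : ThreePartite (H ∖ zero)
  ∖zero-threePartite = colour , λ e h i → let ∣e∣ , cross = edge⇒ {outside ∷ e} h in go e ∣e∣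
    (λ {x} {y} x∈e y∈e x≢y → proj₁ (cross x y (there x∈e) (there y∈e) x≢y)) i
    where
    go : ∀ e → ∣ e ∣ ≡ 3 → (∀ {x y} → x ∈ e → y ∈ e → x ≢ y → colour x ≢ colour y) → ∀ i →
         ∃ λ v → (v ∈ e × colour v ≡ i) × (∀ {w} → w ∈ e × colour w ≡ i → v ≡ w)
    go e ∣e∣ rainbow i = unique found
      where
      unique : (∃ λ v → v ∈ e × colour v ≡ i) →
               ∃ λ v → (v ∈ e × colour v ≡ i) × (∀ {w} → w ∈ e × colour w ≡ i → v ≡ w)
      unique (v , v∈e , refl) = v , (v∈e , refl) , λ {w} (w∈e , eq) →
        decidable-stable (v ≟ᶠ w) λ v≢w → rainbow v∈e w∈e v≢w (sym eq)
      found : ∃ λ v → v ∈ e × colour v ≡ i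
      found
        with x , x∈e , p , ∣p∣ , p⊆e ← extract e ∣e∣
        with y , y∈p , q , ∣q∣ , q⊆p ← extract p ∣p∣
        with z , z∈q , _ ← extract q ∣q∣
        with y∈e , y≢x ← p⊆e y∈p
        with z∈p , z≢y ← q⊆p z∈q
        with z∈e , z≢x ← p⊆e z∈p
        with colour x ≟ᶠ i | colour y ≟ᶠ i
      ... | yes x≡i | _       = x , x∈e , x≡i
      ... | no  _   | yes y≡i = y , y∈e , y≡i
      ... | no  x≢i | no  y≢i = z , z∈e , third-colour (colour x) (colour y) (colour z) i
        (rainbow x∈e y∈e (y≢x ∘ sym)) (rainbow z∈e x∈e z≢x) (rainbow z∈e y∈e z≢y) (x≢i ∘ sym) (y≢i ∘ sym)

  -- A linked vertex lies in an edge with the new vertex, and an edge has a single vertex in each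
  -- part.
  linked-colour : (χ : Fin (suc N) → Fin 3) →
                  (∀ e → Edge H e → ∀ i → ∃ λ v → (v ∈ e × χ v ≡ i) × (∀ {w} → w ∈ e × χ w ≡ i → v ≡ w)) →
                  ∀ {x y} → Link x y → χ (suc x) ≢ χ zero
  linked-colour χ part {x} {y} l eq with part (triple zero (suc x) (suc y)) (edge (link-edge l)) (χ zero)
  ... | w , _ , unique with () ← trans (sym (unique (triple-∋₁ zero (suc x) (suc y) , refl)))
                                       (unique (triple-∋₂ zero (suc x) (suc y) , eq))

  module _ (z : Fin β) {a b c : Fin u} (a≢b : a ≢ b) (b≢c : b ≢ c) (a≢c : a ≢ c)
           (oa : omitted a ≡ 1F) (ob : omitted b ≡ 0F) (oc : omitted c ≡ 1F) where

    vertex : Fin 3 → Fin u → Fin N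
    vertex i d = combine i (combine d z)

    colour-vertex : ∀ i d → colour (vertex i d) ≡ i
    colour-vertex i d = cong proj₁ (remQuot-combine {3} i (combine d z))

    block-vertex : ∀ i d → block (vertex i d) ≡ d
    block-vertex i d = trans (cong (quotient β) (cong proj₂ (remQuot-combine {3} i (combine d z))))
      (cong proj₁ (remQuot-combine {u} {β} d z))

    link-vertex : ∀ {i j d o} → omitted d ≡ o → i ≢ j → i ≢ o → j ≢ o → Link (vertex i d) (vertex j d)
    link-vertex {i} {j} {d} refl i≢j i≢o j≢o
      rewrite colour-vertex i d | colour-vertex j d | block-vertex i d | block-vertex j d =
      refl , i≢j , i≢o , j≢o

    cross-vertex : ∀ {i j d e} → i ≢ j → d ≢ e → Cross (vertex i d) (vertex j e)
    cross-vertex {i} {j} {d} {e} i≢j d≢e =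
      (λ eq → i≢j (trans (sym (colour-vertex i d)) (trans eq (colour-vertex j e)))) ,
      (λ l → d≢e (trans (sym (block-vertex i d)) (trans (proj₁ l) (block-vertex j e))))

    -- The vertices are taken from different blocks so that they are pairwise `Cross` and span an
    -- edge, and the values of `omitted` make each of them linked. One of the three must lie in the
    -- part of the new vertex, against `linked-colour`.
    not-threePartite : ¬ ThreePartite H
    not-threePartite (χ , part)
      with x , (x∈ , χx) , _ ← part (triple (suc (vertex 0F a)) (suc (vertex 1F b)) (suc (vertex 2F c)))
             (edge (cross-edge {vertex 0F a} {vertex 1F b} {vertex 2F c}
               (cross-vertex {0F} {1F} (λ ()) a≢b) (cross-vertex {1F} {2F} (λ ()) b≢c) (cross-vertex {0F} {2F} (λ ()) a≢c))) (χ zero)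
      with ∈-triple (suc (vertex 0F a)) (suc (vertex 1F b)) (suc (vertex 2F c)) x∈
    ... | inj₁ refl        = linked-colour χ part (link-vertex {0F} {2F} oa (λ ()) (λ ()) λ ()) χx
    ... | inj₂ (inj₁ refl) = linked-colour χ part (link-vertex {1F} {2F} ob (λ ()) (λ ()) λ ()) χx
    ... | inj₂ (inj₂ refl) = linked-colour χ part (link-vertex {2F} {0F} oc (λ ()) (λ ()) λ ()) χx

  -- Counting

  σ : ℕ
  σ = u * β

  link cross differ : Fin N → Fin N → ℕ
  link x y   = 𝟙 (does (link? x y))
  cross x y  = 𝟙 (does (cross? x y))
  differ x y = 𝟙 (does (¬? (colour x ≟ᶠ colour y)))

  -- Given colour c in a block omitting colour o, the colours of its linked vertices.
  linkable? : (c o d : Fin 3) → Dec (c ≢ d × c ≢ o × d ≢ o)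
  linkable? c o d = ¬? (c ≟ᶠ d) ×-dec ¬? (c ≟ᶠ o) ×-dec ¬? (d ≟ᶠ o)

  linkable : Fin 3 → Fin 3 → Fin 3 → ℕ
  linkable c o d = 𝟙 (does (linkable? c o d))

  -- On a link both blocks agree, so the omitted colour can be read off at x. For fixed x the
  -- condition then separates into one on the block of y and one on the colour of y.
  link≡ : ∀ x y → link x y ≡ 𝟙 (does (block x ≟ᶠ block y)) * linkable (colour x) (omitted (block x)) (colour y)
  link≡ x y = trans (𝟙-⇔ (link? x y) ((block x ≟ᶠ block y) ×-dec linkable? (colour x) (omitted (block x)) (colour y))
      (λ (b , c , ox , oy) → b , c , ox , λ eq → oy (trans eq (cong omitted b)))
      (λ (b , c , ox , oy) → b , c , ox , λ eq → oy (trans eq (cong omitted (sym b)))))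
    (𝟙-∧ (does (block x ≟ᶠ block y)) (does (linkable? (colour x) (omitted (block x)) (colour y))))

  sum-colour-block : (F : Fin 3 → Fin u → ℕ) →
                     sum (λ x → F (colour x) (block x)) ≡ β * sum (λ c → sum (F c))
  sum-colour-block F = begin
    sum (λ x → F (colour x) (block x))
      ≡⟨ sum-combine 3 {σ} (λ x → F (colour x) (block x)) ⟩
    sum (λ c → sum {σ} (λ r → F (colour (combine {3} c r)) (block (combine {3} c r))))
      ≡⟨ sum₂-cong (λ c r → cong₂ F (cong proj₁ (remQuot-combine {3} {σ} c r))
                                    (cong (quotient β) (cong proj₂ (remQuot-combine {3} {σ} c r)))) ⟩
    sum (λ c → sum {σ} (λ r → F c (quotient β r)))
      ≡⟨ sum-cong-≗ (λ c → trans (sum-combine u {β} (λ r → F c (quotient β r)))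
           (trans (sum₂-cong λ a b → cong (F c) (cong proj₁ (remQuot-combine {u} {β} a b)))
           (trans (sum-cong-≗ λ a → sum-const β (F c a)) (sym (*-distribˡ-sum β (F c)))))) ⟩
    sum (λ c → β * sum (F c))
      ≡⟨ *-distribˡ-sum β (λ c → sum (F c)) ⟨
    β * sum (λ c → sum (F c)) ∎
    where open ≡-Reasoning

  sum-colour : (f : Fin 3 → ℕ) → sum (f ∘ colour) ≡ sum f * σ
  sum-colour f = begin
    sum (f ∘ colour)                      ≡⟨ sum-colour-block (λ c _ → f c) ⟩
    β * sum (λ c → sum {u} (λ _ → f c))   ≡⟨ cong (β *_) (sum-cong-≗ λ c → sum-const u (f c)) ⟩
    β * sum (λ c → u * f c)               ≡⟨ cong (β *_) (*-distribˡ-sum u f) ⟨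
    β * (u * sum f)                       ≡⟨ solve 3 (λ β u s → β :* (u :* s) := s :* (u :* β)) refl β u (sum f) ⟩
    sum f * σ                             ∎
    where
    open ≡-Reasoning
    open +-*-Solver

  linkDeg : ∀ x → sum (link x) ≡ β * sum (linkable (colour x) (omitted (block x)))
  linkDeg x = begin
    sum (link x)
      ≡⟨ sum-cong-≗ (link≡ x) ⟩
    sum (λ y → 𝟙 (does (block x ≟ᶠ block y)) * linkable (colour x) o (colour y))
      ≡⟨ sum-colour-block (λ d b → 𝟙 (does (block x ≟ᶠ b)) * linkable (colour x) o d) ⟩
    β * sum (λ d → sum (λ b → 𝟙 (does (block x ≟ᶠ b)) * linkable (colour x) o d))
      ≡⟨ cong (β *_) (sum-cong-≗ λ d → trans (sym (*-distribʳ-sum (linkable (colour x) o d) λ b → 𝟙 (does (block x ≟ᶠ b))))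
           (trans (cong (_* linkable (colour x) o d) (sum-indicator (block x))) (*-identityˡ _))) ⟩
    β * sum (linkable (colour x) o) ∎
    where
    open ≡-Reasoning
    o = omitted (block x)

  linkDeg≤β : ∀ x → sum (link x) ≤ β
  linkDeg≤β x = ≤-trans (≤-reflexive (linkDeg x))
    (≤-trans (*-monoʳ-≤ β (few (colour x) (omitted (block x)))) (≤-reflexive (*-identityʳ β)))
    where
    few : ∀ c o → sum (linkable c o) ≤ 1
    few = toWitness {a? = all? λ c → all? λ o → sum (linkable c o) ≤? 1} tt

  -- Every block contributes a complete bipartite graph with parts of size β.
  sum-link : sum (λ x → sum (link x)) ≡ 2 * (u * (β * β))
  sum-link = begin
    sum (λ x → sum (link x))
      ≡⟨ sum-cong-≗ linkDeg ⟩
    sum (λ x → β * sum (linkable (colour x) (omitted (block x))))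
      ≡⟨ sum-colour-block (λ c a → β * sum (linkable c (omitted a))) ⟩
    β * sum (λ c → sum λ a → β * sum (linkable c (omitted a)))
      ≡⟨ cong (β *_) (trans (sum₂-* β (λ c a → sum (linkable c (omitted a))))
           (cong (β *_) (∑-comm λ c a → sum (linkable c (omitted a))))) ⟩
    β * (β * sum (λ a → sum λ c → sum (linkable c (omitted a))))
      ≡⟨ cong (λ t → β * (β * t)) (trans (sum-cong-≗ λ a → two (omitted a)) (sum-const u 2)) ⟩
    β * (β * (u * 2))
      ≡⟨ solve 2 (λ β u → β :* (β :* (u :* con 2)) := con 2 :* (u :* (β :* β))) refl β u ⟩
    2 * (u * (β * β)) ∎
    where
    open ≡-Reasoning
    open +-*-Solver
    two : ∀ o → sum (λ c → sum (linkable c o)) ≡ 2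
    two = toWitness {a? = all? λ o → sum (λ c → sum (linkable c o)) ≟ 2} tt

  sum-differ : ∀ x → sum (differ x) ≡ 2 * σ
  sum-differ x = trans (sum-colour λ d → 𝟙 (does (¬? (colour x ≟ᶠ d)))) (cong (_* σ) (two (colour x)))
    where
    two : ∀ c → sum (λ d → 𝟙 (does (¬? (c ≟ᶠ d)))) ≡ 2
    two = toWitness {a? = all? λ c → sum (λ d → 𝟙 (does (¬? (c ≟ᶠ d)))) ≟ 2} tt

  sum-third : ∀ {x y} → colour x ≢ colour y → sum (λ z → differ x z * differ y z) ≡ σ
  sum-third {x} {y} x≢y =
    trans (sum-colour λ d → 𝟙 (does (¬? (colour x ≟ᶠ d))) * 𝟙 (does (¬? (colour y ≟ᶠ d))))
      (trans (cong (_* σ) (one (colour x) (colour y) x≢y)) (*-identityˡ σ))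
    where
    one : ∀ c d → c ≢ d → sum (λ e → 𝟙 (does (¬? (c ≟ᶠ e))) * 𝟙 (does (¬? (d ≟ᶠ e)))) ≡ 1
    one = toWitness {a? = all? λ c → all? λ d → ¬? (c ≟ᶠ d) →-dec
      (sum (λ e → 𝟙 (does (¬? (c ≟ᶠ e))) * 𝟙 (does (¬? (d ≟ᶠ e)))) ≟ 1)} tt

  differ≤ : ∀ x y → differ x y ≤ cross x y + link x y
  differ≤ x y = 𝟙-⊎ (¬? (colour x ≟ᶠ colour y)) (cross? x y) (link? x y) λ x≢y → split x≢y (link? x y)
    where
    split : colour x ≢ colour y → Dec (Link x y) → Cross x y ⊎ Link x y
    split x≢y (yes l) = inj₂ l
    split x≢y (no ¬l) = inj₁ (x≢y , ¬l)

  crossDeg : ∀ x → 2 * σ ∸ β ≤ sum (cross x)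
  crossDeg x = m≤n+o⇒m∸n≤o (2 * σ) β (begin
    2 * σ                             ≡⟨ sum-differ x ⟨
    sum (differ x)                    ≤⟨ sum-mono (differ≤ x) ⟩
    sum (λ y → cross x y + link x y)  ≡⟨ ∑-distrib-+ (cross x) (link x) ⟩
    sum (cross x) + sum (link x)      ≤⟨ +-monoʳ-≤ (sum (cross x)) (linkDeg≤β x) ⟩
    sum (cross x) + β                 ≡⟨ +-comm (sum (cross x)) β ⟩
    β + sum (cross x)                 ∎)
    where open ≤-Reasoning

  -- Among the `σ` vertices of the third colour, x and y each spoil at most `β` by a link.
  crossCodeg : ∀ {x y} → colour x ≢ colour y → σ ∸ 2 * β ≤ sum (λ z → cross x z * cross y z)
  crossCodeg {x} {y} x≢y = m≤n+o⇒m∸n≤o σ (2 * β) (begin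
    σ
      ≡⟨ sum-third {x} {y} x≢y ⟨
    sum (λ z → differ x z * differ y z)
      ≤⟨ sum-mono (λ z → pointwise {differ x z} {differ y z} {cross x z} {cross y z}
          (differ≤ x z) (differ≤ y z) (𝟙≤1 _) (𝟙≤1 _)) ⟩
    sum (λ z → cross x z * cross y z + (link x z + link y z))
      ≡⟨ ∑-distrib-+ (λ z → cross x z * cross y z) (λ z → link x z + link y z) ⟩
    sum (λ z → cross x z * cross y z) + sum (λ z → link x z + link y z)
      ≡⟨ cong (sum (λ z → cross x z * cross y z) +_) (∑-distrib-+ (link x) (link y)) ⟩
    sum (λ z → cross x z * cross y z) + (sum (link x) + sum (link y))
      ≤⟨ +-monoʳ-≤ (sum (λ z → cross x z * cross y z)) (+-mono-≤ (linkDeg≤β x) (linkDeg≤β y)) ⟩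
    sum (λ z → cross x z * cross y z) + (β + β)
      ≡⟨ cong (λ b → sum (λ z → cross x z * cross y z) + (β + b)) (+-identityʳ β) ⟨
    sum (λ z → cross x z * cross y z) + 2 * β
      ≡⟨ +-comm (sum (λ z → cross x z * cross y z)) (2 * β) ⟩
    2 * β + sum (λ z → cross x z * cross y z) ∎)
    where
    open ≤-Reasoning
    open +-*-Solver
    pointwise : ∀ {d e c f l m} → d ≤ c + l → e ≤ f + m → e ≤ 1 → c ≤ 1 → d * e ≤ c * f + (l + m)
    pointwise {d} {e} {c} {f} {l} {m} d≤ e≤ e≤1 c≤1 = begin
      d * e                ≤⟨ *-monoˡ-≤ e d≤ ⟩
      (c + l) * e          ≡⟨ *-distribʳ-+ e c l ⟩
      c * e + l * e        ≤⟨ +-mono-≤ (*-monoʳ-≤ c e≤) (*-monoʳ-≤ l e≤1) ⟩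
      c * (f + m) + l * 1  ≡⟨ solve 4 (λ c f l m → c :* (f :+ m) :+ l :* con 1 := c :* f :+ (l :+ c :* m)) refl c f l m ⟩
      c * f + (l + c * m)  ≤⟨ +-monoʳ-≤ (c * f) (+-monoʳ-≤ l (≤-trans (*-monoˡ-≤ m c≤1) (≤-reflexive (*-identityˡ m)))) ⟩
      c * f + (l + m)      ∎

  -- Degrees in the construction

  link⇒ind : ∀ {x y} → Link x y → ind H (suc x) (suc y) zero ≡ 1
  link⇒ind {x} {y} l = T⇒𝟙≡1 (edge (edge-rotate H (link-edge l)))

  cross⇒ind : ∀ {x y} → Cross x y → ind H (suc x) (suc y) zero ≡ 0
  cross⇒ind {x} {y} (_ , ¬l) = ¬T⇒𝟙≡0 λ h →
    ¬l (edge-link (edge-rotate H (edge-rotate H (edge₃ {x = suc x} {suc y} {zero} h))))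

  link⇒codeg : ∀ {x y} → Link x y → codeg (H ∖ zero) x y ≡ 0
  link⇒codeg {x} {y} l = sum-zero {f = ind (H ∖ zero) x y} λ z → trans (ind-∖ H zero x y z)
    (¬T⇒𝟙≡0 λ h → proj₂ (edge-cross (edge₃ {x = suc x} {suc y} {suc z} h)) l)

  cross⇒codeg≤σ : ∀ {x y} → Cross x y → codeg H (suc x) (suc y) ≤ σ
  cross⇒codeg≤σ {x} {y} xy = ≤-trans
    (+-mono-≤ (≤-reflexive (cross⇒ind xy)) (sum-mono pointwise))
    (≤-reflexive (sum-third {x} {y} (proj₁ xy)))
    where
    pointwise : ∀ z → ind H (suc x) (suc y) (suc z) ≤ differ x z * differ y z
    pointwise z with T? (edge? H (triple (suc x) (suc y) (suc z)))
    ... | no ¬h = ≤-trans (≤-reflexive (¬T⇒𝟙≡0 ¬h)) z≤n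
    ... | yes h = ≤-trans (≤-reflexive (T⇒𝟙≡1 h)) (≤-reflexive (sym (cong₂ _*_
      (𝟙-yes (¬? (colour x ≟ᶠ colour z)) (proj₁ (edge-cross (edge-rotate H (edge-rotate H xyz))) ∘ sym))
      (𝟙-yes (¬? (colour y ≟ᶠ colour z)) (proj₁ (edge-cross (edge-rotate H xyz)))))))
      where
      xyz = edge₃ {H = H} {suc x} {suc y} {suc z} h

  cross⇒codeg≥ : ∀ {x y} → Cross x y → σ ∸ 2 * β ≤ codeg H (suc x) (suc y)
  cross⇒codeg≥ {x} {y} xy = ≤-trans (crossCodeg {x} {y} (proj₁ xy)) (≤-trans (sum-mono pointwise)
    (m≤n+m (sum λ z → ind H (suc x) (suc y) (suc z)) (ind H (suc x) (suc y) zero)))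
    where
    pointwise : ∀ z → cross x z * cross y z ≤ ind H (suc x) (suc y) (suc z)
    pointwise z = ≤-trans (≤-reflexive (sym (*-identityˡ (cross x z * cross y z))))
      (𝟙-×₃ (yes xy) (cross? x z) (cross? y z) λ xy xz yz → ≤-reflexive (sym (T⇒𝟙≡1 (edge (cross-edge xy yz xz)))))

  module _ (k : ℕ) .{{_ : NonZero k}} where

    -- The only edge on a link pair is the one through the new vertex, so its codegree falls from 1
    -- to 0 and its root by a full k. The pairs at the new vertex are simply discarded.
    norm-∖zero : 2 * norm k (H ∖ zero) + k * (2 * (u * (β * β))) ≤ 2 * norm k H
    norm-∖zero = begin
      2 * norm k (H ∖ zero) + k * (2 * (u * (β * β)))
        ≡⟨ cong₂ _+_ (sum-rt k (H ∖ zero)) (trans (sum₂-* k link) (cong (k *_) sum-link)) ⟨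
      sum (λ y → sum λ z → rt k (codeg (H ∖ zero) y z)) + sum (λ y → sum λ z → k * link y z)
        ≡⟨ sum₂-+ (λ y z → rt k (codeg (H ∖ zero) y z)) (λ y z → k * link y z) ⟨
      sum (λ y → sum λ z → rt k (codeg (H ∖ zero) y z) + k * link y z)
        ≤⟨ sum₂-mono (λ y z → pointwise y z (link? y z)) ⟩
      sum (λ y → sum λ z → rt k (codeg H (suc y) (suc z)))
        ≤⟨ m≤n+m _ (2 * sum (λ z → rt k (codeg H zero z))) ⟩
      2 * sum (λ z → rt k (codeg H zero z)) + sum (λ y → sum λ z → rt k (codeg H (suc y) (suc z)))
        ≡⟨ norm-split k H zero ⟨
      2 * norm k H ∎
      where
      open ≤-Reasoning
      pointwise : ∀ y z → Dec (Link y z) →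
                  rt k (codeg (H ∖ zero) y z) + k * link y z ≤ rt k (codeg H (suc y) (suc z))
      pointwise y z (yes l) = begin
        rt k (codeg (H ∖ zero) y z) + k * link y z
          ≡⟨ cong₂ (λ d i → rt k d + k * i) (link⇒codeg l) (𝟙-yes (link? y z) l) ⟩
        k * 1
          ≡⟨ *-identityʳ k ⟩
        k
          ≤⟨ rt-greatest {k} {1} (≤-reflexive (sym (*-identityˡ (k * k)))) ⟩
        rt k 1
          ≡⟨ cong (rt k) (trans (codeg-∖ H zero y z) (cong₂ _+_ (link⇒ind l) (link⇒codeg l))) ⟨
        rt k (codeg H (suc y) (suc z)) ∎
      pointwise y z (no ¬l) = begin
        rt k (codeg (H ∖ zero) y z) + k * link y z
          ≡⟨ cong (λ i → rt k (codeg (H ∖ zero) y z) + k * i) (𝟙-no (link? y z) ¬l) ⟩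
        rt k (codeg (H ∖ zero) y z) + k * 0
          ≡⟨ trans (cong (rt k (codeg (H ∖ zero) y z) +_) (*-zeroʳ k)) (+-identityʳ _) ⟩
        rt k (codeg (H ∖ zero) y z)
          ≤⟨ rt-mono k (≤-trans (m≤n+m _ (ind H (suc y) (suc z) zero)) (≤-reflexive (sym (codeg-∖ H zero y z)))) ⟩
        rt k (codeg H (suc y) (suc z)) ∎

    -- There are at least 2σ - β cross neighbours y of w, and for each at least σ - 2β vertices z
    -- completing an edge. The codegree of yz is at most `σ`, so `σ ≡ s * s` places the pair in
    -- `losing`.
    norm-∖suc : ∀ w s → σ ≡ s * s →
      2 * s * (2 * norm k (H ∖ suc w)) + k * ((2 * σ ∸ β) * (σ ∸ 2 * β)) +
      2 * s * (2 * ((2 * σ ∸ β) * rt k (σ ∸ 2 * β))) ≤ 2 * s * (2 * norm k H) + N * (N * (2 * s))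
    norm-∖suc w s σ≡ = ≤-trans
      (+-mono-≤ (+-monoʳ-≤ (2 * s * (2 * norm k (H ∖ suc w))) (*-monoʳ-≤ k many-losing))
                (*-monoʳ-≤ (2 * s) (*-monoʳ-≤ 2 large-degree)))
      (norm-∖ k H (suc w) s)
      where
      open ≤-Reasoning
      L = losing k H (suc w) s
      many-losing : (2 * σ ∸ β) * (σ ∸ 2 * β) ≤ sum (λ y → sum (L y))
      many-losing = begin
        (2 * σ ∸ β) * (σ ∸ 2 * β)
          ≤⟨ *-monoˡ-≤ (σ ∸ 2 * β) (crossDeg w) ⟩
        sum (cross w) * (σ ∸ 2 * β)
          ≡⟨ *-distribʳ-sum (σ ∸ 2 * β) (cross w) ⟩
        sum (λ y → cross w y * (σ ∸ 2 * β))
          ≤⟨ sum-mono (λ y → row y (cross? w y)) ⟩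
        sum (λ y → sum (L (suc y) ∘ suc))
          ≤⟨ sum-mono (λ y → m≤n+m (sum (L (suc y) ∘ suc)) (L (suc y) zero)) ⟩
        sum (λ y → sum (L (suc y)))
          ≤⟨ m≤n+m (sum (λ y → sum (L (suc y)))) (sum (L zero)) ⟩
        sum (λ y → sum (L y)) ∎
        where
        row : ∀ y → (wy? : Dec (Cross w y)) → 𝟙 (does wy?) * (σ ∸ 2 * β) ≤ sum (L (suc y) ∘ suc)
        row y (no  _)  = z≤n
        row y (yes wy) = begin
          1 * (σ ∸ 2 * β)                      ≡⟨ *-identityˡ (σ ∸ 2 * β) ⟩
          σ ∸ 2 * β                            ≤⟨ crossCodeg {w} {y} (proj₁ wy) ⟩
          sum (λ z → cross w z * cross y z)    ≤⟨ sum-mono pointwise ⟩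
          sum (L (suc y) ∘ suc)                ∎
          where
          pointwise : ∀ z → cross w z * cross y z ≤ L (suc y) (suc z)
          pointwise z = ≤-trans (≤-reflexive (sym (*-identityˡ (cross w z * cross y z))))
            (𝟙-×₃ (yes wy) (cross? w z) (cross? y z) λ wy wz yz → ≤-reflexive (sym (cong₂ _*_
              (𝟙-yes (codeg H (suc y) (suc z) ≤? s * s) (≤-trans (cross⇒codeg≤σ yz) (≤-reflexive σ≡)))
              (T⇒𝟙≡1 (edge (cross-edge yz (cross-sym wz) (cross-sym wy)))))))
      large-degree : (2 * σ ∸ β) * rt k (σ ∸ 2 * β) ≤ sum (λ z → rt k (codeg H (suc w) z))
      large-degree = begin
        (2 * σ ∸ β) * rt k (σ ∸ 2 * β)
          ≤⟨ *-monoˡ-≤ (rt k (σ ∸ 2 * β)) (crossDeg w) ⟩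
        sum (cross w) * rt k (σ ∸ 2 * β)
          ≡⟨ *-distribʳ-sum (rt k (σ ∸ 2 * β)) (cross w) ⟩
        sum (λ y → cross w y * rt k (σ ∸ 2 * β))
          ≤⟨ sum-mono (λ y → pointwise y (cross? w y)) ⟩
        sum (λ y → rt k (codeg H (suc w) (suc y)))
          ≤⟨ m≤n+m _ (rt k (codeg H (suc w) zero)) ⟩
        sum (λ z → rt k (codeg H (suc w) z)) ∎
        where
        pointwise : ∀ y → (wy? : Dec (Cross w y)) →
                    𝟙 (does wy?) * rt k (σ ∸ 2 * β) ≤ rt k (codeg H (suc w) (suc y))
        pointwise y (no  _)  = z≤n
        pointwise y (yes wy) = ≤-trans (≤-reflexive (*-identityˡ (rt k (σ ∸ 2 * β)))) (rt-mono k (cross⇒codeg≥ wy))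

-- Degrees of the construction with cells of size 9u

lower-arithmetic : ∀ u → 2 ≤ u → ∀ k .{{_ : NonZero k}} X Y N → N * N ≤ k →
  2 * (3 * u) * (2 * X) + k * ((2 * (u * (9 * u)) ∸ 9 * u) * (u * (9 * u) ∸ 2 * (9 * u))) +
  2 * (3 * u) * (2 * ((2 * (u * (9 * u)) ∸ 9 * u) * rt k (u * (9 * u) ∸ 2 * (9 * u))))
    ≤ 2 * (3 * u) * (2 * Y) + N * (N * (2 * (3 * u))) →
  10 * (3 * u) ^ 3 * k + 4 * X ≤ 4 * Y + 77 * (3 * u) ^ 2 * k
lower-arithmetic u@(suc (suc t)) (s≤s (s≤s z≤n)) k X Y N N²≤k h = *-cancelˡ-≤ s (begin
    s * (10 * s ^ 3 * k + 4 * X)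
      ≡⟨ solve 3 (λ u k X → con 3 :* u :* (con 10 :* (con 3 :* u) :^ 3 :* k :+ con 4 :* X)
           := con 810 :* u :^ 4 :* k :+ con 12 :* u :* X) refl u k X ⟩
    810 * u ^ 4 * k + 12 * u * X
      -- The padding makes the next identity exact: with t = u - 2 one has 405u²(2u - 1)(u - 2) =
      -- 810u⁴ - 2025u³ + 810u².
      ≤⟨ m≤m+n _ (810 * u ^ 2 * k) ⟩
    810 * u ^ 4 * k + 12 * u * X + 810 * u ^ 2 * k
      ≡⟨ solve 3 (λ t k X → let u = con 2 :+ t in
           con 810 :* u :^ 4 :* k :+ con 12 :* u :* X :+ con 810 :* u :^ 2 :* k
           := con 2 :* (con 3 :* u) :* (con 2 :* X) :+ k :* (con 9 :* u :* (con 3 :+ con 2 :* t) :* (con 9 :* u :* t))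
              :+ con 2 :* (con 3 :* u) :* (con 2 :* (con 9 :* u :* (con 3 :+ con 2 :* t) :* (con 3 :* t :* k)))
              :+ con 2025 :* u :^ 3 :* k) refl t k X ⟩
    2 * s * (2 * X) + k * (A * B) + 2 * s * (2 * (A * (3 * t * k))) + 2025 * u ^ 3 * k
      ≤⟨ +-monoˡ-≤ (2025 * u ^ 3 * k) (+-monoʳ-≤ (2 * s * (2 * X) + k * (A * B))
           (*-monoʳ-≤ (2 * s) (*-monoʳ-≤ 2 (*-monoʳ-≤ A 3tk≤)))) ⟩
    2 * s * (2 * X) + k * (A * B) + 2 * s * (2 * (A * rt k B)) + 2025 * u ^ 3 * k
      ≡⟨ cong₂ (λ a b → 2 * s * (2 * X) + k * (a * b) + 2 * s * (2 * (a * rt k b)) + 2025 * u ^ 3 * k) A≡ B≡ ⟨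
    2 * s * (2 * X) + k * ((2 * σ ∸ β) * (σ ∸ 2 * β)) + 2 * s * (2 * ((2 * σ ∸ β) * rt k (σ ∸ 2 * β))) + 2025 * u ^ 3 * k
      ≤⟨ +-monoˡ-≤ (2025 * u ^ 3 * k) h ⟩
    2 * s * (2 * Y) + N * (N * (2 * s)) + 2025 * u ^ 3 * k
      -- The rounding costs at most 54u³k, and 54 + 2025 = 27 · 77; dividing by s = 3u leaves the
      -- error 77s²k.
      ≤⟨ +-monoˡ-≤ (2025 * u ^ 3 * k) (+-monoʳ-≤ (2 * s * (2 * Y)) error) ⟩
    2 * s * (2 * Y) + 54 * u ^ 3 * k + 2025 * u ^ 3 * k
      ≡⟨ solve 3 (λ u k Y → con 2 :* (con 3 :* u) :* (con 2 :* Y) :+ con 54 :* u :^ 3 :* k :+ con 2025 :* u :^ 3 :* k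
           := con 3 :* u :* (con 4 :* Y :+ con 77 :* (con 3 :* u) :^ 2 :* k)) refl u k Y ⟩
    s * (4 * Y + 77 * s ^ 2 * k) ∎)
    where
    open ≤-Reasoning
    open +-*-Solver
    s = 3 * u
    β = 9 * u
    σ = u * β
    A = 9 * u * (3 + 2 * t)
    B = 9 * u * t
    A≡ : 2 * σ ∸ β ≡ A
    A≡ = trans (cong (_∸ β) (solve 1 (λ t → let u = con 2 :+ t in
      con 2 :* (u :* (con 9 :* u)) := con 9 :* u :* (con 3 :+ con 2 :* t) :+ con 9 :* u) refl t)) (m+n∸n≡m A β)
    B≡ : σ ∸ 2 * β ≡ B
    B≡ = trans (cong (_∸ 2 * β) (solve 1 (λ t → let u = con 2 :+ t in
      u :* (con 9 :* u) := con 9 :* u :* t :+ con 2 :* (con 9 :* u)) refl t)) (m+n∸n≡m B (2 * β))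
    -- Since B = 9ut ≥ 9t², the root is at least 3t = s - 6.
    3tk≤ : 3 * t * k ≤ rt k B
    3tk≤ = rt-greatest {k} {B} (begin
      3 * t * k * (3 * t * k)
        ≡⟨ solve 2 (λ t k → con 3 :* t :* k :* (con 3 :* t :* k) := con 9 :* t :* t :* (k :* k)) refl t k ⟩
      9 * t * t * (k * k)
        ≤⟨ *-monoˡ-≤ (k * k) (*-monoˡ-≤ t (*-monoʳ-≤ 9 (m≤n+m t 2))) ⟩
      B * (k * k) ∎)
    error : N * (N * (2 * s)) ≤ 54 * u ^ 3 * k
    error = begin
      N * (N * (2 * s))    ≡⟨ *-assoc N N (2 * s) ⟨
      N * N * (2 * s)      ≤⟨ *-monoˡ-≤ (2 * s) N²≤k ⟩
      k * (2 * s)          ≡⟨ solve 2 (λ u k → k :* (con 2 :* (con 3 :* u)) := con 6 :* (u :* (con 1 :* con 1)) :* k) refl u k ⟩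
      6 * (u * (1 * 1)) * k  ≤⟨ *-monoˡ-≤ k (*-mono-≤ (m≤m+n 6 48) (*-monoʳ-≤ u (*-mono-≤ {1} {u} {1} {u * 1} 1≤u (s≤s z≤n)))) ⟩
      54 * (u * (u * (u * 1))) * k ∎
      where
      1≤u : 1 ≤ u
      1≤u = s≤s z≤n

module _ (u : ℕ) (2≤u : 2 ≤ u) (omitted : Fin u → Fin 3) where

  private
    s : ℕ
    s = 3 * u

  open Construction u (9 * u) omitted

  -- The 81u³ = 3s³ link pairs are worth 12s³k on the scale of 4 `norm`, against the 10s³k required.
  -- Cells of size 9u give this margin and make `σ` = 9u² a square.
  norm-lower-zero : ∀ k .{{_ : NonZero k}} →
    10 * s ^ 3 * k + 4 * norm k (H ∖ zero) ≤ 4 * norm k H + 77 * s ^ 2 * k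
  norm-lower-zero k = begin
    10 * s ^ 3 * k + 4 * X
      ≡⟨ solve 3 (λ u k X → con 10 :* (con 3 :* u) :^ 3 :* k :+ con 4 :* X
                      := con 270 :* u :^ 3 :* k :+ con 4 :* X) refl u k X ⟩
    270 * u ^ 3 * k + 4 * X
      ≤⟨ +-monoˡ-≤ (4 * X) (*-monoˡ-≤ k (*-monoˡ-≤ (u ^ 3) (m≤m+n 270 54))) ⟩
    324 * u ^ 3 * k + 4 * X
      ≡⟨ solve 3 (λ u k X → con 324 :* u :^ 3 :* k :+ con 4 :* X
           := con 2 :* (con 2 :* X :+ k :* (con 2 :* (u :* (con 9 :* u :* (con 9 :* u)))))) refl u k X ⟩
    2 * (2 * X + k * (2 * (u * (9 * u * (9 * u)))))
      ≤⟨ *-monoʳ-≤ 2 (norm-∖zero k) ⟩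
    2 * (2 * Y)
      ≡⟨ *-assoc 2 2 Y ⟨
    4 * Y
      ≤⟨ m≤m+n (4 * Y) (77 * s ^ 2 * k) ⟩
    4 * Y + 77 * s ^ 2 * k ∎
    where
    open ≤-Reasoning
    open +-*-Solver
    X = norm k (H ∖ zero)
    Y = norm k H

  norm-lower-suc : ∀ k .{{_ : NonZero k}} → N * N ≤ k → ∀ w →
    10 * s ^ 3 * k + 4 * norm k (H ∖ suc w) ≤ 4 * norm k H + 77 * s ^ 2 * k
  norm-lower-suc k N²≤k w = lower-arithmetic u 2≤u k (norm k (H ∖ suc w)) (norm k H) N N²≤k
    (norm-∖suc k w s (solve 1 (λ u → u :* (con 9 :* u) := con 3 :* u :* (con 3 :* u)) refl u))
    where open +-*-Solver

  norm-lower : ∀ k .{{_ : NonZero k}} → N * N ≤ k → ∀ v →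
    10 * s ^ 3 * k + 4 * norm k (H ∖ v) ≤ 4 * norm k H + 77 * s ^ 2 * k
  norm-lower k N²≤k zero    = norm-lower-zero k
  norm-lower k N²≤k (suc w) = norm-lower-suc k N²≤k w

-- Approximations of the real quantities

+/ : ∀ a b j → (ℤ.+ a) ℚ./ suc j ℚ.+ (ℤ.+ b) ℚ./ suc j ≡ (ℤ.+ (a + b)) ℚ./ suc j
+/ a b j = ℚ.toℚᵘ-injective (ℚᵘ.≃-trans (ℚ.toℚᵘ-homo-+ ((ℤ.+ a) ℚ./ suc j) ((ℤ.+ b) ℚ./ suc j))
  (ℚᵘ.≃-trans (ℚᵘ.+-cong (ℚ.toℚᵘ-fromℚᵘ (mkℚᵘ (ℤ.+ a) j)) (ℚ.toℚᵘ-fromℚᵘ (mkℚᵘ (ℤ.+ b) j)))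
  (ℚᵘ.≃-trans (*≡* lem) (ℚᵘ.≃-sym (ℚ.toℚᵘ-fromℚᵘ (mkℚᵘ (ℤ.+ (a + b)) j))))))
  where
  open ℤ.+-*-Solver
  lem : (ℤ.+ a ℤ.* ℤ.+ suc j ℤ.+ ℤ.+ b ℤ.* ℤ.+ suc j) ℤ.* ℤ.+ suc j ≡ ℤ.+ (a + b) ℤ.* ℤ.+ (suc j * suc j)
  lem = trans (solve 3 (λ a b d → (a :* d :+ b :* d) :* d := (a :+ b) :* (d :* d)) refl (ℤ.+ a) (ℤ.+ b) (ℤ.+ suc j))
    (sym (cong₂ ℤ._*_ (ℤ.pos-+ a b) (ℤ.pos-* (suc j) (suc j))))

*/ : ∀ a b i j → (ℤ.+ a) ℚ./ suc i ℚ.* ((ℤ.+ b) ℚ./ suc j) ≡ (ℤ.+ (a * b)) ℚ./ (suc i * suc j)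
*/ a b i j = ℚ.toℚᵘ-injective (ℚᵘ.≃-trans (ℚ.toℚᵘ-homo-* ((ℤ.+ a) ℚ./ suc i) ((ℤ.+ b) ℚ./ suc j))
  (ℚᵘ.≃-trans (ℚᵘ.*-cong (ℚ.toℚᵘ-fromℚᵘ (mkℚᵘ (ℤ.+ a) i)) (ℚ.toℚᵘ-fromℚᵘ (mkℚᵘ (ℤ.+ b) j)))
  (ℚᵘ.≃-trans (*≡* (cong (ℤ._* ℤ.+ (suc i * suc j)) (sym (ℤ.pos-* a b))))
    (ℚᵘ.≃-sym (ℚ.toℚᵘ-fromℚᵘ (mkℚᵘ (ℤ.+ (a * b)) (j + i * suc j)))))))

0≤/ : ∀ a j → 0ℚ ℚ.≤ (ℤ.+ a) ℚ./ suc j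
0≤/ a j = /-≤ 0 a 0 j z≤n

-- At index i all roots are approximated with the common denominator i + 1, so the approximation of
-- the norm is exactly the sum of the rounded roots, and the bounds on `norm` apply index by index.
seq-norm₂ : (H : ThreeGraph n) (i : ℕ) → seq (norm₂ ½ H) i ≡ (ℤ.+ norm (suc i) H) ℚ./ suc i
seq-norm₂ {n} H i = go (subsetsOfSize 2 n)
  where
  go : ∀ Ss → seq (sumℝ (map (λ S → deg H S ^ℝ ½) Ss)) i ≡ (ℤ.+ sumOver (rt (suc i) ∘ deg H) Ss) ℚ./ suc i
  go []       = ℚ.≤-antisym (0≤/ 0 i) (/-≤ 0 0 i 0 z≤n)
  go (S ∷ Ss) = trans (cong (seq (deg H S ^ℝ ½) i ℚ.+_) (go Ss))
    (+/ (rt (suc i) (deg H S)) (sumOver (rt (suc i) ∘ deg H) Ss) i)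

seq-max-≤ : (q : ℚ) (i : ℕ) {A : Set} (f : A → ℝ) {as : List A} → 0ℚ ℚ.≤ q →
            All (λ a → seq (f a) i ℚ.≤ q) as → seq (foldr _⊔ℝ_ 0ℝ (map f as)) i ℚ.≤ q
seq-max-≤ q i f 0≤q []       = 0≤q
seq-max-≤ q i f 0≤q (h ∷ hs) = ℚ.⊔-lub h (seq-max-≤ q i f 0≤q hs)

seq-max-≥0 : (i : ℕ) (xs : List ℝ) → 0ℚ ℚ.≤ seq (foldr _⊔ℝ_ 0ℝ xs) i
seq-max-≥0 i []       = ℚ.≤-refl
seq-max-≥0 i (x ∷ xs) = ℚ.≤-trans (seq-max-≥0 i xs) (ℚ.p≤q⊔p (seq x i) (seq (foldr _⊔ℝ_ 0ℝ xs) i))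

seq-min-≥ : (q : ℚ) (i : ℕ) (x : Fin (suc n) → ℝ) → (∀ v → q ℚ.≤ seq (x v) i) → q ℚ.≤ seq (minℝ x) i
seq-min-≥ {zero}  q i x h = h zero
seq-min-≥ {suc n} q i x h = subst (ℚ._≤ seq (minℝ x) i) (solve 1 (λ q → :- (:- q) := q) refl q)
  (ℚ.neg-antimono-≤ (ℚ.⊔-lub (ℚ.neg-antimono-≤ (h zero)) (ℚ.neg-antimono-≤ (seq-min-≥ q i (x ∘ suc) (h ∘ suc)))))
  where open ℚ.+-*-Solver

seq-ex₂-≤ : ∀ s .{{_ : NonZero s}} → n ≡ suc (3 * (s * s)) → ∀ U → 3 * s ^ 5 + 65 * s ^ 4 ≤ U → ∀ i →
            seq (ex₂ ½ F₅ n) i ℚ.≤ (ℤ.+ U) ℚ./ 1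
seq-ex₂-≤ {n} s n≡ U ≤U i =
  seq-max-≤ ((ℤ.+ U) ℚ./ 1) i (norm₂ ½) (0≤/ U 0) (All.map (λ {H} → bound H) (all-filter (F₅ isFree?_) (threeGraphs n)))
  where
  bound : ∀ H → F₅ IsFree H → seq (norm₂ ½ H) i ℚ.≤ (ℤ.+ U) ℚ./ 1
  bound H free = subst (ℚ._≤ (ℤ.+ U) ℚ./ 1) (sym (seq-norm₂ H i)) (/-≤ (norm (suc i) H) U i 0 (begin
    norm (suc i) H * 1                    ≡⟨ *-identityʳ (norm (suc i) H) ⟩
    norm (suc i) H                        ≤⟨ norm-upper H free s n≡ (suc i) ⟩
    suc i * (3 * s ^ 5 + 65 * s ^ 4)      ≤⟨ *-monoʳ-≤ (suc i) ≤U ⟩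
    suc i * U                             ≡⟨ *-comm (suc i) U ⟩
    U * suc i                             ∎))
    where open ≤-Reasoning

subtrahend : ∀ {p q r : ℚ} → p ≡ q ℚ.+ r → r ≡ p ℚ.- q
subtrahend {q = q} {r} refl = solve 2 (λ q r → r := (q :+ r) :- q) refl q r
  where open ℚ.+-*-Solver

-- Writing Y as X + e turns the subtraction in `deg₂` into a fraction with natural numerator.
difference-≥ : ∀ X Y d i → d * suc i + 4 * X ≤ 4 * Y →
               ∃ λ e → (ℤ.+ d) ℚ./ 4 ℚ.≤ (ℤ.+ e) ℚ./ suc i × Y ≡ X + e
difference-≥ X Y d i h with e , refl ← m≤n⇒∃[o]m+o≡n {X} {Y} (*-cancelˡ-≤ 4 (m+n≤o⇒n≤o (d * suc i) h)) =
  e , /-≤ d e 3 i (+-cancelʳ-≤ (4 * X) (d * suc i) (e * 4) (≤-trans h (≤-reflexive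
    (solve 2 (λ X e → con 4 :* (X :+ e) := e :* con 4 :+ con 4 :* X) refl X e)))) , refl
  where open +-*-Solver

seq-deg₂-≥ : ∀ (H : ThreeGraph (suc n)) v d i → d * suc i + 4 * norm (suc i) (H ∖ v) ≤ 4 * norm (suc i) H →
             (ℤ.+ d) ℚ./ 4 ℚ.≤ seq (deg₂ ½ H v) i
seq-deg₂-≥ H v d i h =
  let e , d/4≤ , Y≡ = difference-≥ (norm (suc i) (H ∖ v)) (norm (suc i) H) d i h in
  subst ((ℤ.+ d) ℚ./ 4 ℚ.≤_) (subtrahend {seq (norm₂ ½ H) i} {seq (norm₂ ½ (H ∖ v)) i} (split e Y≡)) d/4≤
  where
  split : ∀ e → norm (suc i) H ≡ norm (suc i) (H ∖ v) + e →
          seq (norm₂ ½ H) i ≡ seq (norm₂ ½ (H ∖ v)) i ℚ.+ (ℤ.+ e) ℚ./ suc i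
  split e Y≡ = trans (seq-norm₂ H i) (trans (cong (λ Y → (ℤ.+ Y) ℚ./ suc i) Y≡)
    (trans (sym (+/ (norm (suc i) (H ∖ v)) e i)) (cong (ℚ._+ (ℤ.+ e) ℚ./ suc i) (sym (seq-norm₂ (H ∖ v) i)))))

-- Choice of the parameters and the counterexample

Blocks : ℕ → Set
Blocks u = ∃ λ (omitted : Fin u → Fin 3) → Fin (9 * u) × ∃ λ a → ∃ λ b → ∃ λ c →
  a ≢ b × b ≢ c × a ≢ c × omitted a ≡ 1F × omitted b ≡ 0F × omitted c ≡ 1F

-- One block omits colour 0 and all others colour 1, so links join colours 1 and 2 or colours 0 and
-- 2. Every colour thus has linked vertices, and three blocks allow them to be picked from different
-- blocks.
blocks : ∀ u → 3 ≤ u → Blocks u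
blocks (suc (suc (suc u))) (s≤s (s≤s (s≤s z≤n))) =
  (λ { zero → 0F ; (suc _) → 1F }) , zero , 1F , 0F , 2F , (λ ()) , (λ ()) , (λ ()) , refl , refl , refl

-- With denominators cleared, this compares j/(j+1) · (5/2)U/(n+1) with d/4. The leading terms are
-- 60js⁵ and 60(j+1)s⁵. The gap 60s⁵ has to absorb 20 · 65js⁴ + 6 · 77(j+1)s⁴ = (1762j + 462)s⁴, and
-- s ≥ 30(j+1) achieves that.
exdeg-numerator : ∀ j s → 30 * suc j ≤ s → ∀ d → 10 * s ^ 3 ≤ d + 77 * s ^ 2 → 
  ∀ U → U ≡ 3 * s ^ 5 + 65 * s ^ 4 → ∀ n → n ≡ 3 * (s * s) →
  j * (5 * U * 1) * 4 ≤ d * (suc j * (2 * 1 * suc n))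
exdeg-numerator j s 30j≤s d d≥ _ refl _ refl = ≤-trans (+-cancelʳ-≤ (462 * suc j * s ^ 4) _ _ (begin
  j * (5 * (3 * s ^ 5 + 65 * s ^ 4) * 1) * 4 + 462 * suc j * s ^ 4
    ≡⟨ solve 2 (λ j s → j :* (con 5 :* (con 3 :* s :^ 5 :+ con 65 :* s :^ 4) :* con 1) :* con 4 :+ con 462 :* (con 1 :+ j) :* s :^ 4
         := con 60 :* j :* s :^ 5 :+ (con 1762 :* j :+ con 462) :* s :^ 4) refl j s ⟩
  60 * j * s ^ 5 + (1762 * j + 462) * s ^ 4
    ≤⟨ +-monoʳ-≤ (60 * j * s ^ 5) (*-monoˡ-≤ (s ^ 4) (begin
         1762 * j + 462        ≤⟨ +-mono-≤ (*-monoˡ-≤ j (m≤m+n 1762 38)) (m≤m+n 462 1338) ⟩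
         1800 * j + 1800       ≡⟨ solve 1 (λ j → con 1800 :* j :+ con 1800 := con 60 :* (con 30 :* (con 1 :+ j))) refl j ⟩
         60 * (30 * suc j)     ≤⟨ *-monoʳ-≤ 60 30j≤s ⟩
         60 * s                ∎)) ⟩
  60 * j * s ^ 5 + 60 * s * s ^ 4
    ≡⟨ solve 2 (λ j s → con 60 :* j :* s :^ 5 :+ con 60 :* s :* s :^ 4 := con 6 :* (con 1 :+ j) :* s :^ 2 :* (con 10 :* s :^ 3)) refl j s ⟩
  6 * suc j * s ^ 2 * (10 * s ^ 3)
    ≤⟨ *-monoʳ-≤ (6 * suc j * s ^ 2) d≥ ⟩
  6 * suc j * s ^ 2 * (d + 77 * s ^ 2)
    ≡⟨ solve 3 (λ j s d → con 6 :* (con 1 :+ j) :* s :^ 2 :* (d :+ con 77 :* s :^ 2)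
         := d :* ((con 1 :+ j) :* (con 2 :* con 1 :* (con 3 :* (s :* s)))) :+ con 462 :* (con 1 :+ j) :* s :^ 4) refl j s d ⟩
  d * (suc j * (2 * 1 * (3 * (s * s)))) + 462 * suc j * s ^ 4 ∎))
  (*-monoʳ-≤ d (*-monoʳ-≤ (suc j) (*-monoʳ-≤ 2 (n≤1+n (3 * (s * s))))))
  where
  open ≤-Reasoning
  open +-*-Solver

-- The factor 1 - ε may be negative, so it is raised to j/(j+1) first, against the nonnegative y;
-- only then is x replaced by its upper bound.
threshold : ∀ j U d n ε x → 0ℚ ℚ.≤ x → x ℚ.≤ (ℤ.+ U) ℚ./ 1 → (ℤ.+ 1) ℚ./ suc j ℚ.≤ ε →
  j * (5 * U * 1) * 4 ≤ d * (suc j * (2 * 1 * suc n)) →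
  (1ℚ ℚ.- ε) ℚ.* (((ℤ.+ 2) ℚ./ 1 ℚ.+ ½) ℚ.* x ℚ.* ((ℤ.+ 1) ℚ./ suc n)) ℚ.≤ (ℤ.+ d) ℚ./ 4
threshold j U d n ε x 0≤x x≤U 1/j≤ε h = begin
  (1ℚ ℚ.- ε) ℚ.* y
    ≤⟨ ℚ.*-monoʳ-≤-nonNeg y {{ℚ.nonNegative 0≤y}} 1-ε≤ ⟩
  (ℤ.+ j) ℚ./ suc j ℚ.* y
    ≤⟨ ℚ.*-monoˡ-≤-nonNeg ((ℤ.+ j) ℚ./ suc j) {{ℚ.nonNegative (0≤/ j j)}} y≤ ⟩
  (ℤ.+ j) ℚ./ suc j ℚ.* ((ℤ.+ (5 * U * 1)) ℚ./ (2 * 1 * suc n))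
    ≡⟨ */ j (5 * U * 1) j (n + 1 * suc n) ⟩
  (ℤ.+ (j * (5 * U * 1))) ℚ./ (suc j * (2 * 1 * suc n))
    ≤⟨ /-≤ (j * (5 * U * 1)) d _ 3 h ⟩
  (ℤ.+ d) ℚ./ 4 ∎
  where
  open ℚ.≤-Reasoning
  c = (ℤ.+ 5) ℚ./ 2
  1/n = (ℤ.+ 1) ℚ./ suc n
  y = c ℚ.* x ℚ.* 1/n
  cx≥0 : 0ℚ ℚ.≤ c ℚ.* x
  cx≥0 = subst (ℚ._≤ c ℚ.* x) (ℚ.*-zeroʳ c) (ℚ.*-monoˡ-≤-nonNeg c 0≤x)
  0≤y : 0ℚ ℚ.≤ y
  0≤y = subst (ℚ._≤ y) (ℚ.*-zeroˡ 1/n) (ℚ.*-monoʳ-≤-nonNeg 1/n {{ℚ.nonNegative (0≤/ 1 n)}} cx≥0)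
  y≤ : y ℚ.≤ (ℤ.+ (5 * U * 1)) ℚ./ (2 * 1 * suc n)
  y≤ = ℚ.≤-trans (ℚ.*-monoʳ-≤-nonNeg 1/n {{ℚ.nonNegative (0≤/ 1 n)}} (ℚ.*-monoˡ-≤-nonNeg c x≤U))
    (ℚ.≤-reflexive (trans (cong (ℚ._* 1/n) (*/ 5 U 1 0)) (*/ (5 * U) 1 1 n)))
  1-ε≤ : 1ℚ ℚ.- ε ℚ.≤ (ℤ.+ j) ℚ./ suc j
  1-ε≤ = ≤+⇒-≤ {(ℤ.+ j) ℚ./ suc j} 1ℚ ε (ℚ.≤-trans
    (ℚ.≤-reflexive (trans 1≡ (suc/ j j)))
    (ℚ.≤-trans (ℚ.+-monoʳ-≤ ((ℤ.+ j) ℚ./ suc j) 1/j≤ε) (ℚ.≤-reflexive (ℚ.+-comm ((ℤ.+ j) ℚ./ suc j) ε))))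
    where
    1≡ : 1ℚ ≡ (ℤ.+ suc j) ℚ./ suc j
    1≡ = ℚ.≤-antisym (/-≤ 1 (suc j) 0 j (≤-reflexive (*-comm 1 (suc j)))) (/-≤ (suc j) 1 j 0 (≤-reflexive (*-comm (suc j) 1)))

-- The rational d/4 separates the two sides at every index beyond `M` and `K`.
meets-threshold : ∀ {n} (H : ThreeGraph (suc n)) (ε : ℝ) {ε₀ : ℚ} → 0ℚ ℚ.< ε₀ →
  ∀ M → (∀ i → M ≤ i → 0ℚ ℚ.+ ε₀ ℚ.≤ seq ε i) →
  ∀ K s .{{_ : NonZero s}} → n ≡ 3 * (s * s) → ∀ U d → 3 * s ^ 5 + 65 * s ^ 4 ≤ U →
  (∀ i → K ≤ i → ∀ v → d * suc i + 4 * norm (suc i) (H ∖ v) ≤ 4 * norm (suc i) H) →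
  ↧ₙ ε₀ * (5 * U * 1) * 4 ≤ d * (suc (↧ₙ ε₀) * (2 * 1 * suc n)) →
  (1ℝ -ℝ ε) *ℝ exdeg₂ ½ F₅ (suc n) ≤ℝ δ₂ ½ H
meets-threshold {n} H ε {ε₀} 0<ε₀ M ε₀≤ε K s n≡ U d ≤U loss h η 0<η = M ⊔ K , λ i M⊔K≤i →
  ℚ.≤-trans (bound i (m⊔n≤o⇒m≤o M K M⊔K≤i) (m⊔n≤o⇒n≤o M K M⊔K≤i))
    (ℚ.≤-trans (ℚ.≤-reflexive (sym (ℚ.+-identityʳ (seq (δ₂ ½ H) i)))) (ℚ.+-monoʳ-≤ (seq (δ₂ ½ H) i) (ℚ.<⇒≤ 0<η)))
  where
  bound : ∀ i → M ≤ i → K ≤ i → seq ((1ℝ -ℝ ε) *ℝ exdeg₂ ½ F₅ (suc n)) i ℚ.≤ seq (δ₂ ½ H) i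
  bound i M≤i K≤i = ℚ.≤-trans
    (threshold (↧ₙ ε₀) U d n (seq ε i) (seq (ex₂ ½ F₅ (suc n)) i)
      (seq-max-≥0 i (map (norm₂ ½) (filter (F₅ isFree?_) (threeGraphs (suc n)))))
      (seq-ex₂-≤ s (cong suc n≡) U ≤U i)
      (ℚ.≤-trans (1/suc≤ 0<ε₀ (↧ₙ ε₀) ≤-refl) (ℚ.≤-trans (ℚ.≤-reflexive (sym (ℚ.+-identityˡ ε₀))) (ε₀≤ε i M≤i)))
      h)
    (seq-min-≥ ((ℤ.+ d) ℚ./ 4) i (deg₂ ½ H) λ v → seq-deg₂-≥ H v d i (loss i K≤i v))

77s²≤10s³ : ∀ {s} → 30 ≤ s → 77 * s ^ 2 ≤ 10 * s ^ 3
77s²≤10s³ {s} 30≤s = begin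
  77 * s ^ 2           ≤⟨ *-monoˡ-≤ (s ^ 2) (m≤m+n 77 223) ⟩
  10 * 30 * s ^ 2      ≤⟨ *-monoˡ-≤ (s ^ 2) (*-monoʳ-≤ 10 30≤s) ⟩
  10 * s * s ^ 2       ≡⟨ *-assoc 10 s (s ^ 2) ⟩
  10 * s ^ 3           ∎
  where open ≤-Reasoning

cancel-error : ∀ {A B} d k X Y → d + B ≡ A → A * k + 4 * X ≤ 4 * Y + B * k → d * k + 4 * X ≤ 4 * Y
cancel-error {B = B} d k X Y refl h = +-cancelʳ-≤ (B * k) (d * k + 4 * X) (4 * Y) (≤-trans (≤-reflexive
  (solve 4 (λ d B k X → d :* k :+ con 4 :* X :+ B :* k := (d :+ B) :* k :+ con 4 :* X) refl d B k X)) h)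
  where open +-*-Solver

30j≤s : ∀ j u → 10 * suc j ≤ u → 30 * suc j ≤ 3 * u
30j≤s j u 10j≤u = ≤-trans (≤-reflexive (*-assoc 3 10 (suc j))) (*-monoʳ-≤ 3 10j≤u)

Counterexample : ℝ → ℕ → Set
Counterexample ε N₀ = ∃ λ n → ∃ λ (G : ThreeGraph (suc n)) →
  N₀ ≤ suc n × F₅ IsFree G × (1ℝ -ℝ ε) *ℝ exdeg₂ ½ F₅ (suc n) ≤ℝ δ₂ ½ G × ThreePartite (G ∖ zero) × ¬ ThreePartite G

mk-counterexample : ∀ {n} (H : ThreeGraph (suc n)) (ε : ℝ) {ε₀ : ℚ} → 0ℚ ℚ.< ε₀ →
  ∀ M → (∀ i → M ≤ i → 0ℚ ℚ.+ ε₀ ℚ.≤ seq ε i) →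
  ∀ K s .{{_ : NonZero s}} → n ≡ 3 * (s * s) → ∀ U d → 3 * s ^ 5 + 65 * s ^ 4 ≤ U →
  (∀ i → K ≤ i → ∀ v → d * suc i + 4 * norm (suc i) (H ∖ v) ≤ 4 * norm (suc i) H) →
  ↧ₙ ε₀ * (5 * U * 1) * 4 ≤ d * (suc (↧ₙ ε₀) * (2 * 1 * suc n)) →
  ∀ {N₀} → N₀ ≤ suc n → F₅ IsFree H → ThreePartite (H ∖ zero) → ¬ ThreePartite H → Counterexample ε N₀
mk-counterexample {n} H ε 0<ε₀ M ε₀≤ε K s n≡ U d ≤U loss h N₀≤n free deleted ¬threePartite =
  n , H , N₀≤n , free , meets-threshold H ε 0<ε₀ M ε₀≤ε K s n≡ U d ≤U loss h , deleted , ¬threePartite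

module _ (ε : ℝ) (ε₀ : ℚ) (0<ε₀ : 0ℚ ℚ.< ε₀) (M : ℕ) (ε₀≤ε : ∀ i → M ≤ i → 0ℚ ℚ.+ ε₀ ℚ.≤ seq ε i)
         (u : ℕ) (3≤u : 3 ≤ u) (u-large : 10 * suc (↧ₙ ε₀) ≤ u) (omitted : Fin u → Fin 3)
         (d U : ℕ) (d+77s²≡10s³ : d + 77 * (3 * u) ^ 2 ≡ 10 * (3 * u) ^ 3)
         (U≡ : U ≡ 3 * (3 * u) ^ 5 + 65 * (3 * u) ^ 4) where

  private
    s : ℕ
    s = 3 * u

  open Construction u (9 * u) omitted

  N≡3s² : N ≡ 3 * (s * s)
  N≡3s² = solve 1 (λ u → con 3 :* (u :* (con 9 :* u)) := con 3 :* (con 3 :* u :* (con 3 :* u))) refl u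
    where open +-*-Solver

  loss : ∀ i → N * N ≤ i → ∀ v → d * suc i + 4 * norm (suc i) (H ∖ v) ≤ 4 * norm (suc i) H
  loss i N²≤i v = cancel-error {10 * s ^ 3} {77 * s ^ 2} d (suc i) (norm (suc i) (H ∖ v)) (norm (suc i) H) d+77s²≡10s³
      (norm-lower u (<⇒≤ 3≤u) omitted (suc i) (≤-trans N²≤i (n≤1+n i)) v)

  numerator : (↧ₙ ε₀) * (5 * U * 1) * 4 ≤ d * (suc (↧ₙ ε₀) * (2 * 1 * suc N))
  numerator = exdeg-numerator (↧ₙ ε₀) s (30j≤s (↧ₙ ε₀) u u-large) d (≤-reflexive (sym d+77s²≡10s³)) U U≡ N N≡3s²

  u≤N : u ≤ suc N
  u≤N = ≤-trans (m≤m*n u (9 * u) {{m*n≢0 9 u {{_}} {{>-nonZero (<⇒≤ (<⇒≤ 3≤u))}}}}) (≤-trans (m≤n*m (u * (9 * u)) 3) (n≤1+n N))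

  counterexample-at : ∀ {N₀} → N₀ ≤ u → Fin (9 * u) → ∀ {a b c} → a ≢ b → b ≢ c → a ≢ c →
                      omitted a ≡ 1F → omitted b ≡ 0F → omitted c ≡ 1F → Counterexample ε N₀
  counterexample-at N₀≤u z a≢b b≢c a≢c oa ob oc =
    mk-counterexample H ε 0<ε₀ M ε₀≤ε (N * N) s {{m*n≢0 3 u {{_}} {{>-nonZero (<⇒≤ (<⇒≤ 3≤u))}}}}
      N≡3s² U d (≤-reflexive (sym U≡)) loss numerator
      (≤-trans N₀≤u u≤N) F₅-free ∖zero-threePartite (not-threePartite z a≢b b≢c a≢c oa ob oc)

counterexample : ∀ ε → 0ℝ <ℝ ε → ∀ N₀ → Counterexample ε N₀
-- The size u must allow three blocks, reach `N₀`, and satisfy s = 3u ≥ 30(j+1).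
counterexample ε (ε₀ , 0<ε₀ , M , ε₀≤ε) N₀ = build (3 + (10 * suc j + N₀)) (m≤m+n 3 _)
  (≤-trans (m≤m+n (10 * suc j) N₀) (m≤n+m _ 3)) (≤-trans (m≤n+m N₀ (10 * suc j)) (m≤n+m _ 3))
  where
  -- The denominator of a positive rational satisfies 1/(j+1) ≤ ε₀.
  j = ↧ₙ ε₀
  build : ∀ u → 3 ≤ u → 10 * suc j ≤ u → N₀ ≤ u → Counterexample ε N₀
  build u 3≤u u-large N₀≤u =
    let omitted , z , a , b , c , a≢b , b≢c , a≢c , oa , ob , oc = blocks u 3≤u in
    counterexample-at ε ε₀ 0<ε₀ M ε₀≤ε u 3≤u u-large omitted
      -- Four times the degree that `norm-lower` guarantees at every vertex; s ≥ 30 ensures that the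
      -- subtraction is not truncated.
      (10 * (3 * u) ^ 3 ∸ 77 * (3 * u) ^ 2) (3 * (3 * u) ^ 5 + 65 * (3 * u) ^ 4)
      (m∸n+n≡m {10 * (3 * u) ^ 3} {77 * (3 * u) ^ 2} (77s²≤10s³ {3 * u} (≤-trans (*-monoʳ-≤ 30 {1} {suc j} (s≤s z≤n)) (30j≤s j u u-large)))) refl N₀≤u z a≢b b≢c a≢c oa ob oc

theoremA1 : ¬ VertexExtendable ½ F₅ 𝔎₃³
theoremA1 (ε , 0<ε , N₀ , extend) =
  let n , G , N₀≤n , free , degree , deleted , ¬threePartite = counterexample ε 0<ε N₀ in
  ¬threePartite (extend n N₀≤n G free degree (zero , deleted))
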